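{- Let $X_n$ be a finite Dynkin diagram (one of $A_n,B_n,C_n,D_n,E_6,E_7,E_8,F_4,G_2$) with set of positive roots $\Phi_+$. Let $U_{X_n}$ and $H_{X_n}$ be the filtered commutative rings defined in the context, and let $\rho: U_{X_n}\to H_{X_n}$ be the unique morphism of filtered rings with $\rho(u_\alpha)=h_\alpha$ for all $\alpha\in\Phi_+$. Then $\rho$ is an isomorphism of filtered rings between $U_{X_n}$ and $H_{X_n}$, i.e. $\rho$ is a ring isomorphism and $\rho(\mathcal{F}_k U_{X_n})=\mathcal{F}_k H_{X_n}$ for all $k\ge 0$.
   Context: Rings are commutative with unit. $\Phi_+$ is the set of positive roots of the (irreducible, reduced, crystallographic) root system of type $X_n$, with the partial order $\alpha\le\beta$ iff $\beta-\alpha$ has non-negative coefficients in the basis of simple roots. Roots are regarded as linear forms on a real vector space $V$ of dimension $n$ (the simple roots form a basis of $V^*$). The Shi arrangement is the collection of hyperplanes $\alpha(x)=0$ and $\alpha(x)=1$, $\alpha\in\Phi_+$. The dominant Weyl chamber is $\{x\in V:\alpha(x)>0\ \forall\alpha\in\Phi_+\}$. Ring $H_{X_n}$: the ring (pointwise operations) of locally constant integer-valued functions on the intersection of the dominant Weyl chamber with the complement of the union of the Shi hyperplanes. For $\alpha\in\Phi_+$, $h_\alpha\in H_{X_n}$ is the function with $h_\alpha(x)=1$ if $\alpha(x)>1$ and $h_\alpha(x)=0$ if $\alpha(x)<1$. Filtration: $\mathcal{F}_0H_{X_n}=\mathbb{Z}1$, $\mathcal{F}_1H_{X_n}$ is the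 $\mathbb{Z}$-linear span of $1$ and all $h_\alpha$, and $\mathcal{F}_kH_{X_n}=(\mathcal{F}_1H_{X_n})^k$ (the $\mathbb{Z}$-span of products of $k$ elements of $\mathcal{F}_1H_{X_n}$) for $k>1$. Ring $U_{X_n}$: the commutative ring (over $\mathbb{Z}$) generated by variables $u_\alpha$, $\alpha\in\Phi_+$, modulo the relations $u_\alpha u_\beta=u_{\min(\alpha,\beta)}$ for all $\alpha,\beta\in\Phi_+$ that are comparable for $\le$ (including $\alpha=\beta$, i.e. $u_\alpha^2=u_\alpha$). Filtration: $\mathcal{F}_0U_{X_n}=\mathbb{Z}1$, $\mathcal{F}_1U_{X_n}$ is the $\mathbb{Z}$-linear span of $1$ and all $u_\alpha$, and $\mathcal{F}_kU_{X_n}=(\mathcal{F}_1U_{X_n})^k$ for $k>1$. A morphism of filtered rings is a ring morphism mapping $\mathcal{F}_k$ into $\mathcal{F}_k$ for all $k$. -}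

module Defs where

open import Level using (0ℓ)
open import Algebra.Bundles using (CommutativeMonoid; CommutativeRing)
open import Algebra.Morphism.Structures using (module RingMorphisms)
import Algebra.Properties.AbelianGroup as AbelianGroupProperties
import Algebra.Properties.CommutativeSemigroup as CommutativeSemigroupProperties
open import Data.Bool.Base using (if_then_else_)
open import Data.Empty using (⊥; ⊥-elim)
open import Data.Fin.Base using (Fin; toℕ)
open import Data.Integer.Base as ℤ using (ℤ; +_; -[1+_]; 0ℤ; 1ℤ)
import Data.Integer.Properties as ℤₚ
open import Data.List.Base using (List)
open import Data.List.Membership.Propositional using (_∈_; _∉_)
open import Data.Nat.Base as ℕ using (ℕ; zero; suc; _≡ᵇ_)
import Data.Nat.Properties as ℕₚ
open import Data.Product.Base using (Σ; ∃; ∃-syntax; _×_; _,_; proj₁; proj₂)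
open import Data.Rational.Base as ℚ using (ℚ; 0ℚ; 1ℚ; ½)
import Data.Rational.Properties as ℚₚ
open import Data.Sum.Base using (_⊎_; inj₁; inj₂)
open import Data.Vec.Base as Vec using (Vec; []; _∷_; lookup; replicate; zipWith; foldr′; _[_]≔_)
open import Data.Vec.Relation.Binary.Pointwise.Inductive using (Pointwise; []; _∷_; head; tail)
import Data.Vec.Relation.Unary.All as VecAll
open import Function.Bundles using (_⇔_)
open import Relation.Binary.PropositionalEquality
open import Relation.Unary using (Pred)

record FilteredRing : Set₁ where
  field
    commutativeRing : CommutativeRing 0ℓ 0ℓ
    F               : ℕ → Pred (CommutativeRing.Carrier commutativeRing) 0ℓ
  open CommutativeRing commutativeRing public

module _ (R : CommutativeRing 0ℓ 0ℓ) where
  open CommutativeRing R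

  -- The ℤ-linear span of a subset, i.e. the additive subgroup it generates.
  data Span (S : Pred Carrier 0ℓ) : Pred Carrier 0ℓ where
    gen   : ∀ {x} → S x → Span S x
    zeroₛ : Span S 0#
    addₛ  : ∀ {x y} → Span S x → Span S y → Span S (x + y)
    negₛ  : ∀ {x} → Span S x → Span S (- x)
    respₛ : ∀ {x y} → x ≈ y → Span S x → Span S y

  product : ∀ {k} → Vec Carrier k → Carrier
  product = foldr′ _*_ 1#

  Products : ℕ → Pred Carrier 0ℓ → Pred Carrier 0ℓ
  Products k S x = Σ (Vec Carrier k) λ v → VecAll.All S v × x ≈ product v

  module _ {I : Set} (g : I → Carrier) where

    OneOrGen : Pred Carrier 0ℓ
    OneOrGen x = (x ≈ 1#) ⊎ (∃[ i ] x ≈ g i)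

    filtration : ℕ → Pred Carrier 0ℓ
    filtration 0               = Span (_≈ 1#)
    filtration 1               = Span OneOrGen
    filtration k@(suc (suc _)) = Span (Products k (Span OneOrGen))

module _ (R S : FilteredRing) where
  private
    module R = FilteredRing R
    module S = FilteredRing S
  open RingMorphisms R.rawRing S.rawRing

  record IsFilteredMorphism (f : R.Carrier → S.Carrier) : Set where
    field
      isRingHomomorphism : IsRingHomomorphism f
      preserves          : ∀ k {x} → R.F k x → S.F k (f x)

  record IsFilteredIsomorphism (f : R.Carrier → S.Carrier) : Set where
    field
      isRingIsomorphism : IsRingIsomorphism f
      image             : ∀ k y → S.F k y ⇔ (∃[ x ] R.F k x × f x S.≈ y)

data Expr (X : Set) : Set where
  var     : X → Expr X
  𝟘 𝟙     : Expr X
  _⊕_ _⊗_ : Expr X → Expr X → Expr X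
  ⊖_      : Expr X → Expr X

infixl 6 _⊕_
infixl 7 _⊗_
infix  8 ⊖_

module Presentation {X : Set} (Rel : Expr X → Expr X → Set) where

  infix 4 _≈_

  -- The least congruence containing Rel and the commutative ring axioms.
  data _≈_ : Expr X → Expr X → Set where
    rel         : ∀ {s t} → Rel s t → s ≈ t
    ≈-refl      : ∀ {s} → s ≈ s
    ≈-sym       : ∀ {s t} → s ≈ t → t ≈ s
    ≈-trans     : ∀ {s t r} → s ≈ t → t ≈ r → s ≈ r
    ⊕-cong      : ∀ {s s′ t t′} → s ≈ s′ → t ≈ t′ → s ⊕ t ≈ s′ ⊕ t′
    ⊗-cong      : ∀ {s s′ t t′} → s ≈ s′ → t ≈ t′ → s ⊗ t ≈ s′ ⊗ t′
    ⊖-cong      : ∀ {s t} → s ≈ t → ⊖ s ≈ ⊖ t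
    ⊕-assoc     : ∀ s t r → (s ⊕ t) ⊕ r ≈ s ⊕ (t ⊕ r)
    ⊕-comm      : ∀ s t → s ⊕ t ≈ t ⊕ s
    ⊕-identityˡ : ∀ s → 𝟘 ⊕ s ≈ s
    ⊖-inverseˡ  : ∀ s → ⊖ s ⊕ s ≈ 𝟘
    ⊗-assoc     : ∀ s t r → (s ⊗ t) ⊗ r ≈ s ⊗ (t ⊗ r)
    ⊗-comm      : ∀ s t → s ⊗ t ≈ t ⊗ s
    ⊗-identityˡ : ∀ s → 𝟙 ⊗ s ≈ s
    distribˡ    : ∀ s t r → s ⊗ (t ⊕ r) ≈ s ⊗ t ⊕ s ⊗ r

  commutativeRing : CommutativeRing 0ℓ 0ℓ
  commutativeRing = record
    { Carrier = Expr X ; _≈_ = _≈_ ; _+_ = _⊕_ ; _*_ = _⊗_ ; -_ = ⊖_ ; 0# = 𝟘 ; 1# = 𝟙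
    ; isCommutativeRing = record
      { isRing = record
        { +-isAbelianGroup = record
          { isGroup = record
            { isMonoid = record
              { isSemigroup = record
                { isMagma = record
                  { isEquivalence = record { refl = ≈-refl ; sym = ≈-sym ; trans = ≈-trans }
                  ; ∙-cong = ⊕-cong }
                ; assoc = ⊕-assoc }
              ; identity = ⊕-identityˡ , λ s → ≈-trans (⊕-comm _ _) (⊕-identityˡ s) }
            ; inverse = ⊖-inverseˡ , λ s → ≈-trans (⊕-comm _ _) (⊖-inverseˡ s)
            ; ⁻¹-cong = ⊖-cong }
          ; comm = ⊕-comm }
        ; *-cong = ⊗-cong
        ; *-assoc = ⊗-assoc
        ; *-identity = ⊗-identityˡ , λ s → ≈-trans (⊗-comm _ _) (⊗-identityˡ s)
        ; distrib = distribˡ , λ s t r → ≈-trans (⊗-comm _ _)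
            (≈-trans (distribˡ s t r) (⊕-cong (⊗-comm _ _) (⊗-comm _ _))) }
      ; *-comm = ⊗-comm } }

data Dynkin : ℕ → Set where
  A  : ∀ m → Dynkin (1 ℕ.+ m)
  B  : ∀ m → Dynkin (2 ℕ.+ m)
  C  : ∀ m → Dynkin (2 ℕ.+ m)
  D  : ∀ m → Dynkin (4 ℕ.+ m)
  E₆ : Dynkin 6
  E₇ : Dynkin 7
  E₈ : Dynkin 8
  F₄ : Dynkin 4
  G₂ : Dynkin 2

-- Cartan integers  i , j ↦ ⟨αᵢ, αⱼ^∨⟩.  The nodes of the classical diagrams are
-- numbered so that the exceptional end comes first:
--   A   0 — 1 — 2 — …
--   B   0 ⇐ 1 — 2 — …            (α₀ short)
--   C   0 ⇒ 1 — 2 — …            (α₀ long)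
--   D   1 — 2 — 3 — …            with 0 joined to 2
--   E   1 — 2 — 3 — 4 — …        with 0 joined to 3
--   F₄  0 — 1 ⇒ 2 — 3
--   G₂  0 ⇚ 1                    (α₀ short)

chain : ℕ → ℕ → ℤ
chain 0             0             = + 2
chain 0             1             = -[1+ 0 ]
chain 1             0             = -[1+ 0 ]
chain 0             (suc (suc _)) = 0ℤ
chain (suc (suc _)) 0             = 0ℤ
chain (suc i)       (suc j)       = chain i j

chainB : ℕ → ℕ → ℤ
chainB 1 0 = -[1+ 1 ]
chainB i j = chain i j

branch : ℕ → ℕ → ℕ → ℤ
branch k 0       0       = + 2
branch k 0       (suc j) = if suc j ≡ᵇ k then -[1+ 0 ] else 0ℤ
branch k (suc i) 0       = if suc i ≡ᵇ k then -[1+ 0 ] else 0ℤ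
branch k (suc i) (suc j) = chain i j

chainF : ℕ → ℕ → ℤ
chainF 1 2 = -[1+ 1 ]
chainF i j = chain i j

chainG : ℕ → ℕ → ℤ
chainG 1 0 = -[1+ 2 ]
chainG i j = chain i j

cartanℕ : ∀ {n} → Dynkin n → ℕ → ℕ → ℤ
cartanℕ (A _) i j = chain i j
cartanℕ (B _) i j = chainB i j
cartanℕ (C _) i j = chainB j i
cartanℕ (D _) i j = branch 2 i j
cartanℕ E₆    i j = branch 3 i j
cartanℕ E₇    i j = branch 3 i j
cartanℕ E₈    i j = branch 3 i j
cartanℕ F₄    i j = chainF i j
cartanℕ G₂    i j = chainG i j

cartan : ∀ {n} → Dynkin n → Fin n → Fin n → ℤ
cartan X i j = cartanℕ X (toℕ i) (toℕ j)

infixl 6 _-ᵛ_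
infixl 7 _*ᵛ_
infix  8 -ᵛ_

0ᵛ : ∀ {n} → Vec ℤ n
0ᵛ = replicate _ 0ℤ

_-ᵛ_ : ∀ {n} → Vec ℤ n → Vec ℤ n → Vec ℤ n
_-ᵛ_ = zipWith ℤ._-_

-ᵛ_ : ∀ {n} → Vec ℤ n → Vec ℤ n
-ᵛ_ = Vec.map (λ z → ℤ.- z)

_*ᵛ_ : ∀ {n} → ℤ → Vec ℤ n → Vec ℤ n
c *ᵛ v = Vec.map (c ℤ.*_) v

dot : ∀ {n} → Vec ℤ n → Vec ℤ n → ℤ
dot u v = foldr′ ℤ._+_ 0ℤ (zipWith ℤ._*_ u v)

simple : ∀ {n} → Fin n → Vec ℤ n
simple i = 0ᵛ [ i ]≔ 1ℤ

NonNeg : ∀ {n} → Vec ℤ n → Set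
NonNeg = VecAll.All (0ℤ ℤ.≤_)

-- A reduced crystallographic root system with a chosen base whose Cartan matrix
-- is that of X.  Roots are written in coordinates with respect to the base, so
-- that the simple roots are the unit vectors and the integrality of the
-- coordinates is part of the definition of a base.  The coroot α^∨ is given by
-- its (integer) values on the simple roots, so ⟨β, α^∨⟩ = dot β (coroot α);
-- the function coroot is only meaningful on roots.  Irreducibility holds because
-- the diagrams X are connected.
record RootSystem {n : ℕ} (X : Dynkin n) : Set where
  field
    roots      : List (Vec ℤ n)
    nonzero    : 0ᵛ ∉ roots
    coroot     : Vec ℤ n → Vec ℤ n
    pairing≡2  : ∀ {α} → α ∈ roots → dot α (coroot α) ≡ + 2
    reflection : ∀ {α β} → α ∈ roots → β ∈ roots → β -ᵛ dot β (coroot α) *ᵛ α ∈ roots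
    reduced    : ∀ {α β} → α ∈ roots → β ∈ roots →
                 ∀ p q → p ≢ 0ℤ → p *ᵛ α ≡ q *ᵛ β → (α ≡ β) ⊎ (α ≡ -ᵛ β)
    simple∈    : ∀ i → simple i ∈ roots
    sign       : ∀ {α} → α ∈ roots → NonNeg α ⊎ NonNeg (-ᵛ α)
    type       : ∀ i j → dot (simple i) (coroot (simple j)) ≡ cartan X i j

  record PosRoot : Set where
    field
      coeffs : Vec ℤ n
      root   : coeffs ∈ roots
      pos    : NonNeg coeffs

  infix 4 _≼_
  _≼_ : PosRoot → PosRoot → Set
  α ≼ β = NonNeg (PosRoot.coeffs β -ᵛ PosRoot.coeffs α)

module +-Group = AbelianGroupProperties ℚₚ.+-0-abelianGroup
module +-Semigroup =
  CommutativeSemigroupProperties (CommutativeMonoid.commutativeSemigroup ℚₚ.+-0-commutativeMonoid)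

+-interchange-- : ∀ a b c d → (a ℚ.+ b) ℚ.- (c ℚ.+ d) ≡ (a ℚ.- c) ℚ.+ (b ℚ.- d)
+-interchange-- a b c d = trans (cong ((a ℚ.+ b) ℚ.+_) (ℚₚ.neg-distrib-+ c d))
  (+-Semigroup.interchange a b (ℚ.- c) (ℚ.- d))

*-distribˡ-- : ∀ c a b → c ℚ.* a ℚ.- c ℚ.* b ≡ c ℚ.* (a ℚ.- b)
*-distribˡ-- c a b = trans (cong (c ℚ.* a ℚ.+_) (ℚₚ.neg-distribʳ-* c b))
  (sym (ℚₚ.*-distribˡ-+ c a (ℚ.- b)))

half : ∀ {ε} → 0ℚ ℚ.< ε → 0ℚ ℚ.< ½ ℚ.* ε
half {ε} ε>0 = subst (ℚ._< ½ ℚ.* ε) (ℚₚ.*-zeroʳ ½) (ℚₚ.*-monoʳ-<-pos ½ ε>0)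

half+half : ∀ ε → ½ ℚ.* ε ℚ.+ ½ ℚ.* ε ≡ ε
half+half ε = trans (sym (ℚₚ.*-distribʳ-+ ε ½ ½)) (ℚₚ.*-identityˡ ε)

∣+∣-bound : ∀ p q {ε} → ℚ.∣ p ∣ ℚ.< ½ ℚ.* ε → ℚ.∣ q ∣ ℚ.< ½ ℚ.* ε → ℚ.∣ p ℚ.+ q ∣ ℚ.< ε
∣+∣-bound p q {ε} p< q< = ℚₚ.≤-<-trans (ℚₚ.∣p+q∣≤∣p∣+∣q∣ p q)
  (subst (ℚ.∣ p ∣ ℚ.+ ℚ.∣ q ∣ ℚ.<_) (half+half ε) (ℚₚ.+-mono-< p< q<))

scale-bound : ∀ c {ε} → 0ℚ ℚ.< ε →
              ∃[ η ] 0ℚ ℚ.< η × (∀ d → ℚ.∣ d ∣ ℚ.< η → ℚ.∣ c ℚ.* d ∣ ℚ.< ε)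
scale-bound c {ε} ε>0 = η , η>0 , bound
  where
  K : ℚ
  K = 1ℚ ℚ.+ ℚ.∣ c ∣
  c<K : ℚ.∣ c ∣ ℚ.< K
  c<K = subst (ℚ._< K) (ℚₚ.+-identityˡ ℚ.∣ c ∣) (ℚₚ.+-monoˡ-< ℚ.∣ c ∣ (ℚₚ.positive⁻¹ 1ℚ))
  instance
    K-pos : ℚ.Positive K
    K-pos = ℚ.positive (ℚₚ.≤-<-trans (ℚₚ.0≤∣p∣ c) c<K)
    K-nz : ℚ.NonZero K
    K-nz = ℚₚ.pos⇒nonZero K
    K⁻¹-pos : ℚ.Positive (ℚ.1/ K)
    K⁻¹-pos = ℚₚ.1/pos⇒pos K
    K-nn : ℚ.NonNegative K
    K-nn = ℚₚ.pos⇒nonNeg K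
  η : ℚ
  η = ℚ.1/ K ℚ.* ε
  η>0 : 0ℚ ℚ.< η
  η>0 = subst (ℚ._< η) (ℚₚ.*-zeroʳ (ℚ.1/ K)) (ℚₚ.*-monoʳ-<-pos (ℚ.1/ K) ε>0)
  Kη≡ε : K ℚ.* η ≡ ε
  Kη≡ε = trans (sym (ℚₚ.*-assoc K (ℚ.1/ K) ε))
           (trans (cong (ℚ._* ε) (ℚₚ.*-inverseʳ K)) (ℚₚ.*-identityˡ ε))
  bound : ∀ d → ℚ.∣ d ∣ ℚ.< η → ℚ.∣ c ℚ.* d ∣ ℚ.< ε
  bound d d<η = begin-strict
    ℚ.∣ c ℚ.* d ∣          ≡⟨ ℚₚ.∣p*q∣≡∣p∣*∣q∣ c d ⟩
    ℚ.∣ c ∣ ℚ.* ℚ.∣ d ∣    ≤⟨ ℚₚ.*-monoʳ-≤-nonNeg ℚ.∣ d ∣ {{ℚₚ.∣-∣-nonNeg d}} (ℚₚ.<⇒≤ c<K) ⟩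
    K ℚ.* ℚ.∣ d ∣          <⟨ ℚₚ.*-monoʳ-<-pos K d<η ⟩
    K ℚ.* η                ≡⟨ Kη≡ε ⟩
    ε                      ∎
    where open ℚₚ.≤-Reasoning

Cauchy : (ℕ → ℚ) → Set
Cauchy a = ∀ ε → 0ℚ ℚ.< ε →
           ∃[ N ] ∀ m n → N ℕ.≤ m → N ℕ.≤ n → ℚ.∣ a m ℚ.- a n ∣ ℚ.< ε

-- A real number is a Cauchy sequence of rationals.
record ℝ : Set where
  constructor mkℝ
  field
    seq    : ℕ → ℚ
    cauchy : Cauchy seq
open ℝ public

Eventually : Pred ℕ 0ℓ → Set
Eventually P = ∃[ N ] ∀ n → N ℕ.≤ n → P n

infix  4 _<_ _#_
infixl 6 _+_
infixl 7 _·_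

_<_ : ℝ → ℝ → Set
x < y = ∃[ ε ] 0ℚ ℚ.< ε × Eventually (λ n → seq x n ℚ.+ ε ℚ.≤ seq y n)

-- x # y is the constructive reading of x ≠ y.
_#_ : ℝ → ℝ → Set
x # y = (x < y) ⊎ (y < x)

-- Abstract only to keep these proofs from being unfolded during normalisation.
abstract
  const-cauchy : ∀ q → Cauchy (λ _ → q)
  const-cauchy q ε ε>0 = 0 , λ _ _ _ _ →
    subst (ℚ._< ε) (sym (cong ℚ.∣_∣ (ℚₚ.+-inverseʳ q))) ε>0

  +-cauchy : ∀ a b → Cauchy a → Cauchy b → Cauchy (λ n → a n ℚ.+ b n)
  +-cauchy a b ca cb ε ε>0 =
    let (N , p) = ca (½ ℚ.* ε) (half ε>0) ; (M , q) = cb (½ ℚ.* ε) (half ε>0) in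
    N ℕ.⊔ M , λ m n m≥ n≥ →
    subst (λ z → ℚ.∣ z ∣ ℚ.< ε) (sym (+-interchange-- (a m) (b m) (a n) (b n)))
      (∣+∣-bound (a m ℚ.- a n) (b m ℚ.- b n)
        (p m n (ℕₚ.m⊔n≤o⇒m≤o N M m≥) (ℕₚ.m⊔n≤o⇒m≤o N M n≥))
        (q m n (ℕₚ.m⊔n≤o⇒n≤o N M m≥) (ℕₚ.m⊔n≤o⇒n≤o N M n≥)))

  *-cauchy : ∀ c a → Cauchy a → Cauchy (λ n → c ℚ.* a n)
  *-cauchy c a ca ε ε>0 =
    let (η , η>0 , bound) = scale-bound c ε>0 ; (N , p) = ca η η>0 in
    N , λ m n m≥ n≥ →
    subst (λ z → ℚ.∣ z ∣ ℚ.< ε) (sym (*-distribˡ-- c (a m) (a n)))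
      (bound (a m ℚ.- a n) (p m n m≥ n≥))

fromℚ : ℚ → ℝ
fromℚ q = mkℝ (λ _ → q) (const-cauchy q)

0ℝ 1ℝ : ℝ
0ℝ = fromℚ 0ℚ
1ℝ = fromℚ 1ℚ

_+_ : ℝ → ℝ → ℝ
x + y = mkℝ (λ n → seq x n ℚ.+ seq y n) (+-cauchy (seq x) (seq y) (cauchy x) (cauchy y))

_·_ : ℤ → ℝ → ℝ
c · x = mkℝ (λ n → (c ℚ./ 1) ℚ.* seq x n) (*-cauchy (c ℚ./ 1) (seq x) (cauchy x))

-- A vector of coordinates x₀, x₁, … stands for the point of V with αᵢ(x) = xᵢ
-- for every simple root αᵢ; hence the linear form with coefficients c takes the
-- value Σ cᵢ xᵢ.
infix 5 _⟨_⟩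
_⟨_⟩ : ∀ {n} → Vec ℤ n → Vec ℝ n → ℝ
c ⟨ x ⟩ = foldr′ _+_ 0ℝ (zipWith _·_ c x)

-- ∣ a − b ∣ < ε; hence Near is a ball for the sup norm.
Within : ℚ → ℝ → ℝ → Set
Within ε a b = (a < b + fromℚ ε) × (b < a + fromℚ ε)

Near : ∀ {n} → ℚ → Vec ℝ n → Vec ℝ n → Set
Near ε = Pointwise (Within ε)

∣∣<-intro : ∀ {p ε} → p ℚ.< ε → ℚ.- p ℚ.< ε → ℚ.∣ p ∣ ℚ.< ε
∣∣<-intro {p} {ε} p< -p< with ℚₚ.∣p∣≡p∨∣p∣≡-p p
... | inj₁ e = subst (ℚ._< ε) (sym e) p<
... | inj₂ e = subst (ℚ._< ε) (sym e) -p<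

diff< : ∀ a b {ε η} → 0ℚ ℚ.< η → a ℚ.+ η ℚ.≤ b ℚ.+ ε → a ℚ.- b ℚ.< ε
diff< a b {ε} {η} η>0 h = begin-strict
  a ℚ.- b                  ≡⟨ sym (ℚₚ.+-identityʳ _) ⟩
  (a ℚ.- b) ℚ.+ 0ℚ         <⟨ ℚₚ.+-monoʳ-< (a ℚ.- b) η>0 ⟩
  (a ℚ.- b) ℚ.+ η          ≡⟨ +-Semigroup.xy∙z≈xz∙y a (ℚ.- b) η ⟩
  (a ℚ.+ η) ℚ.- b          ≤⟨ ℚₚ.+-monoˡ-≤ (ℚ.- b) h ⟩
  (b ℚ.+ ε) ℚ.- b          ≡⟨ +-Group.xyx⁻¹≈y b ε ⟩
  ε                        ∎
  where open ℚₚ.≤-Reasoning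

within⇒ : ∀ {ε} a b → Within ε a b → Eventually λ n → ℚ.∣ seq a n ℚ.- seq b n ∣ ℚ.< ε
within⇒ {ε} a b ((η , η>0 , N , p) , (ζ , ζ>0 , M , q)) = N ℕ.⊔ M , λ n n≥ →
  ∣∣<-intro (diff< (seq a n) (seq b n) η>0 (p n (ℕₚ.m⊔n≤o⇒m≤o N M n≥)))
    (subst (ℚ._< ε) (sym (+-Group.⁻¹-anti-homo‿- (seq a n) (seq b n)))
      (diff< (seq b n) (seq a n) ζ>0 (q n (ℕₚ.m⊔n≤o⇒n≤o N M n≥))))

near-mono : ∀ {n ε η} {x y : Vec ℝ n} → ε ℚ.≤ η → Near ε x y → Near η x y
near-mono         ε≤η []                = []
near-mono {ε = ε} {η} ε≤η (_∷_ {x = a} {y = b} (p , q) ps) =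
  (weaken a b p , weaken b a q) ∷ near-mono ε≤η ps
  where
  weaken : ∀ a b → a < b + fromℚ ε → a < b + fromℚ η
  weaken a b (ζ , ζ>0 , N , h) =
    ζ , ζ>0 , N , λ n n≥ → ℚₚ.≤-trans (h n n≥) (ℚₚ.+-monoʳ-≤ (seq b n) ε≤η)

min>0 : ∀ {ε η} → 0ℚ ℚ.< ε → 0ℚ ℚ.< η → 0ℚ ℚ.< ε ℚ.⊓ η
min>0 {ε} {η} ε>0 η>0 with ℚₚ.⊓-sel ε η
... | inj₁ e = subst (0ℚ ℚ.<_) (sym e) ε>0
... | inj₂ e = subst (0ℚ ℚ.<_) (sym e) η>0

step-bound : ∀ c a b r s {δ} → ℚ.∣ c ℚ.* (a ℚ.- b) ∣ ℚ.< ½ ℚ.* δ → ℚ.∣ r ℚ.- s ∣ ℚ.< ½ ℚ.* δ →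
             ℚ.∣ (c ℚ.* a ℚ.+ r) ℚ.- (c ℚ.* b ℚ.+ s) ∣ ℚ.< δ
step-bound c a b r s {δ} h₁ h₂ = subst (λ z → ℚ.∣ z ∣ ℚ.< δ)
  (sym (trans (+-interchange-- (c ℚ.* a) r (c ℚ.* b) s)
              (cong (ℚ._+ (r ℚ.- s)) (*-distribˡ-- c a b))))
  (∣+∣-bound (c ℚ.* (a ℚ.- b)) (r ℚ.- s) h₁ h₂)

Close : ∀ {n} → Vec ℤ n → ℚ → Vec ℝ n → Vec ℝ n → Set
Close c δ x y = Eventually λ k → ℚ.∣ seq (c ⟨ x ⟩) k ℚ.- seq (c ⟨ y ⟩) k ∣ ℚ.< δ

continuous : ∀ {n} (c : Vec ℤ n) {δ} → 0ℚ ℚ.< δ →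
             ∃[ ε ] 0ℚ ℚ.< ε × (∀ x y → Near ε x y → Close c δ x y)
continuous []           δ>0 = 1ℚ , ℚₚ.positive⁻¹ 1ℚ , λ { [] [] [] → 0 , λ _ _ → δ>0 }
continuous {suc n} (c ∷ cs) {δ} δ>0 =
  η ℚ.⊓ ε , min>0 (proj₁ (proj₂ s)) (proj₁ (proj₂ ih)) , close
  where
  s  = scale-bound (c ℚ./ 1) (half δ>0)
  ih = continuous cs (half δ>0)
  η  = proj₁ s
  ε  = proj₁ ih
  combine : ∀ a b (x y : Vec ℝ n) → Within η a b → Close cs (½ ℚ.* δ) x y →
            Close (c ∷ cs) δ (a ∷ x) (b ∷ y)
  combine a b x y w (M , q) = let (N , p) = within⇒ a b w in
    N ℕ.⊔ M , λ k k≥ →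
      step-bound (c ℚ./ 1) (seq a k) (seq b k) (seq (cs ⟨ x ⟩) k) (seq (cs ⟨ y ⟩) k)
        (proj₂ (proj₂ s) (seq a k ℚ.- seq b k) (p k (ℕₚ.m⊔n≤o⇒m≤o N M k≥)))
        (q k (ℕₚ.m⊔n≤o⇒n≤o N M k≥))
  close : ∀ x y → Near (η ℚ.⊓ ε) x y → Close (c ∷ cs) δ x y
  close (a ∷ x) (b ∷ y) near =
    combine a b x y (head (near-mono (ℚₚ.p⊓q≤p η ε) near))
      (proj₂ (proj₂ ih) x y (tail (near-mono (ℚₚ.p⊓q≤q η ε) near)))

gap : ∀ p q r {δ ζ} → p ℚ.+ δ ℚ.≤ r → r ℚ.+ ζ ℚ.≤ q → δ ℚ.+ ζ ℚ.≤ ℚ.∣ q ℚ.- p ∣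
gap p q r {δ} {ζ} h₁ h₂ = begin
  δ ℚ.+ ζ                     ≡⟨ sym (+-Group.xyx⁻¹≈y p (δ ℚ.+ ζ)) ⟩
  (p ℚ.+ (δ ℚ.+ ζ)) ℚ.- p     ≡⟨ cong (ℚ._- p) (sym (ℚₚ.+-assoc p δ ζ)) ⟩
  ((p ℚ.+ δ) ℚ.+ ζ) ℚ.- p     ≤⟨ ℚₚ.+-monoˡ-≤ (ℚ.- p) (ℚₚ.+-monoˡ-≤ ζ h₁) ⟩
  (r ℚ.+ ζ) ℚ.- p             ≤⟨ ℚₚ.+-monoˡ-≤ (ℚ.- p) h₂ ⟩
  q ℚ.- p                     ≤⟨ p≤∣p∣ (q ℚ.- p) ⟩
  ℚ.∣ q ℚ.- p ∣               ∎
  where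
  open ℚₚ.≤-Reasoning
  p≤∣p∣ : ∀ p → p ℚ.≤ ℚ.∣ p ∣
  p≤∣p∣ p with ℚₚ.≤-total 0ℚ p
  ... | inj₁ 0≤p = ℚₚ.≤-reflexive (sym (ℚₚ.0≤p⇒∣p∣≡p 0≤p))
  ... | inj₂ p≤0 = ℚₚ.≤-trans p≤0 (ℚₚ.0≤∣p∣ p)

absurd : ∀ {δ ζ d} → 0ℚ ℚ.< ζ → δ ℚ.+ ζ ℚ.≤ d → d ℚ.< δ → ⊥
absurd {δ} {ζ} {d} ζ>0 h d<δ = ℚₚ.<-irrefl refl (begin-strict
  δ           ≡⟨ sym (ℚₚ.+-identityʳ δ) ⟩
  δ ℚ.+ 0ℚ    <⟨ ℚₚ.+-monoʳ-< δ ζ>0 ⟩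
  δ ℚ.+ ζ     ≤⟨ h ⟩
  d           <⟨ d<δ ⟩
  δ           ∎)
  where open ℚₚ.≤-Reasoning

∣-∣-comm : ∀ a b → ℚ.∣ a ℚ.- b ∣ ≡ ℚ.∣ b ℚ.- a ∣
∣-∣-comm a b = trans (sym (ℚₚ.∣-p∣≡∣p∣ (a ℚ.- b))) (cong ℚ.∣_∣ (+-Group.⁻¹-anti-homo‿- a b))

indicator : ∀ r → r # 1ℝ → ℤ
indicator _ (inj₁ r<1) = 0ℤ
indicator _ (inj₂ 1<r) = 1ℤ

indicator-locallyConstant : ∀ r (p : r # 1ℝ) → ∃[ δ ] 0ℚ ℚ.< δ × (∀ s (q : s # 1ℝ) →
  Eventually (λ k → ℚ.∣ seq r k ℚ.- seq s k ∣ ℚ.< δ) → indicator r p ≡ indicator s q)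
indicator-locallyConstant r (inj₁ (δ , δ>0 , N , p)) = δ , δ>0 , λ where
  s (inj₁ _)                  _       → refl
  s (inj₂ (ζ , ζ>0 , M , q)) (L , c) →
    let k = N ℕ.⊔ M ℕ.⊔ L ; N⊔M≤k = ℕₚ.m≤m⊔n (N ℕ.⊔ M) L in
    ⊥-elim (absurd ζ>0
      (gap (seq r k) (seq s k) 1ℚ (p k (ℕₚ.m⊔n≤o⇒m≤o N M N⊔M≤k)) (q k (ℕₚ.m⊔n≤o⇒n≤o N M N⊔M≤k)))
      (subst (ℚ._< δ) (∣-∣-comm (seq r k) (seq s k)) (c k (ℕₚ.m≤n⊔m (N ℕ.⊔ M) L))))
indicator-locallyConstant r (inj₂ (δ , δ>0 , N , p)) = δ , δ>0 , λ where
  s (inj₂ _)                  _       → refl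
  s (inj₁ (ζ , ζ>0 , M , q)) (L , c) →
    let k = N ℕ.⊔ M ℕ.⊔ L ; N⊔M≤k = ℕₚ.m≤m⊔n (N ℕ.⊔ M) L in
    ⊥-elim (absurd ζ>0
      (subst (ℚ._≤ ℚ.∣ seq r k ℚ.- seq s k ∣) (ℚₚ.+-comm ζ δ)
        (gap (seq s k) (seq r k) 1ℚ (q k (ℕₚ.m⊔n≤o⇒n≤o N M N⊔M≤k)) (p k (ℕₚ.m⊔n≤o⇒m≤o N M N⊔M≤k))))
      (c k (ℕₚ.m≤n⊔m (N ℕ.⊔ M) L)))

module _ {n : ℕ} {X : Dynkin n} (Φ : RootSystem X) where
  open RootSystem Φ

  data URel : Expr PosRoot → Expr PosRoot → Set where
    minˡ : ∀ {α β} → α ≼ β → URel (var α ⊗ var β) (var α)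
    minʳ : ∀ {α β} → β ≼ α → URel (var α ⊗ var β) (var β)

  URing : CommutativeRing 0ℓ 0ℓ
  URing = Presentation.commutativeRing URel

  u : PosRoot → CommutativeRing.Carrier URing
  u = var

  U : FilteredRing
  U = record { commutativeRing = URing ; F = filtration URing u }

  value : PosRoot → Vec ℝ n → ℝ
  value α x = PosRoot.coeffs α ⟨ x ⟩

  -- A point of the dominant Weyl chamber off all Shi hyperplanes.  Being off a
  -- hyperplane is apartness, so that h α below is a total function on points.
  record Point : Set where
    field
      coords   : Vec ℝ n
      dominant : ∀ α → 0ℝ < value α coords
      offShi   : ∀ α → (value α coords # 0ℝ) × (value α coords # 1ℝ)
  open Point public

  -- Such functions do not depend on the proofs contained in a point, since two
  -- points with equal coordinates are Near for every ε > 0.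
  LocallyConstant : (Point → ℤ) → Set
  LocallyConstant f = ∀ x → ∃[ ε ] 0ℚ ℚ.< ε × (∀ y → Near ε (coords x) (coords y) → f x ≡ f y)

  record LocConst : Set where
    field
      fun      : Point → ℤ
      locConst : LocallyConstant fun
  open LocConst public

  private
    const : ℤ → LocConst
    const c = record { fun = λ _ → c ; locConst = λ _ → 1ℚ , ℚₚ.positive⁻¹ 1ℚ , λ _ _ → refl }

    pointwise₁ : (ℤ → ℤ) → LocConst → LocConst
    pointwise₁ op f = record
      { fun      = λ x → op (fun f x)
      ; locConst = λ x → let (ε , ε>0 , p) = locConst f x in
                         ε , ε>0 , λ y near → cong op (p y near) }

    pointwise₂ : (ℤ → ℤ → ℤ) → LocConst → LocConst → LocConst
    pointwise₂ op f g = record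
      { fun      = λ x → op (fun f x) (fun g x)
      ; locConst = λ x → let (ε , ε>0 , p) = locConst f x ; (η , η>0 , q) = locConst g x in
          ε ℚ.⊓ η , min>0 ε>0 η>0 , λ y near →
            cong₂ op (p y (near-mono (ℚₚ.p⊓q≤p ε η) near))
                     (q y (near-mono (ℚₚ.p⊓q≤q ε η) near)) }

  HRing : CommutativeRing 0ℓ 0ℓ
  HRing = record
    { Carrier = LocConst
    ; _≈_ = λ f g → ∀ x → fun f x ≡ fun g x
    ; _+_ = pointwise₂ ℤ._+_ ; _*_ = pointwise₂ ℤ._*_ ; -_ = pointwise₁ (λ z → ℤ.- z)
    ; 0# = const 0ℤ ; 1# = const 1ℤ
    ; isCommutativeRing = record
      { isRing = record
        { +-isAbelianGroup = record
          { isGroup = record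
            { isMonoid = record
              { isSemigroup = record
                { isMagma = record
                  { isEquivalence = record
                    { refl = λ _ → refl
                    ; sym = λ p x → sym (p x)
                    ; trans = λ p q x → trans (p x) (q x) }
                  ; ∙-cong = λ p q x → cong₂ ℤ._+_ (p x) (q x) }
                ; assoc = λ f g h x → ℤₚ.+-assoc (fun f x) (fun g x) (fun h x) }
              ; identity = (λ f x → ℤₚ.+-identityˡ (fun f x))
                         , (λ f x → ℤₚ.+-identityʳ (fun f x)) }
            ; inverse = (λ f x → ℤₚ.+-inverseˡ (fun f x))
                      , (λ f x → ℤₚ.+-inverseʳ (fun f x))
            ; ⁻¹-cong = λ p x → cong (λ z → ℤ.- z) (p x) }
          ; comm = λ f g x → ℤₚ.+-comm (fun f x) (fun g x) }
        ; *-cong = λ p q x → cong₂ ℤ._*_ (p x) (q x)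
        ; *-assoc = λ f g h x → ℤₚ.*-assoc (fun f x) (fun g x) (fun h x)
        ; *-identity = (λ f x → ℤₚ.*-identityˡ (fun f x))
                     , (λ f x → ℤₚ.*-identityʳ (fun f x))
        ; distrib = (λ f g h x → ℤₚ.*-distribˡ-+ (fun f x) (fun g x) (fun h x))
                  , (λ f g h x → ℤₚ.*-distribʳ-+ (fun f x) (fun g x) (fun h x)) }
      ; *-comm = λ f g x → ℤₚ.*-comm (fun f x) (fun g x) } }

  h : PosRoot → CommutativeRing.Carrier HRing
  h α = record
    { fun      = λ x → indicator (value α (coords x)) (proj₂ (offShi x α))
    ; locConst = λ x →
        let (δ , δ>0 , agree) = indicator-locallyConstant (value α (coords x)) (proj₂ (offShi x α))
            (ε , ε>0 , close) = continuous (PosRoot.coeffs α) δ>0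
        in ε , ε>0 , λ y near →
             agree (value α (coords y)) (proj₂ (offShi y α)) (close (coords x) (coords y) near) }

  H : FilteredRing
  H = record { commutativeRing = HRing ; F = filtration HRing h }

{-# OPTIONS --safe #-}
-- The crux: if no α ∈ ins lies below a β ∈ outs, some dominant x has α(x) > 1 for all α ∈ ins and
-- β(x) < 1 for all β ∈ outs. Expand 1 as the product of the u α + (1 − u α) over all positive roots. A term
-- containing u α (1 − u β) with α ≼ β vanishes, and on any other term an element p of U acts as the integer
-- ρ(p)(x), x being the corresponding point; so ρ(p) = 0 forces p = 0. Conversely, a locally constant function
-- is constant on each region, since bisecting a segment inside the region finds a point where it would jump;
-- it is therefore the combination of these terms with coefficients its values at the points x.
--
-- If no such x existed, Gordan's theorem would give α₁, …, αₖ ∈ ins and β₁, …, βₘ ∈ outs, k ≥ m, k ≥ 1, with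
-- σ = Σβ − Σα ≥ 0. With respect to the invariant form, if (αᵢ , βⱼ) > 0 then βⱼ − αᵢ is zero or a root, necessarily
-- negative, and αᵢ, βⱼ can be cancelled, adding αᵢ − βⱼ to σ. Otherwise (Σβ , σ) ≥ (Σβ , Σβ) > 0, so some simple
-- root in σ pairs positively with some βⱼ and can be subtracted from both. Both steps lower the height of Σβ.
module Submission where

open import Algebra.Bundles using (CommutativeMonoid; CommutativeRing)
open import Algebra.Morphism.Structures using (module RingMorphisms)
import Algebra.Properties.AbelianGroup as AGroupProperties
import Algebra.Properties.CommutativeSemigroup as CSemigroupProperties
import Algebra.Properties.Monoid.Mult as Mult
import Algebra.Properties.Ring as RingProperties
open import Data.Empty using (⊥; ⊥-elim)
open import Data.Fin.Base using (Fin; toℕ; zero; suc)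
import Data.Fin.Properties as Finₚ
open import Data.Integer.Base as ℤ using (ℤ; +_; -[1+_]; 0ℤ; 1ℤ)
import Data.Integer.Properties as ℤₚ
open import Data.Integer.Tactic.RingSolver using (solve-∀)
open import Data.List.Base as List using (List; []; _∷_; _++_; allFin; cartesianProductWith; deduplicate; filter; length; map)
open import Data.List.Extrema ℤₚ.≤-totalOrder using (argmax; argmax-all; f[xs]≤f[argmax])
open import Data.List.Membership.Propositional using (_∈_; find)
import Data.List.Membership.Propositional.Properties as ∈ₚ
open import Data.List.Membership.Propositional.Properties.WithK using (unique∧set⇒bag)
import Data.List.Properties as Listₚ
open import Data.List.Relation.Binary.BagAndSetEquality using (∼bag⇒↭)
open import Data.List.Relation.Binary.Permutation.Propositional as ↭ using (_↭_; ↭-refl; ↭-prep; ↭-swap; ↭-trans)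
import Data.List.Relation.Binary.Permutation.Propositional.Properties as ↭ₚ
import Data.List.Relation.Binary.Permutation.Setoid.Properties as ↭ₛₚ
open import Data.List.Relation.Unary.All as All using (All; []; _∷_)
import Data.List.Relation.Unary.All.Properties as Allₚ
open import Data.List.Relation.Unary.Any as Any using (Any; here; there; any?)
open import Data.List.Relation.Unary.Any.Properties using (lookup-index)
import Data.List.Relation.Unary.Unique.DecPropositional.Properties as DecUnique
open import Data.List.Relation.Unary.Unique.Propositional using (Unique)
import Data.List.Relation.Unary.Unique.Propositional.Properties as Uniqueₚ
open import Data.Nat.Base as ℕ using (ℕ; zero; suc)
import Data.Nat.Properties as ℕₚ
open import Data.Product.Base using (Σ-syntax; ∃-syntax; _×_; _,_; proj₁; proj₂)
open import Data.Rational.Base as ℚ using (ℚ; 0ℚ; 1ℚ; ½)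
import Data.Rational.Properties as ℚₚ
open import Data.Rational.Solver using (module +-*-Solver)
import Data.Rational.Unnormalised.Base as ℚᵘ
import Data.Rational.Unnormalised.Properties as ℚᵘₚ
open import Data.Sum.Base using (_⊎_; inj₁; inj₂)
open import Data.Vec.Base as Vec using (Vec; []; _∷_; head; tail; lookup; replicate; zipWith)
import Data.Vec.Membership.Propositional.Properties as ∈ᵥₚ
open import Data.Vec.Properties using (≡-dec)
open import Data.Vec.Relation.Binary.Pointwise.Inductive using ([]; _∷_)
open import Data.Vec.Relation.Unary.All as VecAll using ([]; _∷_)
open import Function.Base using (_∘_)
open import Function.Bundles using (_⇔_; mk⇔)
open import Level using (0ℓ)
open import Relation.Binary.Definitions using (DecidableEquality; tri<; tri≈; tri>)
open import Relation.Binary.PropositionalEquality hiding (setoid)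
import Relation.Binary.PropositionalEquality.Properties as ≡ₚ
import Relation.Binary.Reasoning.Setoid as SetoidReasoning
open import Relation.Nullary using (¬_; yes; no; Dec)
open import Relation.Nullary.Decidable using (_→-dec_)
open import Defs
open +-*-Solver using (solve; _:+_; _:*_; _:-_; :-_; _:=_)

-- `RootSystem` supplies integer pairings with coroots but no inner product. The form is therefore
-- built as (u , w) = Σ ⟨u , γ^∨⟩ ⟨w , γ^∨⟩ over the distinct roots γ. Its invariance, and what it
-- says about differences of roots, rest on finiteness: for v ≠ 0 the vectors u - k v cannot all lie
-- in the root list. In the descent, k ≥ m guards the cancellation of a pair: if the last α
-- disappears, so does the last β, and what is left reads α ≼ β. The inequality itself comes from
-- making the system homogeneous, with an unknown threshold t in place of 1. Real numbers are Cauchy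
-- sequences and points carry proofs, so nothing is argued through equality of points. Constancy on
-- a region is obtained by refuting f p ≠ f q, which suffices because equality in ℤ is decidable.
-- Likewise positive roots are compared by coefficients, not as records. The filtrations are matched
-- formally, layer by layer, since ρ sends generators to generators; all the geometry goes into
-- bijectivity of ρ.

infixl 6 _+ᵛ_
_+ᵛ_ : ∀ {n} → Vec ℤ n → Vec ℤ n → Vec ℤ n
_+ᵛ_ = zipWith ℤ._+_

_≟ᵛ_ : ∀ {n} → DecidableEquality (Vec ℤ n)
_≟ᵛ_ = ≡-dec ℤₚ._≟_

-- Integer vectors, linearity of `dot`, progressions in a finite list.

dot-minus : ∀ {n} c (u v w : Vec ℤ n) → dot (u -ᵛ c *ᵛ v) w ≡ dot u w ℤ.- c ℤ.* dot v w
dot-minus c []      []      []      = sym (cong (λ z → 0ℤ ℤ.- z) (ℤₚ.*-zeroʳ c))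
dot-minus c (a ∷ u) (b ∷ v) (e ∷ w) = trans
  (cong (λ z → (a ℤ.- c ℤ.* b) ℤ.* e ℤ.+ z) (dot-minus c u v w))
  (rearrange a b e c (dot u w) (dot v w))
  where
  rearrange : ∀ a b e c p q → (a ℤ.- c ℤ.* b) ℤ.* e ℤ.+ (p ℤ.- c ℤ.* q) ≡
              (a ℤ.* e ℤ.+ p) ℤ.- c ℤ.* (b ℤ.* e ℤ.+ q)
  rearrange = solve-∀

-ᵛ-collinear : ∀ {n} a b (u v : Vec ℤ n) → u -ᵛ a *ᵛ v -ᵛ b *ᵛ v ≡ u -ᵛ (a ℤ.+ b) *ᵛ v
-ᵛ-collinear a b []      []      = refl
-ᵛ-collinear a b (x ∷ u) (y ∷ v) = cong₂ _∷_ (lemma x y a b) (-ᵛ-collinear a b u v)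
  where
  lemma : ∀ x y a b → x ℤ.- a ℤ.* y ℤ.- b ℤ.* y ≡ x ℤ.- (a ℤ.+ b) ℤ.* y
  lemma = solve-∀

-ᵛ-0* : ∀ {n} (u v : Vec ℤ n) → u -ᵛ 0ℤ *ᵛ v ≡ u
-ᵛ-0* []      []      = refl
-ᵛ-0* (x ∷ u) (y ∷ v) = cong₂ _∷_ (lemma x y) (-ᵛ-0* u v)
  where
  lemma : ∀ x y → x ℤ.- 0ℤ ℤ.* y ≡ x
  lemma = solve-∀

-ᵛ-1* : ∀ {n} (u v : Vec ℤ n) → u -ᵛ 1ℤ *ᵛ v ≡ u -ᵛ v
-ᵛ-1* []      []      = refl
-ᵛ-1* (x ∷ u) (y ∷ v) = cong₂ _∷_ (cong (ℤ._-_ x) (ℤₚ.*-identityˡ y)) (-ᵛ-1* u v)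

-ᵛ-** : ∀ {n} a b (u v : Vec ℤ n) → u -ᵛ (a ℤ.* b) *ᵛ v ≡ u -ᵛ a *ᵛ (b *ᵛ v)
-ᵛ-** a b []      []      = refl
-ᵛ-** a b (x ∷ u) (y ∷ v) = cong₂ _∷_ (cong (ℤ._-_ x) (ℤₚ.*-assoc a b y)) (-ᵛ-** a b u v)

-ᵛ-inverse : ∀ {n} (u : Vec ℤ n) → u -ᵛ u ≡ 0ᵛ
-ᵛ-inverse []      = refl
-ᵛ-inverse (x ∷ u) = cong₂ _∷_ (ℤₚ.+-inverseʳ x) (-ᵛ-inverse u)

dot-zero : ∀ {n} (w : Vec ℤ n) → dot 0ᵛ w ≡ 0ℤ
dot-zero []      = refl
dot-zero (x ∷ w) = trans (cong (ℤ._+ dot 0ᵛ w) (ℤₚ.*-zeroˡ x)) (trans (ℤₚ.+-identityˡ _) (dot-zero w))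

dot-* : ∀ {n} c (u w : Vec ℤ n) → dot (c *ᵛ u) w ≡ c ℤ.* dot u w
dot-* c []      []      = sym (ℤₚ.*-zeroʳ c)
dot-* c (x ∷ u) (y ∷ w) = trans (cong₂ ℤ._+_ (ℤₚ.*-assoc c x y) (dot-* c u w)) (sym (ℤₚ.*-distribˡ-+ c _ _))

multiples-injective : ∀ {n} (i j : ℤ) (u v : Vec ℤ n) → i ≢ j → u -ᵛ i *ᵛ v ≡ u -ᵛ j *ᵛ v → v ≡ 0ᵛ
multiples-injective i j []      []      _   _ = refl
multiples-injective i j (x ∷ u) (y ∷ v) i≢j e =
  cong₂ _∷_ y≡0 (multiples-injective i j u v i≢j (cong Vec.tail e))
  where
  lemma : ∀ x y i j → (i ℤ.- j) ℤ.* y ≡ (x ℤ.- j ℤ.* y) ℤ.- (x ℤ.- i ℤ.* y)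
  lemma = solve-∀
  y≡0 : y ≡ 0ℤ
  y≡0 with ℤₚ.i*j≡0⇒i≡0∨j≡0 (i ℤ.- j)
             (trans (lemma x y i j) (ℤₚ.i≡j⇒i-j≡0 (sym (cong Vec.head e))))
  ... | inj₁ i-j≡0 = ⊥-elim (i≢j (ℤₚ.i-j≡0⇒i≡j i j i-j≡0))
  ... | inj₂ y≡0   = y≡0

-- Pigeonhole: two of the first `length xs` + 1 terms sit at the same index, so two different
-- multiples of v agree. This is how finiteness of the root system forces a vector to vanish.
finite-progression : ∀ {n} (xs : List (Vec ℤ n)) (u v : Vec ℤ n) →
                     (∀ k → u -ᵛ (+ k) *ᵛ v ∈ xs) → v ≡ 0ᵛ
finite-progression xs u v p with Finₚ.pigeonhole (ℕₚ.n<1+n (length xs)) (λ i → Any.index (p (toℕ i)))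
... | i , j , i<j , eq = multiples-injective (+ toℕ i) (+ toℕ j) u v
  (λ e → ℕₚ.<⇒≢ i<j (ℤₚ.+-injective e))
  (trans (lookup-index (p (toℕ i)))
    (trans (cong (List.lookup xs) eq) (sym (lookup-index (p (toℕ j))))))

sumℤ : List ℤ → ℤ
sumℤ = List.foldr ℤ._+_ 0ℤ

sumℤ-↭ : ∀ {xs ys} → xs ↭ ys → sumℤ xs ≡ sumℤ ys
sumℤ-↭ p = ↭ₛₚ.foldr-commMonoid (≡ₚ.setoid ℤ) ℤₚ.+-0-isCommutativeMonoid (↭.↭⇒↭ₛ p)

-- Roots

module RootTheory {n} {X : Dynkin n} (Φ : RootSystem X) where
  open RootSystem Φ

  infix 8 ⟪_,_⟫
  ⟪_,_⟫ : Vec ℤ n → Vec ℤ n → ℤ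
  ⟪ v , γ ⟫ = dot v (coroot γ)

  reflect : Vec ℤ n → Vec ℤ n → Vec ℤ n
  reflect γ v = v -ᵛ ⟪ v , γ ⟫ *ᵛ γ

  reflect-involutive : ∀ {γ} → γ ∈ roots → ∀ v → reflect γ (reflect γ v) ≡ v
  reflect-involutive {γ} γ∈ v = begin
    v -ᵛ p *ᵛ γ -ᵛ ⟪ v -ᵛ p *ᵛ γ , γ ⟫ *ᵛ γ ≡⟨ -ᵛ-collinear p _ v γ ⟩
    v -ᵛ (p ℤ.+ ⟪ v -ᵛ p *ᵛ γ , γ ⟫) *ᵛ γ    ≡⟨ cong (λ c → v -ᵛ c *ᵛ γ) coefficient ⟩
    v -ᵛ 0ℤ *ᵛ γ                            ≡⟨ -ᵛ-0* v γ ⟩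
    v                                        ∎
    where
    open ≡-Reasoning
    p = ⟪ v , γ ⟫
    cancel : ∀ p → p ℤ.+ (p ℤ.- p ℤ.* + 2) ≡ 0ℤ
    cancel = solve-∀
    coefficient : p ℤ.+ ⟪ v -ᵛ p *ᵛ γ , γ ⟫ ≡ 0ℤ
    coefficient = begin
      p ℤ.+ ⟪ v -ᵛ p *ᵛ γ , γ ⟫         ≡⟨ cong (λ z → p ℤ.+ z) (dot-minus p v γ (coroot γ)) ⟩
      p ℤ.+ (p ℤ.- p ℤ.* ⟪ γ , γ ⟫)     ≡⟨ cong (λ z → p ℤ.+ (p ℤ.- p ℤ.* z)) (pairing≡2 γ∈) ⟩
      p ℤ.+ (p ℤ.- p ℤ.* + 2)           ≡⟨ cancel p ⟩
      0ℤ                                ∎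

  -- The composite of two reflections in the same root α is x ↦ x − d(x) α with d(α) = 0,
  -- which has finite orbits on the roots only if d vanishes there.
  coroot-unique : ∀ {α} → α ∈ roots → (f : Vec ℤ n → ℤ) →
                  (∀ c u v → f (u -ᵛ c *ᵛ v) ≡ f u ℤ.- c ℤ.* f v) → f α ≡ + 2 →
                  (∀ {β} → β ∈ roots → β -ᵛ f β *ᵛ α ∈ roots) →
                  ∀ {β} → β ∈ roots → f β ≡ ⟪ β , α ⟫
  coroot-unique {α} α∈ f linear fα≡2 stable {β} β∈ = ℤₚ.i-j≡0⇒i≡j (f β) ⟪ β , α ⟫ d≡0
    where
    open ≡-Reasoning
    d = f β ℤ.- ⟪ β , α ⟫
    orbit : ℕ → Vec ℤ n
    orbit k = β -ᵛ (+ k ℤ.* d) *ᵛ α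
    composite : ∀ x y → let g = ⟪ x , α ⟫ in f x ≡ g ℤ.+ y → f (reflect α x) ≡ y ℤ.- g
    composite x y e = begin
      f (reflect α x)                        ≡⟨ linear ⟪ x , α ⟫ x α ⟩
      f x ℤ.- ⟪ x , α ⟫ ℤ.* f α              ≡⟨ cong₂ (λ a b → a ℤ.- ⟪ x , α ⟫ ℤ.* b) e fα≡2 ⟩
      ⟪ x , α ⟫ ℤ.+ y ℤ.- ⟪ x , α ⟫ ℤ.* + 2  ≡⟨ lemma ⟪ x , α ⟫ y ⟩
      y ℤ.- ⟪ x , α ⟫                        ∎
      where
      lemma : ∀ g y → g ℤ.+ y ℤ.- g ℤ.* + 2 ≡ y ℤ.- g
      lemma = solve-∀
    -- Both `f` and the pairing with α take the value 2 at α, so their discrepancy stays equal to d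
    -- along the whole orbit.
    drift : ∀ k → f (orbit k) ≡ ⟪ orbit k , α ⟫ ℤ.+ d
    drift k = begin
      f (orbit k)                                        ≡⟨ linear (+ k ℤ.* d) β α ⟩
      f β ℤ.- + k ℤ.* d ℤ.* f α                          ≡⟨ cong (λ z → f β ℤ.- + k ℤ.* d ℤ.* z) (trans fα≡2 (sym (pairing≡2 α∈))) ⟩
      f β ℤ.- + k ℤ.* d ℤ.* ⟪ α , α ⟫                    ≡⟨ lemma (f β) ⟪ β , α ⟫ (+ k ℤ.* d ℤ.* ⟪ α , α ⟫) ⟩
      ⟪ β , α ⟫ ℤ.- + k ℤ.* d ℤ.* ⟪ α , α ⟫ ℤ.+ d        ≡⟨ cong (ℤ._+ d) (dot-minus (+ k ℤ.* d) β α (coroot α)) ⟨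
      ⟪ orbit k , α ⟫ ℤ.+ d                              ∎
      where
      lemma : ∀ a b z → a ℤ.- z ≡ b ℤ.- z ℤ.+ (a ℤ.- b)
      lemma = solve-∀
    step : ∀ k → reflect α (orbit k) -ᵛ f (reflect α (orbit k)) *ᵛ α ≡ orbit (suc k)
    step k = begin
      reflect α (orbit k) -ᵛ f (reflect α (orbit k)) *ᵛ α
        ≡⟨ -ᵛ-collinear ⟪ orbit k , α ⟫ _ (orbit k) α ⟩
      orbit k -ᵛ (⟪ orbit k , α ⟫ ℤ.+ f (reflect α (orbit k))) *ᵛ α
        ≡⟨ cong (λ c → orbit k -ᵛ (⟪ orbit k , α ⟫ ℤ.+ c) *ᵛ α) (composite (orbit k) d (drift k)) ⟩
      orbit k -ᵛ (⟪ orbit k , α ⟫ ℤ.+ (d ℤ.- ⟪ orbit k , α ⟫)) *ᵛ α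
        ≡⟨ -ᵛ-collinear (+ k ℤ.* d) _ β α ⟩
      β -ᵛ (+ k ℤ.* d ℤ.+ (⟪ orbit k , α ⟫ ℤ.+ (d ℤ.- ⟪ orbit k , α ⟫))) *ᵛ α
        ≡⟨ cong (λ c → β -ᵛ c *ᵛ α) (lemma (+ k) d ⟪ orbit k , α ⟫) ⟩
      orbit (suc k) ∎
      where
      lemma : ∀ k d g → k ℤ.* d ℤ.+ (g ℤ.+ (d ℤ.- g)) ≡ (1ℤ ℤ.+ k) ℤ.* d
      lemma = solve-∀
    orbit∈ : ∀ k → orbit k ∈ roots
    orbit∈ zero    = subst (_∈ roots)
      (sym (trans (cong (λ c → β -ᵛ c *ᵛ α) (ℤₚ.*-zeroˡ d)) (-ᵛ-0* β α))) β∈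
    orbit∈ (suc k) = subst (_∈ roots) (step k) (stable (reflection α∈ (orbit∈ k)))
    dα≡0 : d *ᵛ α ≡ 0ᵛ
    dα≡0 = finite-progression roots β (d *ᵛ α)
      (λ k → subst (_∈ roots) (-ᵛ-** (+ k) d β α) (orbit∈ k))
    -- Pairing d α = 0 with the coroot of α gives 2 d = 0.
    d≡0 : d ≡ 0ℤ
    d≡0 = ℤₚ.*-cancelʳ-≡ d 0ℤ (+ 2) (begin
      d ℤ.* + 2         ≡⟨ cong (d ℤ.*_) (pairing≡2 α∈) ⟨
      d ℤ.* ⟪ α , α ⟫   ≡⟨ dot-* d α (coroot α) ⟨
      ⟪ d *ᵛ α , α ⟫    ≡⟨ cong ⟪_, α ⟫ dα≡0 ⟩
      ⟪ 0ᵛ , α ⟫        ≡⟨ dot-zero (coroot α) ⟩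
      0ℤ                ∎)

  reflect-minus : ∀ γ c u v → reflect γ (u -ᵛ c *ᵛ v) ≡ reflect γ u -ᵛ c *ᵛ reflect γ v
  reflect-minus γ c u v = trans
    (cong (λ z → u -ᵛ c *ᵛ v -ᵛ z *ᵛ γ) (dot-minus c u v (coroot γ)))
    (lemma ⟪ u , γ ⟫ ⟪ v , γ ⟫ u v γ)
    where
    entry : ∀ x y z p q c → x ℤ.- c ℤ.* y ℤ.- (p ℤ.- c ℤ.* q) ℤ.* z ≡ x ℤ.- p ℤ.* z ℤ.- c ℤ.* (y ℤ.- q ℤ.* z)
    entry = solve-∀
    lemma : ∀ {m} p q (u v w : Vec ℤ m) →
            u -ᵛ c *ᵛ v -ᵛ (p ℤ.- c ℤ.* q) *ᵛ w ≡ u -ᵛ p *ᵛ w -ᵛ c *ᵛ (v -ᵛ q *ᵛ w)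
    lemma p q []      []      []      = refl
    lemma p q (x ∷ u) (y ∷ v) (z ∷ w) = cong₂ _∷_ (entry x y z p q c) (lemma p q u v w)

  -- Conjugating the reflection in α by the reflection in γ gives a reflection in `reflect γ α` that
  -- preserves the roots. Hence v ↦ ⟨s v , α^∨⟩, with s the reflection in γ, has the properties that
  -- determine the coroot of `reflect γ α` on roots.
  coroot-reflect : ∀ {γ α β} → γ ∈ roots → α ∈ roots → β ∈ roots →
                   ⟪ reflect γ β , α ⟫ ≡ ⟪ β , reflect γ α ⟫
  coroot-reflect {γ} {α} γ∈ α∈ = coroot-unique (reflection γ∈ α∈) (λ v → ⟪ reflect γ v , α ⟫)
    (λ c u v → trans (cong ⟪_, α ⟫ (reflect-minus γ c u v)) (dot-minus c (reflect γ u) (reflect γ v) (coroot α)))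
    (trans (cong ⟪_, α ⟫ (reflect-involutive γ∈ α)) (pairing≡2 α∈))
    (λ {β} β∈ → subst (_∈ roots)
      (trans (reflect-minus γ ⟪ reflect γ β , α ⟫ (reflect γ β) α) (cong (_-ᵛ ⟪ reflect γ β , α ⟫ *ᵛ reflect γ α) (reflect-involutive γ∈ β)))
      (reflection γ∈ (reflection α∈ (reflection γ∈ β∈))))

  -- The list `roots` may repeat entries, and a reflection need not preserve multiplicities; without
  -- repetitions it permutes the list.
  distinctRoots : List (Vec ℤ n)
  distinctRoots = deduplicate _≟ᵛ_ roots

  -- At `distinctRoots` this is the canonical invariant form, a sum of squares on the diagonal,
  -- which requires no choice of root lengths. The list is an argument so that identities can be
  -- proved by induction on it.
  formOver : List (Vec ℤ n) → Vec ℤ n → Vec ℤ n → ℤ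
  formOver γs u w = sumℤ (List.map (λ γ → ⟪ u , γ ⟫ ℤ.* ⟪ w , γ ⟫) γs)

  opaque
    form : Vec ℤ n → Vec ℤ n → ℤ
    form = formOver distinctRoots

  distinct⁺ : ∀ {γ} → γ ∈ roots → γ ∈ distinctRoots
  distinct⁺ = ∈ₚ.∈-deduplicate⁺ _≟ᵛ_

  distinct⁻ : ∀ {γ} → γ ∈ distinctRoots → γ ∈ roots
  distinct⁻ = ∈ₚ.∈-deduplicate⁻ _≟ᵛ_ roots

  -- An involution is injective, so the image list has no repetitions; two such lists with the same
  -- members are permutations of each other.
  reflect-permutes : ∀ {γ} → γ ∈ roots → List.map (reflect γ) distinctRoots ↭ distinctRoots
  reflect-permutes {γ} γ∈ = ∼bag⇒↭ (unique∧set⇒bag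
    (Uniqueₚ.map⁺ reflect-injective unique) unique (mk⇔ to from))
    where
    unique : Unique distinctRoots
    unique = DecUnique.deduplicate-! _≟ᵛ_ roots
    reflect-injective : ∀ {x y} → reflect γ x ≡ reflect γ y → x ≡ y
    reflect-injective {x} {y} e =
      trans (sym (reflect-involutive γ∈ x)) (trans (cong (reflect γ) e) (reflect-involutive γ∈ y))
    to : ∀ {x} → x ∈ List.map (reflect γ) distinctRoots → x ∈ distinctRoots
    to x∈ with ∈ₚ.∈-map⁻ (reflect γ) x∈
    ... | y , y∈ , refl = distinct⁺ (reflection γ∈ (distinct⁻ y∈))
    from : ∀ {x} → x ∈ distinctRoots → x ∈ List.map (reflect γ) distinctRoots
    from {x} x∈ = subst (_∈ List.map (reflect γ) distinctRoots) (reflect-involutive γ∈ x)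
      (∈ₚ.∈-map⁺ (reflect γ) (distinct⁺ (reflection γ∈ (distinct⁻ x∈))))

  opaque
    unfolding form

    -- `coroot-reflect` moves the reflection from the vectors to the summation index, where it only
    -- permutes the terms. Since `coroot-reflect` speaks of pairings of roots, u and w are roots
    -- here.
    form-reflect : ∀ {γ u w} → γ ∈ roots → u ∈ roots → w ∈ roots →
                   form (reflect γ u) (reflect γ w) ≡ form u w
    form-reflect {γ} {u} {w} γ∈ u∈ w∈ = trans (over distinctRoots distinct⁻)
      (sumℤ-↭ (↭ₚ.map⁺ _ (reflect-permutes γ∈)))
      where
      over : ∀ δs → (∀ {δ} → δ ∈ δs → δ ∈ roots) →
             formOver δs (reflect γ u) (reflect γ w) ≡ formOver (List.map (reflect γ) δs) u w
      over []       _  = refl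
      over (δ ∷ δs) δ∈ = cong₂ ℤ._+_
        (cong₂ ℤ._*_ (coroot-reflect γ∈ (δ∈ (here refl)) u∈) (coroot-reflect γ∈ (δ∈ (here refl)) w∈))
        (over δs (δ∈ ∘ there))

    form-sym : ∀ u w → form u w ≡ form w u
    form-sym u w = over distinctRoots
      where
      over : ∀ γs → formOver γs u w ≡ formOver γs w u
      over []       = refl
      over (γ ∷ γs) = cong₂ ℤ._+_ (ℤₚ.*-comm ⟪ u , γ ⟫ ⟪ w , γ ⟫) (over γs)

    form-minusˡ : ∀ c u v w → form (u -ᵛ c *ᵛ v) w ≡ form u w ℤ.- c ℤ.* form v w
    form-minusˡ c u v w = over distinctRoots
      where
      lemma : ∀ a b e c p q → (a ℤ.- c ℤ.* b) ℤ.* e ℤ.+ (p ℤ.- c ℤ.* q) ≡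
              (a ℤ.* e ℤ.+ p) ℤ.- c ℤ.* (b ℤ.* e ℤ.+ q)
      lemma = solve-∀
      zero-case : ∀ c → 0ℤ ≡ 0ℤ ℤ.- c ℤ.* 0ℤ
      zero-case = solve-∀
      over : ∀ γs → formOver γs (u -ᵛ c *ᵛ v) w ≡ formOver γs u w ℤ.- c ℤ.* formOver γs v w
      over []       = zero-case c
      over (γ ∷ γs) = trans
        (cong₂ (λ a b → a ℤ.* ⟪ w , γ ⟫ ℤ.+ b) (dot-minus c u v (coroot γ)) (over γs))
        (lemma ⟪ u , γ ⟫ ⟪ v , γ ⟫ ⟪ w , γ ⟫ c (formOver γs u w) (formOver γs v w))

    form-minusʳ : ∀ c u v w → form w (u -ᵛ c *ᵛ v) ≡ form w u ℤ.- c ℤ.* form w v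
    form-minusʳ c u v w = trans (form-sym w (u -ᵛ c *ᵛ v)) (trans (form-minusˡ c u v w)
      (cong₂ (λ a b → a ℤ.- c ℤ.* b) (form-sym u w) (form-sym v w)))

    square≥0 : ∀ a → 0ℤ ℤ.≤ a ℤ.* a
    square≥0 (+ k)    = subst (0ℤ ℤ.≤_) (ℤₚ.pos-* k k) (ℤ.+≤+ ℕ.z≤n)
    square≥0 -[1+ k ] = ℤ.+≤+ ℕ.z≤n

    formOver≥0 : ∀ γs v → 0ℤ ℤ.≤ formOver γs v v
    formOver≥0 []       v = ℤₚ.≤-refl
    formOver≥0 (γ ∷ γs) v = ℤₚ.+-mono-≤ (square≥0 ⟪ v , γ ⟫) (formOver≥0 γs v)

    form≥0 : ∀ v → 0ℤ ℤ.≤ form v v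
    form≥0 = formOver≥0 distinctRoots

    form≥square : ∀ v {γ} → γ ∈ roots → ⟪ v , γ ⟫ ℤ.* ⟪ v , γ ⟫ ℤ.≤ form v v
    form≥square v γ∈ = over distinctRoots (distinct⁺ γ∈)
      where
      over : ∀ γs {γ} → γ ∈ γs → ⟪ v , γ ⟫ ℤ.* ⟪ v , γ ⟫ ℤ.≤ formOver γs v v
      over (γ ∷ γs) (here refl) = subst (λ z → z ℤ.≤ formOver (γ ∷ γs) v v) (ℤₚ.+-identityʳ (⟪ v , γ ⟫ ℤ.* ⟪ v , γ ⟫))
        (ℤₚ.+-monoʳ-≤ (⟪ v , γ ⟫ ℤ.* ⟪ v , γ ⟫) (formOver≥0 γs v))
      over (γ ∷ γs) {δ} (there γ∈) = subst (λ z → z ℤ.≤ formOver (γ ∷ γs) v v)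
        (ℤₚ.+-identityˡ (⟪ v , δ ⟫ ℤ.* ⟪ v , δ ⟫)) (ℤₚ.+-mono-≤ (square≥0 ⟪ v , γ ⟫) (over γs γ∈))

  -- The summand of index γ alone contributes 2 · 2.
  form-root>0 : ∀ {γ} → γ ∈ roots → 0ℤ ℤ.< form γ γ
  form-root>0 {γ} γ∈ = ℤₚ.<-≤-trans (ℤ.+<+ (ℕ.s≤s ℕ.z≤n))
    (subst (λ z → z ℤ.* z ℤ.≤ form γ γ) (pairing≡2 γ∈) (form≥square γ γ∈))

  isotropic⇒null : ∀ v → form v v ≡ 0ℤ → ∀ {γ} → γ ∈ roots → ⟪ v , γ ⟫ ≡ 0ℤ
  isotropic⇒null v e {γ} γ∈ with ℤₚ.i*j≡0⇒i≡0∨j≡0 ⟪ v , γ ⟫ {⟪ v , γ ⟫}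
    (ℤₚ.≤-antisym (subst (λ z → ⟪ v , γ ⟫ ℤ.* ⟪ v , γ ⟫ ℤ.≤ z) e (form≥square v γ∈)) (square≥0 ⟪ v , γ ⟫))
  ... | inj₁ z = z
  ... | inj₂ z = z

  -- Invariance under the reflection in α reads (-α , v - p α) = (α , v) with p = ⟨v , α^∨⟩;
  -- expanding gives the usual formula p = 2 (α , v) / (α , α), cleared of its denominator.
  form-pairing : ∀ {α v} → α ∈ roots → v ∈ roots → ⟪ v , α ⟫ ℤ.* form α α ≡ + 2 ℤ.* form α v
  form-pairing {α} {v} α∈ v∈ = lemma (form α α) (form α v) ⟪ v , α ⟫ (begin
    form α v ℤ.- + 2 ℤ.* form α v ℤ.- p ℤ.* (form α α ℤ.- + 2 ℤ.* form α α)
      ≡⟨ cong₂ (λ a b → a ℤ.- p ℤ.* b) (form-minusˡ (+ 2) α α v) (form-minusˡ (+ 2) α α α) ⟨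
    form (α -ᵛ + 2 *ᵛ α) v ℤ.- p ℤ.* form (α -ᵛ + 2 *ᵛ α) α
      ≡⟨ form-minusʳ p v α (α -ᵛ + 2 *ᵛ α) ⟨
    form (α -ᵛ + 2 *ᵛ α) (reflect α v)
      ≡⟨ cong (λ c → form (α -ᵛ c *ᵛ α) (reflect α v)) (pairing≡2 α∈) ⟨
    form (reflect α α) (reflect α v)  ≡⟨ form-reflect α∈ α∈ v∈ ⟩
    form α v                          ∎)
    where
    open ≡-Reasoning
    p = ⟪ v , α ⟫
    expand : ∀ a b p → p ℤ.* a ≡ (b ℤ.- + 2 ℤ.* b ℤ.- p ℤ.* (a ℤ.- + 2 ℤ.* a)) ℤ.+ b
    expand = solve-∀
    double : ∀ b → b ℤ.+ b ≡ + 2 ℤ.* b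
    double = solve-∀
    lemma : ∀ a b p → b ℤ.- + 2 ℤ.* b ℤ.- p ℤ.* (a ℤ.- + 2 ℤ.* a) ≡ b → p ℤ.* a ≡ + 2 ℤ.* b
    lemma a b p e = trans (expand a b p) (trans (cong (ℤ._+ b) e) (double b))

-- Heights, nonnegative vectors and supports.

dot-comm : ∀ {n} (u w : Vec ℤ n) → dot u w ≡ dot w u
dot-comm []      []      = refl
dot-comm (x ∷ u) (y ∷ w) = cong₂ ℤ._+_ (ℤₚ.*-comm x y) (dot-comm u w)

dot-+ : ∀ {n} (u v w : Vec ℤ n) → dot (u +ᵛ v) w ≡ dot u w ℤ.+ dot v w
dot-+ []      []      []      = refl
dot-+ (x ∷ u) (y ∷ v) (z ∷ w) = trans (cong (λ e → (x ℤ.+ y) ℤ.* z ℤ.+ e) (dot-+ u v w))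
  (lemma x y z (dot u w) (dot v w))
  where
  lemma : ∀ x y z p q → (x ℤ.+ y) ℤ.* z ℤ.+ (p ℤ.+ q) ≡ (x ℤ.* z ℤ.+ p) ℤ.+ (y ℤ.* z ℤ.+ q)
  lemma = solve-∀

dot-- : ∀ {n} (u v w : Vec ℤ n) → dot (u -ᵛ v) w ≡ dot u w ℤ.- dot v w
dot-- u v w = trans (cong (λ z → dot z w) (sym (-ᵛ-1* u v))) (trans (dot-minus 1ℤ u v w)
  (cong (λ z → dot u w ℤ.- z) (ℤₚ.*-identityˡ (dot v w))))

dot-simple : ∀ {n} (i : Fin n) (w : Vec ℤ n) → dot (simple i) w ≡ lookup w i
dot-simple zero    (x ∷ w) = trans (cong₂ ℤ._+_ (ℤₚ.*-identityˡ x) (dot-zero w)) (ℤₚ.+-identityʳ x)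
dot-simple (suc i) (x ∷ w) = trans (cong₂ ℤ._+_ (ℤₚ.*-zeroˡ x) (dot-simple i w)) (ℤₚ.+-identityˡ _)

height : ∀ {n} → Vec ℤ n → ℤ
height v = dot v (replicate _ 1ℤ)

lookup-ones : ∀ {n} (i : Fin n) → lookup (replicate n 1ℤ) i ≡ 1ℤ
lookup-ones zero    = refl
lookup-ones (suc i) = lookup-ones i

height-simple : ∀ {n} (i : Fin n) → height (simple i) ≡ 1ℤ
height-simple i = trans (dot-simple i (replicate _ 1ℤ)) (lookup-ones i)

height≥0 : ∀ {n} {v : Vec ℤ n} → NonNeg v → 0ℤ ℤ.≤ height v
height≥0 []                     = ℤₚ.≤-refl
height≥0 (_∷_ {x = x} x≥0 v≥0) =
  ℤₚ.+-mono-≤ (subst (λ z → 0ℤ ℤ.≤ z) (sym (ℤₚ.*-identityʳ x)) x≥0) (height≥0 v≥0)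

height>0 : ∀ {n} {v : Vec ℤ n} → NonNeg v → v ≢ 0ᵛ → 0ℤ ℤ.< height v
height>0 []                              v≢0 = ⊥-elim (v≢0 refl)
height>0 (_∷_ {x = x} {xs = v} x≥0 v≥0) v≢0 with x ℤₚ.≟ 0ℤ
... | yes refl = subst (λ z → 0ℤ ℤ.< z) (sym (ℤₚ.+-identityˡ (height v)))
                   (height>0 v≥0 (v≢0 ∘ cong (0ℤ ∷_)))
... | no  x≢0  = ℤₚ.+-mono-<-≤ (subst (λ z → 0ℤ ℤ.< z) (sym (ℤₚ.*-identityʳ x))
                   (ℤₚ.≤∧≢⇒< x≥0 (x≢0 ∘ sym))) (height≥0 v≥0)

nonNeg-0 : ∀ {n} → NonNeg (0ᵛ {n})
nonNeg-0 {zero}  = []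
nonNeg-0 {suc n} = ℤₚ.≤-refl ∷ nonNeg-0

nonNeg-+ : ∀ {n} {u v : Vec ℤ n} → NonNeg u → NonNeg v → NonNeg (u +ᵛ v)
nonNeg-+ []         []         = []
nonNeg-+ (x≥0 ∷ u≥0) (y≥0 ∷ v≥0) = ℤₚ.+-mono-≤ x≥0 y≥0 ∷ nonNeg-+ u≥0 v≥0

nonNeg-trans : ∀ {n} (u v w : Vec ℤ n) → NonNeg (v -ᵛ u) → NonNeg (w -ᵛ v) → NonNeg (w -ᵛ u)
nonNeg-trans []      []      []      []      []      = []
nonNeg-trans (x ∷ u) (y ∷ v) (z ∷ w) (p ∷ ps) (q ∷ qs) =
  subst (λ e → 0ℤ ℤ.≤ e) (lemma x y z) (ℤₚ.+-mono-≤ p q) ∷ nonNeg-trans u v w ps qs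
  where
  lemma : ∀ x y z → (y ℤ.- x) ℤ.+ (z ℤ.- y) ≡ z ℤ.- x
  lemma = solve-∀

neg-minus : ∀ {n} (u v : Vec ℤ n) → -ᵛ (u -ᵛ v) ≡ v -ᵛ u
neg-minus []      []      = refl
neg-minus (x ∷ u) (y ∷ v) = cong₂ _∷_ (lemma x y) (neg-minus u v)
  where
  lemma : ∀ x y → ℤ.- (x ℤ.- y) ≡ y ℤ.- x
  lemma = solve-∀

minus-minus : ∀ {n} (u v : Vec ℤ n) → u -ᵛ (u -ᵛ v) ≡ v
minus-minus []      []      = refl
minus-minus (x ∷ u) (y ∷ v) = cong₂ _∷_ (lemma x y) (minus-minus u v)
  where
  lemma : ∀ x y → x ℤ.- (x ℤ.- y) ≡ y
  lemma = solve-∀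

minus-double : ∀ {n} (u v : Vec ℤ n) → (u -ᵛ v) -ᵛ + 2 *ᵛ (u -ᵛ v) ≡ v -ᵛ u
minus-double []      []      = refl
minus-double (x ∷ u) (y ∷ v) = cong₂ _∷_ (lemma x y) (minus-double u v)
  where
  lemma : ∀ x y → (x ℤ.- y) ℤ.- + 2 ℤ.* (x ℤ.- y) ≡ y ℤ.- x
  lemma = solve-∀

minus-zero : ∀ {n} (v : Vec ℤ n) → v -ᵛ 0ᵛ ≡ v
minus-zero []      = refl
minus-zero (x ∷ v) = cong₂ _∷_ (ℤₚ.+-identityʳ x) (minus-zero v)

simple-nonNeg : ∀ {n} (i : Fin n) → NonNeg (simple i)
simple-nonNeg zero    = ℤ.+≤+ ℕ.z≤n ∷ nonNeg-0
simple-nonNeg (suc i) = ℤₚ.≤-refl ∷ simple-nonNeg i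

minus-simple-nonNeg : ∀ {n} {v : Vec ℤ n} → NonNeg v → ∀ i → 0ℤ ℤ.< lookup v i → NonNeg (v -ᵛ simple i)
minus-simple-nonNeg {v = x ∷ v} (_ ∷ v≥0)   zero    0<x = ℤₚ.i≤j⇒0≤j-i (ℤₚ.i<j⇒suc[i]≤j 0<x)
  ∷ subst NonNeg (sym (minus-zero v)) v≥0
minus-simple-nonNeg {v = x ∷ v} (x≥0 ∷ v≥0) (suc i) 0<vᵢ =
  subst (λ z → 0ℤ ℤ.≤ z) (sym (ℤₚ.+-identityʳ x)) x≥0 ∷ minus-simple-nonNeg v≥0 i 0<vᵢ

nonZero⇒entry : ∀ {n} {v : Vec ℤ n} → v ≢ 0ᵛ → ∃[ i ] lookup v i ≢ 0ℤ
nonZero⇒entry {v = []}    v≢0 = ⊥-elim (v≢0 refl)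
nonZero⇒entry {v = x ∷ v} v≢0 with x ℤₚ.≟ 0ℤ
... | no  x≢0  = zero , x≢0
... | yes refl = let (i , p) = nonZero⇒entry (v≢0 ∘ cong (0ℤ ∷_)) in suc i , p

*-nonNeg : ∀ {a b} → 0ℤ ℤ.≤ a → 0ℤ ℤ.≤ b → 0ℤ ℤ.≤ a ℤ.* b
*-nonNeg {+ a} {+ b} _ _ = subst (λ z → 0ℤ ℤ.≤ z) (ℤₚ.pos-* a b) (ℤ.+≤+ ℕ.z≤n)

-- A positive sum has a positive term, and in that term the factor coming from v is nonnegative, so
-- both factors are positive.
dot-positive : ∀ {n} {v : Vec ℤ n} → NonNeg v → ∀ w → 0ℤ ℤ.< dot v w →
               ∃[ i ] 0ℤ ℤ.< lookup v i × 0ℤ ℤ.< lookup w i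
dot-positive [] [] (ℤ.+<+ ())
dot-positive {v = x ∷ v} (x≥0 ∷ v≥0) (y ∷ w) p with 0ℤ ℤₚ.<? x | 0ℤ ℤₚ.<? y
... | yes 0<x | yes 0<y = zero , 0<x , 0<y
... | no  0≮x | _       = let (i , q) = dot-positive v≥0 w (subst (λ z → 0ℤ ℤ.< z)
                                          (trans (cong (λ z → z ℤ.* y ℤ.+ dot v w) (ℤₚ.≤-antisym (ℤₚ.≮⇒≥ 0≮x) x≥0))
                                            (trans (cong (ℤ._+ dot v w) (ℤₚ.*-zeroˡ y)) (ℤₚ.+-identityˡ (dot v w)))) p)
                          in suc i , q
... | yes _   | no 0≮y  = let (i , q) = dot-positive v≥0 w (ℤₚ.<-≤-trans p
                                          (subst (λ z → x ℤ.* y ℤ.+ dot v w ℤ.≤ z) (ℤₚ.+-identityˡ (dot v w))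
                                            (ℤₚ.+-monoˡ-≤ (dot v w) x*y≤0)))
                          in suc i , q
  where
  x*y≤0 : x ℤ.* y ℤ.≤ 0ℤ
  x*y≤0 = ℤₚ.neg-cancel-≤ (subst (λ z → 0ℤ ℤ.≤ z) (sym (ℤₚ.neg-distribʳ-* x y))
            (*-nonNeg x≥0 (ℤₚ.neg-mono-≤ (ℤₚ.≮⇒≥ 0≮y))))

suc-cancel-< : ∀ {i j} → ℤ.suc i ℤ.< ℤ.suc j → i ℤ.< j
suc-cancel-< {i} {j} p = subst₂ ℤ._<_ (lemma i) (lemma j) (ℤₚ.+-monoʳ-< -[1+ 0 ] p)
  where
  lemma : ∀ x → -[1+ 0 ] ℤ.+ (1ℤ ℤ.+ x) ≡ x
  lemma = solve-∀

Supported : ∀ {n} → Vec ℤ n → Vec ℤ n → Set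
Supported v w = ∀ i → lookup v i ≡ 0ℤ → lookup w i ≡ 0ℤ

-- Nonnegative terms with vanishing sum vanish.
dot-supported : ∀ {n} (v w l : Vec ℤ n) → (∀ i → 0ℤ ℤ.≤ lookup v i ℤ.* lookup l i) →
                dot v l ≡ 0ℤ → Supported v w → dot w l ≡ 0ℤ
dot-supported []      []      []      _   _ _    = refl
dot-supported (x ∷ v) (y ∷ w) (z ∷ l) l≥0 e supp =
  cong₂ ℤ._+_ y*z≡0 (dot-supported v w l (l≥0 ∘ suc) tail≡0 (supp ∘ suc))
  where
  dot≥0 : ∀ {n} (v l : Vec ℤ n) → (∀ i → 0ℤ ℤ.≤ lookup v i ℤ.* lookup l i) → 0ℤ ℤ.≤ dot v l
  dot≥0 []      []      _ = ℤₚ.≤-refl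
  dot≥0 (x ∷ v) (z ∷ l) p = ℤₚ.+-mono-≤ (p zero) (dot≥0 v l (p ∘ suc))
  tail≡0 : dot v l ≡ 0ℤ
  tail≡0 = ℤₚ.≤-antisym
    (ℤₚ.≤-trans (subst (ℤ._≤ x ℤ.* z ℤ.+ dot v l) (ℤₚ.+-identityˡ (dot v l)) (ℤₚ.+-monoˡ-≤ (dot v l) (l≥0 zero))) (ℤₚ.≤-reflexive e))
    (dot≥0 v l (l≥0 ∘ suc))
  head≡0 : x ℤ.* z ≡ 0ℤ
  head≡0 = trans (sym (ℤₚ.+-identityʳ (x ℤ.* z))) (trans (cong (λ e → x ℤ.* z ℤ.+ e) (sym tail≡0)) e)
  y*z≡0 : y ℤ.* z ≡ 0ℤ
  y*z≡0 with ℤₚ.i*j≡0⇒i≡0∨j≡0 x head≡0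
  ... | inj₁ x≡0 = cong (ℤ._* z) (supp zero x≡0)
  ... | inj₂ z≡0 = trans (cong (y ℤ.*_) z≡0) (ℤₚ.*-zeroʳ y)

extract : ∀ {A : Set} {P : A → Set} {xs} → Any P xs → ∃[ x ] ∃[ ys ] P x × xs ↭ x ∷ ys
extract {xs = x ∷ xs} (here p)  = x , xs , p , ↭-refl
extract {xs = x ∷ xs} (there p) = let (y , ys , q , r) = extract p in
  y , x ∷ ys , q , ↭-trans (↭-prep x r) (↭-swap x y ↭-refl)

cancel-positive : ∀ a b {c} → 0ℤ ℤ.< b → a ℤ.* b ≡ c → 0ℤ ℤ.< c → 0ℤ ℤ.< a
cancel-positive a b {c} 0<b e 0<c with 0ℤ ℤₚ.<? a
... | yes 0<a = 0<a
... | no  0≮a = ⊥-elim (ℤₚ.<⇒≱ 0<c (subst (ℤ._≤ 0ℤ) e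
  (ℤₚ.neg-cancel-≤ (subst (λ z → 0ℤ ℤ.≤ z) (sym (ℤₚ.neg-distribˡ-* a b))
    (*-nonNeg (ℤₚ.neg-mono-≤ (ℤₚ.≮⇒≥ 0≮a)) (ℤₚ.<⇒≤ 0<b))))))

-- Differences of roots and definiteness of the form.

module Domination {n} {X : Dynkin n} (Φ : RootSystem X) where
  open RootSystem Φ
  open RootTheory Φ
  open PosRoot

  double-zero : ∀ {m} (u v : Vec ℤ m) → + 2 *ᵛ (u -ᵛ v) ≡ 0ᵛ → u ≡ v
  double-zero []      []      _ = refl
  double-zero (x ∷ u) (y ∷ v) e = cong₂ _∷_
    (ℤₚ.i-j≡0⇒i≡j x y (ℤₚ.*-cancelˡ-≡ (+ 2) (x ℤ.- y) 0ℤ (cong Vec.head e)))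
    (double-zero u v (cong Vec.tail e))

  -- If α − β were null, reflecting in α and then in β would translate β by 2 (β − α).
  null-difference : ∀ {α β} → α ∈ roots → β ∈ roots →
                    (∀ {γ} → γ ∈ roots → ⟪ α -ᵛ β , γ ⟫ ≡ 0ℤ) → α ≡ β
  null-difference {α} {β} α∈ β∈ null = double-zero α β (finite-progression roots β w orbit∈)
    where
    open ≡-Reasoning
    w = + 2 *ᵛ (α -ᵛ β)
    orbit : ℕ → Vec ℤ n
    orbit k = β -ᵛ + k *ᵛ w
    pairing-orbit : ∀ k {γ} → γ ∈ roots → ⟪ orbit k , γ ⟫ ≡ ⟪ β , γ ⟫
    pairing-orbit k {γ} γ∈ = begin
      ⟪ orbit k , γ ⟫                                      ≡⟨ dot-minus (+ k) β w (coroot γ) ⟩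
      ⟪ β , γ ⟫ ℤ.- + k ℤ.* ⟪ w , γ ⟫                      ≡⟨ cong (λ z → ⟪ β , γ ⟫ ℤ.- + k ℤ.* z) (dot-* (+ 2) (α -ᵛ β) (coroot γ)) ⟩
      ⟪ β , γ ⟫ ℤ.- + k ℤ.* (+ 2 ℤ.* ⟪ α -ᵛ β , γ ⟫)       ≡⟨ cong (λ z → ⟪ β , γ ⟫ ℤ.- + k ℤ.* (+ 2 ℤ.* z)) (null γ∈) ⟩
      ⟪ β , γ ⟫ ℤ.- + k ℤ.* 0ℤ                             ≡⟨ lemma ⟪ β , γ ⟫ (+ k) ⟩
      ⟪ β , γ ⟫                                            ∎
      where
      lemma : ∀ b k → b ℤ.- k ℤ.* 0ℤ ≡ b
      lemma = solve-∀
    same-pairing : ∀ {γ} → γ ∈ roots → ⟪ α , γ ⟫ ≡ ⟪ β , γ ⟫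
    same-pairing {γ} γ∈ = ℤₚ.i-j≡0⇒i≡j _ _ (trans (sym (dot-- α β (coroot γ))) (null γ∈))
    pairing-α : ∀ k → ⟪ orbit k , α ⟫ ≡ + 2
    pairing-α k = trans (pairing-orbit k α∈) (trans (sym (same-pairing α∈)) (pairing≡2 α∈))
    pairing-β : ∀ k → ⟪ orbit k -ᵛ + 2 *ᵛ α , β ⟫ ≡ ℤ.- + 2
    pairing-β k = trans (dot-minus (+ 2) (orbit k) α (coroot β))
      (cong₂ (λ a b → a ℤ.- + 2 ℤ.* b) (trans (pairing-orbit k β∈) (pairing≡2 β∈))
                                       (trans (same-pairing β∈) (pairing≡2 β∈)))
    step : ∀ k → reflect β (reflect α (orbit k)) ≡ orbit (suc k)
    step k = begin
      reflect β (reflect α (orbit k))                 ≡⟨ cong (λ c → reflect β (orbit k -ᵛ c *ᵛ α)) (pairing-α k) ⟩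
      reflect β (orbit k -ᵛ + 2 *ᵛ α)                 ≡⟨ cong (λ c → orbit k -ᵛ + 2 *ᵛ α -ᵛ c *ᵛ β) (pairing-β k) ⟩
      orbit k -ᵛ + 2 *ᵛ α -ᵛ (ℤ.- + 2) *ᵛ β           ≡⟨ vectors (+ k) α β β ⟩
      orbit (suc k)                                   ∎
      where
      entry : ∀ k a b c → c ℤ.- k ℤ.* (+ 2 ℤ.* (a ℤ.- b)) ℤ.- + 2 ℤ.* a ℤ.- (ℤ.- + 2) ℤ.* b ≡
              c ℤ.- (1ℤ ℤ.+ k) ℤ.* (+ 2 ℤ.* (a ℤ.- b))
      entry = solve-∀
      vectors : ∀ {m} k (a b c : Vec ℤ m) →
                c -ᵛ k *ᵛ (+ 2 *ᵛ (a -ᵛ b)) -ᵛ + 2 *ᵛ a -ᵛ (ℤ.- + 2) *ᵛ b ≡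
                c -ᵛ (1ℤ ℤ.+ k) *ᵛ (+ 2 *ᵛ (a -ᵛ b))
      vectors k []      []      []      = refl
      vectors k (x ∷ a) (y ∷ b) (z ∷ c) = cong₂ _∷_ (entry k x y z) (vectors k a b c)
    orbit∈ : ∀ k → orbit k ∈ roots
    orbit∈ zero    = subst (_∈ roots) (sym (-ᵛ-0* β w)) β∈
    orbit∈ (suc k) = subst (_∈ roots) (step k) (reflection β∈ (reflection α∈ (orbit∈ k)))

  swap-difference : ∀ {α β} → α -ᵛ β ∈ roots → β -ᵛ α ∈ roots
  swap-difference {α} {β} d∈ = subst (_∈ roots)
    (trans (cong (λ c → (α -ᵛ β) -ᵛ c *ᵛ (α -ᵛ β)) (pairing≡2 d∈)) (minus-double α β))
    (reflection d∈ d∈)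

  -- By `form-pairing`, p = ⟨β , α^∨⟩ and q = ⟨α , β^∨⟩ are positive. If one of them is 1, the
  -- corresponding reflection produces the difference. If both are at least 2, then (α , α) and (β ,
  -- β) are at most (α , β), so (α - β , α - β) ≤ 0; then α - β pairs to 0 with every coroot, and α
  -- = β.
  difference-root : ∀ {α β} → α ∈ roots → β ∈ roots → 0ℤ ℤ.< form α β →
                    α ≡ β ⊎ β -ᵛ α ∈ roots
  difference-root {α} {β} α∈ β∈ 0<αβ =
    cases ⟪ β , α ⟫ ⟪ α , β ⟫ refl refl (form-pairing α∈ β∈) (trans (form-pairing β∈ α∈) (cong (+ 2 ℤ.*_) (form-sym β α)))
    where
    0<2αβ : 0ℤ ℤ.< + 2 ℤ.* form α β
    0<2αβ = subst (ℤ._< + 2 ℤ.* form α β) (ℤₚ.*-zeroʳ (+ 2)) (ℤₚ.*-monoˡ-<-pos (+ 2) 0<αβ)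
    norm : form (α -ᵛ β) (α -ᵛ β) ≡ form α α ℤ.- form α β ℤ.- (form α β ℤ.- form β β)
    norm = begin
      form (α -ᵛ β) (α -ᵛ β)             ≡⟨ cong₂ form (-ᵛ-1* α β) (-ᵛ-1* α β) ⟨
      form (α -ᵛ 1ℤ *ᵛ β) (α -ᵛ 1ℤ *ᵛ β) ≡⟨ form-minusʳ 1ℤ α β (α -ᵛ 1ℤ *ᵛ β) ⟩
      form (α -ᵛ 1ℤ *ᵛ β) α ℤ.- 1ℤ ℤ.* form (α -ᵛ 1ℤ *ᵛ β) β
        ≡⟨ cong₂ (λ a b → a ℤ.- 1ℤ ℤ.* b) (form-minusˡ 1ℤ α β α) (form-minusˡ 1ℤ α β β) ⟩
      form α α ℤ.- 1ℤ ℤ.* form β α ℤ.- 1ℤ ℤ.* (form α β ℤ.- 1ℤ ℤ.* form β β)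
        ≡⟨ cong (λ z → form α α ℤ.- 1ℤ ℤ.* z ℤ.- 1ℤ ℤ.* (form α β ℤ.- 1ℤ ℤ.* form β β)) (form-sym β α) ⟩
      form α α ℤ.- 1ℤ ℤ.* form α β ℤ.- 1ℤ ℤ.* (form α β ℤ.- 1ℤ ℤ.* form β β)
        ≡⟨ lemma (form α α) (form α β) (form β β) ⟩
      form α α ℤ.- form α β ℤ.- (form α β ℤ.- form β β) ∎
      where
      open ≡-Reasoning
      lemma : ∀ a b c → a ℤ.- 1ℤ ℤ.* b ℤ.- 1ℤ ℤ.* (b ℤ.- 1ℤ ℤ.* c) ≡ a ℤ.- b ℤ.- (b ℤ.- c)
      lemma = solve-∀
    cases : ∀ p q → ⟪ β , α ⟫ ≡ p → ⟪ α , β ⟫ ≡ q →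
            p ℤ.* form α α ≡ + 2 ℤ.* form α β → q ℤ.* form β β ≡ + 2 ℤ.* form α β →
            α ≡ β ⊎ β -ᵛ α ∈ roots
    cases p q p≡ q≡ pαα qββ with cancel-positive p _ (form-root>0 α∈) pαα 0<2αβ
                              | cancel-positive q _ (form-root>0 β∈) qββ 0<2αβ
    cases (+ 1) q p≡ q≡ _ _ | _ | _ = inj₂ (subst (_∈ roots)
      (trans (cong (λ c → β -ᵛ c *ᵛ α) p≡) (-ᵛ-1* β α)) (reflection α∈ β∈))
    cases (+ suc (suc _)) (+ 1) p≡ q≡ _ _ | _ | _ = inj₂ (swap-difference (subst (_∈ roots)
      (trans (cong (λ c → α -ᵛ c *ᵛ β) q≡) (-ᵛ-1* α β)) (reflection β∈ α∈)))
    cases (+ suc (suc k)) (+ suc (suc l)) _ _ pαα qββ | _ | _ =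
      inj₁ (null-difference α∈ β∈ (isotropic⇒null (α -ᵛ β) (ℤₚ.≤-antisym norm≤0 (form≥0 (α -ᵛ β)))))
      where
      twice : + 2 ℤ.* form (α -ᵛ β) (α -ᵛ β) ≡ ℤ.- (+ k ℤ.* form α α ℤ.+ + l ℤ.* form β β)
      twice = trans (cong (+ 2 ℤ.*_) norm) (lemma (form α α) (form β β) (form α β) (+ k) (+ l) pαα qββ)
        where
        expand : ∀ a b c k l → + 2 ℤ.* (a ℤ.- c ℤ.- (c ℤ.- b)) ≡
                 (((+ 2 ℤ.+ k) ℤ.* a ℤ.- + 2 ℤ.* c) ℤ.+ ((+ 2 ℤ.+ l) ℤ.* b ℤ.- + 2 ℤ.* c)) ℤ.- (k ℤ.* a ℤ.+ l ℤ.* b)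
        expand = solve-∀
        lemma : ∀ a b c k l → (+ 2 ℤ.+ k) ℤ.* a ≡ + 2 ℤ.* c → (+ 2 ℤ.+ l) ℤ.* b ≡ + 2 ℤ.* c →
                + 2 ℤ.* (a ℤ.- c ℤ.- (c ℤ.- b)) ≡ ℤ.- (k ℤ.* a ℤ.+ l ℤ.* b)
        lemma a b c k l e f = trans (expand a b c k l) (trans
          (cong (ℤ._- (k ℤ.* a ℤ.+ l ℤ.* b)) (cong₂ ℤ._+_ (ℤₚ.i≡j⇒i-j≡0 e) (ℤₚ.i≡j⇒i-j≡0 f)))
          (ℤₚ.+-identityˡ _))
      norm≤0 : form (α -ᵛ β) (α -ᵛ β) ℤ.≤ 0ℤ
      norm≤0 = ℤₚ.*-cancelˡ-≤-pos _ _ (+ 2) (subst (ℤ._≤ 0ℤ) (sym twice)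
        (ℤₚ.neg-mono-≤ (ℤₚ.+-mono-≤ (*-nonNeg {+ k} (ℤ.+≤+ ℕ.z≤n) (form≥0 α)) (*-nonNeg {+ l} (ℤ.+≤+ ℕ.z≤n) (form≥0 β)))))
    cases (+ 0)    _        _ _ _ _ | ℤ.+<+ () | _
    cases -[1+ _ ] _        _ _ _ _ | () | _
    cases (+ suc (suc _)) (+ 0)    _ _ _ _ | _ | ℤ.+<+ ()
    cases (+ suc (suc _)) -[1+ _ ] _ _ _ _ | _ | ()

  -- The covector of w ↦ (u , w); its i-th entry is (u , αᵢ). It rewrites the form as a `dot`, where
  -- signs of coordinates can be exploited.
  gradientOver : List (Vec ℤ n) → Vec ℤ n → Vec ℤ n
  gradientOver []       u = 0ᵛ
  gradientOver (γ ∷ γs) u = ⟪ u , γ ⟫ *ᵛ coroot γ +ᵛ gradientOver γs u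

  gradient : Vec ℤ n → Vec ℤ n
  gradient = gradientOver distinctRoots

  opaque
    unfolding form

    form-gradient : ∀ u w → form u w ≡ dot w (gradient u)
    form-gradient u w = over distinctRoots
      where
      over : ∀ γs → formOver γs u w ≡ dot w (gradientOver γs u)
      over []       = sym (trans (dot-comm w 0ᵛ) (dot-zero w))
      over (γ ∷ γs) = sym (trans (dot-comm w _) (trans (dot-+ (⟪ u , γ ⟫ *ᵛ coroot γ) (gradientOver γs u) w)
        (cong₂ ℤ._+_ (trans (dot-* ⟪ u , γ ⟫ (coroot γ) w) (cong (⟪ u , γ ⟫ ℤ.*_) (dot-comm (coroot γ) w)))
                     (trans (dot-comm (gradientOver γs u) w) (sym (over γs))))))

  form-+ʳ : ∀ u v w → form u (v +ᵛ w) ≡ form u v ℤ.+ form u w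
  form-+ʳ u v w = trans (form-gradient u (v +ᵛ w)) (trans (dot-+ v w (gradient u))
    (cong₂ ℤ._+_ (sym (form-gradient u v)) (sym (form-gradient u w))))

  opaque
    unfolding form

    form-null : ∀ u {v} → (∀ {γ} → γ ∈ roots → ⟪ v , γ ⟫ ≡ 0ℤ) → form u v ≡ 0ℤ
    form-null u {v} null = over distinctRoots distinct⁻
      where
      over : ∀ γs → (∀ {γ} → γ ∈ γs → γ ∈ roots) → formOver γs u v ≡ 0ℤ
      over []       _  = refl
      over (γ ∷ γs) γ∈ = cong₂ ℤ._+_
        (trans (cong (⟪ u , γ ⟫ ℤ.*_) (null (γ∈ (here refl)))) (ℤₚ.*-zeroʳ ⟪ u , γ ⟫)) (over γs (γ∈ ∘ there))

  -- A root θ of maximal height among those supported in v pairs nonnegatively with the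
  -- simple roots in the support of v, so that 0 = form θ v forces form θ θ = 0.
  null-nonNeg⇒zero : ∀ {v} → NonNeg v → (∀ {γ} → γ ∈ roots → ⟪ v , γ ⟫ ≡ 0ℤ) → v ≡ 0ᵛ
  null-nonNeg⇒zero {v} v≥0 null with v ≟ᵛ 0ᵛ
  ... | yes v≡0 = v≡0
  ... | no  v≢0 = ⊥-elim (ℤₚ.<-irrefl (sym form-θθ) (form-root>0 θ∈))
    where
    supported? : ∀ w → Dec (Supported v w)
    supported? w = Finₚ.all? λ i → (lookup v i ℤₚ.≟ 0ℤ) →-dec (lookup w i ℤₚ.≟ 0ℤ)
    supported-simple : ∀ i → lookup v i ≢ 0ℤ → Supported v (simple i)
    supported-simple i vᵢ≢0 j vⱼ≡0 = off-diagonal i j λ { refl → vᵢ≢0 vⱼ≡0 }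
      where
      lookup-zero : ∀ {m} (j : Fin m) → lookup 0ᵛ j ≡ 0ℤ
      lookup-zero zero    = refl
      lookup-zero (suc j) = lookup-zero j
      off-diagonal : ∀ {m} (i j : Fin m) → i ≢ j → lookup (simple i) j ≡ 0ℤ
      off-diagonal zero    zero    i≢j = ⊥-elim (i≢j refl)
      off-diagonal zero    (suc j) _   = lookup-zero j
      off-diagonal (suc i) zero    _   = refl
      off-diagonal (suc i) (suc j) i≢j = off-diagonal i j (i≢j ∘ cong suc)
    entry  = nonZero⇒entry v≢0
    i₀     = proj₁ entry
    inside = filter supported? roots
    -- The default `simple i₀` is itself a root supported in v, so the maximum is taken over a
    -- nonempty set.
    θ      = argmax height (simple i₀) inside
    θ-good : θ ∈ roots × Supported v θ
    θ-good = argmax-all height {P = λ w → w ∈ roots × Supported v w}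
      (simple∈ i₀ , supported-simple i₀ (proj₂ entry))
      (All.tabulate (∈ₚ.∈-filter⁻ supported?))
    θ∈     = proj₁ θ-good
    θ-supp = proj₂ θ-good
    -- Reflecting θ in αⱼ stays inside the support of v and changes the height by -⟨θ , αⱼ^∨⟩; a
    -- negative pairing would beat the maximum.
    pairing≥0 : ∀ j → lookup v j ≢ 0ℤ → 0ℤ ℤ.≤ ⟪ θ , simple j ⟫
    pairing≥0 j vⱼ≢0 = subst (λ z → 0ℤ ℤ.≤ z) (cancel (height θ) ⟪ θ , simple j ⟫)
      (ℤₚ.i≤j⇒0≤j-i (subst (ℤ._≤ height θ) height-reflect
        (All.lookup (f[xs]≤f[argmax] {f = height} (simple i₀) inside)
          (∈ₚ.∈-filter⁺ supported? (reflection (simple∈ j) θ∈) reflect-supp))))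
      where
      cancel : ∀ a b → a ℤ.- (a ℤ.- b) ≡ b
      cancel = solve-∀
      height-reflect : height (reflect (simple j) θ) ≡ height θ ℤ.- ⟪ θ , simple j ⟫
      height-reflect = trans (dot-minus ⟪ θ , simple j ⟫ θ (simple j) (replicate n 1ℤ))
        (cong (λ z → height θ ℤ.- z) (trans (cong (⟪ θ , simple j ⟫ ℤ.*_) (height-simple j)) (ℤₚ.*-identityʳ ⟪ θ , simple j ⟫)))
      lookup-minus : ∀ {m} (i : Fin m) c u w → lookup (u -ᵛ c *ᵛ w) i ≡ lookup u i ℤ.- c ℤ.* lookup w i
      lookup-minus zero    c (_ ∷ _) (_ ∷ _) = refl
      lookup-minus (suc i) c (_ ∷ u) (_ ∷ w) = lookup-minus i c u w
      vanish : ∀ c → 0ℤ ℤ.- c ℤ.* 0ℤ ≡ 0ℤ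
      vanish = solve-∀
      reflect-supp : Supported v (reflect (simple j) θ)
      reflect-supp i vᵢ≡0 = trans (lookup-minus i ⟪ θ , simple j ⟫ θ (simple j))
        (trans (cong₂ (λ a b → a ℤ.- ⟪ θ , simple j ⟫ ℤ.* b) (θ-supp i vᵢ≡0) (supported-simple j vⱼ≢0 i vᵢ≡0))
               (vanish ⟪ θ , simple j ⟫))
    gradient-entry : ∀ j → lookup (gradient θ) j ≡ form θ (simple j)
    gradient-entry j = trans (sym (dot-simple j (gradient θ))) (sym (form-gradient θ (simple j)))
    gradient≥0 : ∀ j → lookup v j ≢ 0ℤ → 0ℤ ℤ.≤ lookup (gradient θ) j
    gradient≥0 j vⱼ≢0 = ℤₚ.*-cancelˡ-≤-pos 0ℤ _ (+ 2) (subst (λ z → 0ℤ ℤ.≤ z)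
      (trans (form-pairing (simple∈ j) θ∈) (cong (+ 2 ℤ.*_) (trans (form-sym (simple j) θ) (sym (gradient-entry j)))))
      (*-nonNeg (pairing≥0 j vⱼ≢0) (form≥0 (simple j))))
    terms≥0 : ∀ j → 0ℤ ℤ.≤ lookup v j ℤ.* lookup (gradient θ) j
    terms≥0 j with lookup v j ℤₚ.≟ 0ℤ
    ... | yes e    = subst (λ z → 0ℤ ℤ.≤ z ℤ.* lookup (gradient θ) j) (sym e) ℤₚ.≤-refl
    ... | no  vⱼ≢0 = *-nonNeg (VecAll.lookup v≥0 (∈ᵥₚ.∈-lookup j v)) (gradient≥0 j vⱼ≢0)
    -- The terms vⱼ (θ , αⱼ) are nonnegative and sum to (θ , v) = 0, so (θ , αⱼ) = 0 wherever vⱼ ≠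
    -- 0. Every nonzero coordinate of θ is at such a j.
    form-θθ : form θ θ ≡ 0ℤ
    form-θθ = trans (form-gradient θ θ) (dot-supported v θ (gradient θ) terms≥0
      (trans (sym (form-gradient θ v)) (form-null θ null)) θ-supp)

  -- The form is semidefinite, and an isotropic vector pairs to 0 with all coroots. Nonnegative
  -- coordinates are enough, since the vectors tested are sums of positive roots.
  form-definite : ∀ {v} → NonNeg v → v ≢ 0ᵛ → 0ℤ ℤ.< form v v
  form-definite {v} v≥0 v≢0 = ℤₚ.≤∧≢⇒< (form≥0 v) λ e →
    v≢0 (null-nonNeg⇒zero v≥0 (λ {γ} → isotropic⇒null v (sym e) {γ}))

-- Descent on sums of positive roots.

module Descent {n} {X : Dynkin n} (Φ : RootSystem X) where
  open RootSystem Φ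
  open RootTheory Φ
  open PosRoot
  open Domination Φ

  form-0ʳ : ∀ u → form u 0ᵛ ≡ 0ℤ
  form-0ʳ u = trans (form-gradient u 0ᵛ) (dot-zero (gradient u))

  total : List PosRoot → Vec ℤ n
  total []       = 0ᵛ
  total (α ∷ αs) = coeffs α +ᵛ total αs

  total-nonNeg : ∀ αs → NonNeg (total αs)
  total-nonNeg []       = nonNeg-0
  total-nonNeg (α ∷ αs) = nonNeg-+ (pos α) (total-nonNeg αs)

  +ᵛ-swap : ∀ {m} (u v w : Vec ℤ m) → u +ᵛ (v +ᵛ w) ≡ v +ᵛ (u +ᵛ w)
  +ᵛ-swap []      []      []      = refl
  +ᵛ-swap (x ∷ u) (y ∷ v) (z ∷ w) = cong₂ _∷_ (lemma x y z) (+ᵛ-swap u v w)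
    where
    lemma : ∀ x y z → x ℤ.+ (y ℤ.+ z) ≡ y ℤ.+ (x ℤ.+ z)
    lemma = solve-∀

  total-↭ : ∀ {αs βs} → αs ↭ βs → total αs ≡ total βs
  total-↭ ↭.refl           = refl
  total-↭ (↭.prep α p)     = cong (coeffs α +ᵛ_) (total-↭ p)
  total-↭ (↭.swap {xs} α β p) =
    trans (+ᵛ-swap (coeffs α) (coeffs β) (total xs)) (cong (λ z → coeffs β +ᵛ (coeffs α +ᵛ z)) (total-↭ p))
  total-↭ (↭.trans p q)    = trans (total-↭ p) (total-↭ q)

  form-total≤0 : ∀ u βs → All (λ β → ¬ 0ℤ ℤ.< form u (coeffs β)) βs → form u (total βs) ℤ.≤ 0ℤ
  form-total≤0 u []       []       = ℤₚ.≤-reflexive (form-0ʳ u)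
  form-total≤0 u (β ∷ βs) (p ∷ ps) = subst (ℤ._≤ 0ℤ) (sym (form-+ʳ u (coeffs β) (total βs)))
    (ℤₚ.+-mono-≤ (ℤₚ.≮⇒≥ p) (form-total≤0 u βs ps))

  coeffs≢0 : ∀ α → coeffs α ≢ 0ᵛ
  coeffs≢0 α e = nonzero (subst (_∈ roots) e (root α))

  height-coeffs>0 : ∀ α → 0ℤ ℤ.< height (coeffs α)
  height-coeffs>0 α = height>0 (pos α) (coeffs≢0 α)

  height-+ : ∀ {m} (u v : Vec ℤ m) → height (u +ᵛ v) ≡ height u ℤ.+ height v
  height-+ u v = dot-+ u v (replicate _ 1ℤ)

  height-tail< : ∀ α αs {k} → height (total (α ∷ αs)) ℤ.< + suc k → height (total αs) ℤ.< + k
  height-tail< α αs {k} h = suc-cancel-< (ℤₚ.≤-<-trans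
    (subst (ℤ.suc (height (total αs)) ℤ.≤_) (sym (height-+ (coeffs α) (total αs)))
      (ℤₚ.+-monoˡ-≤ (height (total αs)) (ℤₚ.i<j⇒suc[i]≤j (height-coeffs>0 α)))) h)

  total≢0 : ∀ α αs → total (α ∷ αs) ≢ 0ᵛ
  total≢0 α αs e = ℤₚ.<-irrefl (sym (trans (cong height e) (dot-zero (replicate n 1ℤ))))
    (subst (λ z → 0ℤ ℤ.< z) (sym (height-+ (coeffs α) (total αs)))
      (ℤₚ.+-mono-<-≤ (height-coeffs>0 α) (height≥0 (total-nonNeg αs))))

  Incomparable : List PosRoot → List PosRoot → Set
  Incomparable αs βs = All (λ β → All (λ α → ¬ α ≼ β) αs) βs

  cancel-both : ∀ {m} (a p s b q : Vec ℤ m) → (a +ᵛ p) +ᵛ s ≡ b +ᵛ q → p +ᵛ (s +ᵛ (a -ᵛ b)) ≡ q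
  cancel-both []      []      []      []      []      _ = refl
  cancel-both (a ∷ u) (p ∷ v) (s ∷ w) (b ∷ x) (q ∷ y) e = cong₂ _∷_
    (trans (expand a p s b) (trans (cong (ℤ._- b) (cong Vec.head e)) (cancel b q)))
    (cancel-both u v w x y (cong Vec.tail e))
    where
    expand : ∀ a p s b → p ℤ.+ (s ℤ.+ (a ℤ.- b)) ≡ a ℤ.+ p ℤ.+ s ℤ.- b
    expand = solve-∀
    cancel : ∀ b q → b ℤ.+ q ℤ.- b ≡ q
    cancel = solve-∀

  cancel-right : ∀ {m} (p s b q : Vec ℤ m) → p +ᵛ s ≡ b +ᵛ q → p +ᵛ (s -ᵛ b) ≡ q
  cancel-right []      []      []      []      _ = refl
  cancel-right (p ∷ v) (s ∷ w) (b ∷ x) (q ∷ y) e = cong₂ _∷_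
    (trans (expand p s b) (trans (cong (ℤ._- b) (cong Vec.head e)) (cancel b q)))
    (cancel-right v w x y (cong Vec.tail e))
    where
    expand : ∀ p s b → p ℤ.+ (s ℤ.- b) ≡ p ℤ.+ s ℤ.- b
    expand = solve-∀
    cancel : ∀ b q → b ℤ.+ q ℤ.- b ≡ q
    cancel = solve-∀

  shift-minus : ∀ {m} (p s e b q : Vec ℤ m) → p +ᵛ s ≡ b +ᵛ q → p +ᵛ (s -ᵛ e) ≡ (b -ᵛ e) +ᵛ q
  shift-minus []      []      []      []      []      _ = refl
  shift-minus (p ∷ v) (s ∷ w) (e ∷ z) (b ∷ x) (q ∷ y) h = cong₂ _∷_
    (trans (expand p s e) (trans (cong (ℤ._- e) (cong Vec.head h)) (cancel b q e)))
    (shift-minus v w z x y (cong Vec.tail h))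
    where
    expand : ∀ p s e → p ℤ.+ (s ℤ.- e) ≡ p ℤ.+ s ℤ.- e
    expand = solve-∀
    cancel : ∀ b q e → b ℤ.+ q ℤ.- e ≡ b ℤ.- e ℤ.+ q
    cancel = solve-∀

  zero-sum⇒≼ : ∀ {m} {s} (a b : Vec ℤ m) → NonNeg s → s +ᵛ (a -ᵛ b) ≡ 0ᵛ → NonNeg (b -ᵛ a)
  zero-sum⇒≼ []      []      []        _ = []
  zero-sum⇒≼ (a ∷ u) (b ∷ v) (_∷_ {x = s} s≥0 ss≥0) e =
    subst (λ z → 0ℤ ℤ.≤ z) (trans (expand s a b) (trans (cong (ℤ._+ (b ℤ.- a)) (cong Vec.head e)) (ℤₚ.+-identityˡ _))) s≥0
    ∷ zero-sum⇒≼ u v ss≥0 (cong Vec.tail e)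
    where
    expand : ∀ s a b → s ≡ s ℤ.+ (a ℤ.- b) ℤ.+ (b ℤ.- a)
    expand = solve-∀

  +ᵛ-identityˡ : ∀ {m} (v : Vec ℤ m) → 0ᵛ +ᵛ v ≡ v
  +ᵛ-identityˡ []      = refl
  +ᵛ-identityˡ (x ∷ v) = cong₂ _∷_ (ℤₚ.+-identityˡ x) (+ᵛ-identityˡ v)

  -- The configuration to be refuted, with k as fuel: k is a strict bound on the height of Σβ, so k
  -- = 0 contradicts nonnegativity, and every step of the descent lowers the height by at least one.
  Domination : ℕ → Set
  Domination k = ∀ αs βs {σ} → NonNeg σ → total αs +ᵛ σ ≡ total βs → length βs ℕ.≤ length αs →
                 0 ℕ.< length αs → Incomparable αs βs → height (total βs) ℤ.< + k → ⊥

  cancel-pair : ∀ {k} → Domination k → ∀ α αs β βs {σ} → NonNeg σ →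
                total (α ∷ αs) +ᵛ σ ≡ total (β ∷ βs) → length βs ℕ.≤ length αs →
                Incomparable (α ∷ αs) (β ∷ βs) → height (total (β ∷ βs)) ℤ.< + suc k →
                0ℤ ℤ.< form (coeffs α) (coeffs β) → ⊥
  cancel-pair {k} ih α αs β βs {σ} σ≥0 eq len ((α⋠β ∷ _) ∷ inc) ht 0<αβ
    with difference-root (root α) (root β) 0<αβ
  ... | inj₁ α≡β = α⋠β (subst (λ z → NonNeg (z -ᵛ coeffs α)) α≡β (subst NonNeg (sym (-ᵛ-inverse (coeffs α))) nonNeg-0))
  ... | inj₂ d∈ with sign d∈
  ... | inj₁ d≥0 = α⋠β d≥0
  ... | inj₂ -d≥0 = go αs βs refl refl
    where
    eq′ : total αs +ᵛ (σ +ᵛ (coeffs α -ᵛ coeffs β)) ≡ total βs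
    eq′ = cancel-both (coeffs α) (total αs) σ (coeffs β) (total βs) eq
    -- The induction hypothesis asks for a nonempty list of α. If none is left, the length bound
    -- leaves no β either, and σ + (α - β) = 0 with σ ≥ 0 gives α ≼ β.
    go : ∀ as bs → as ≡ αs → bs ≡ βs → ⊥
    go [] (_ ∷ _) refl refl = ℕₚ.<⇒≱ (ℕ.s≤s ℕ.z≤n) len
    go [] []      refl refl = α⋠β (zero-sum⇒≼ (coeffs α) (coeffs β) σ≥0 (trans (sym (+ᵛ-identityˡ _)) eq′))
    go (_ ∷ _) _  refl refl = ih αs βs
      (nonNeg-+ σ≥0 (subst NonNeg (neg-minus (coeffs β) (coeffs α)) -d≥0)) eq′ len (ℕ.s≤s ℕ.z≤n)
      (All.map All.tail inc) (height-tail< β βs ht)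

  cancel-simple : ∀ {k} → Domination k → ∀ αs β βs {σ} → NonNeg σ →
                  total αs +ᵛ σ ≡ total (β ∷ βs) → length (β ∷ βs) ℕ.≤ length αs →
                  0 ℕ.< length αs →
                  Incomparable αs (β ∷ βs) → height (total (β ∷ βs)) ℤ.< + suc k →
                  ∀ i → 0ℤ ℤ.< lookup σ i → 0ℤ ℤ.< form (simple i) (coeffs β) → ⊥
  cancel-simple {k} ih αs β βs {σ} σ≥0 eq len nonempty (incβ ∷ inc) ht i 0<σᵢ 0<αᵢβ =
    cases (difference-root (simple∈ i) (root β) 0<αᵢβ)
    where
    remove : NonNeg (simple i -ᵛ coeffs β) → ⊥
    remove β≤αᵢ = ih αs βs (nonNeg-trans (coeffs β) (simple i) σ β≤αᵢ (minus-simple-nonNeg σ≥0 i 0<σᵢ))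
      (cancel-right (total αs) σ (coeffs β) (total βs) eq) (ℕₚ.<⇒≤ len) nonempty inc (height-tail< β βs ht)
    cases : simple i ≡ coeffs β ⊎ coeffs β -ᵛ simple i ∈ roots → ⊥
    cases (inj₁ e)  = remove (subst (λ z → NonNeg (z -ᵛ coeffs β)) (sym e)
      (subst NonNeg (sym (-ᵛ-inverse (coeffs β))) nonNeg-0))
    cases (inj₂ d∈) with sign d∈
    ... | inj₂ -d≥0 = remove (subst NonNeg (neg-minus (coeffs β) (simple i)) -d≥0)
    ... | inj₁ d≥0  = ih αs (β′ ∷ βs) (minus-simple-nonNeg σ≥0 i 0<σᵢ)
      (shift-minus (total αs) σ (simple i) (coeffs β) (total βs) eq) len nonempty
      (All.map (λ {α} α⋠β α≼β′ → α⋠β (nonNeg-trans (coeffs α) (coeffs β′) (coeffs β) α≼β′ β′≼β)) incβ ∷ inc) ht′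
      where
      β′ : PosRoot
      β′ = record { coeffs = coeffs β -ᵛ simple i ; root = d∈ ; pos = d≥0 }
      β′≼β : NonNeg (coeffs β -ᵛ coeffs β′)
      β′≼β = subst NonNeg (sym (minus-minus (coeffs β) (simple i))) (simple-nonNeg i)
      rearrange : ∀ a b → 1ℤ ℤ.+ (a ℤ.- 1ℤ ℤ.+ b) ≡ a ℤ.+ b
      rearrange = solve-∀
      ht′ : height (total (β′ ∷ βs)) ℤ.< + k
      ht′ = suc-cancel-< (subst (ℤ._< + suc k) (sym (begin
        1ℤ ℤ.+ height (total (β′ ∷ βs))
          ≡⟨ cong (λ z → 1ℤ ℤ.+ z) (height-+ (coeffs β′) (total βs)) ⟩
        1ℤ ℤ.+ (height (coeffs β′) ℤ.+ height (total βs))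
          ≡⟨ cong (λ z → 1ℤ ℤ.+ (z ℤ.+ height (total βs))) (dot-- (coeffs β) (simple i) (replicate n 1ℤ)) ⟩
        1ℤ ℤ.+ (height (coeffs β) ℤ.- height (simple i) ℤ.+ height (total βs))
          ≡⟨ cong (λ z → 1ℤ ℤ.+ (height (coeffs β) ℤ.- z ℤ.+ height (total βs))) (height-simple i) ⟩
        1ℤ ℤ.+ (height (coeffs β) ℤ.- 1ℤ ℤ.+ height (total βs))
          ≡⟨ rearrange (height (coeffs β)) (height (total βs)) ⟩
        height (coeffs β) ℤ.+ height (total βs)
          ≡⟨ height-+ (coeffs β) (total βs) ⟨
        height (total (β ∷ βs)) ∎)) ht)
        where open ≡-Reasoning

  PairsPositively : List PosRoot → PosRoot → Set
  PairsPositively βs α = Any (λ β → 0ℤ ℤ.< form (coeffs α) (coeffs β)) βs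

  pairsPositively? : ∀ βs α → Dec (PairsPositively βs α)
  pairsPositively? βs α = any? (λ β → 0ℤ ℤₚ.<? form (coeffs α) (coeffs β)) βs

  domination-pair : ∀ {k} → Domination k → ∀ αs βs {σ} → NonNeg σ → total αs +ᵛ σ ≡ total βs →
                    length βs ℕ.≤ length αs → Incomparable αs βs → height (total βs) ℤ.< + suc k →
                    Any (PairsPositively βs) αs → ⊥
  domination-pair {k} ih αs βs {σ} σ≥0 eq len inc ht p =
    let (α , αs′ , q , αs↭)    = extract p
        (β , βs′ , 0<αβ , βs↭) = extract q in
    cancel-pair ih α αs′ β βs′ σ≥0
      (trans (cong (_+ᵛ σ) (sym (total-↭ αs↭))) (trans eq (total-↭ βs↭)))
      (ℕ.s≤s⁻¹ (subst₂ ℕ._≤_ (↭ₚ.↭-length βs↭) (↭ₚ.↭-length αs↭) len))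
      (All.map (↭ₚ.All-resp-↭ αs↭) (↭ₚ.All-resp-↭ βs↭ inc))
      (subst (λ z → height z ℤ.< + suc k) (total-↭ βs↭) ht) 0<αβ

  -- form (Σβ) (Σβ) > 0 ≥ form (Σβ) (Σα) leaves form (Σβ) σ > 0.
  domination-simple : ∀ {k} → Domination k → ∀ αs βs {σ} → NonNeg σ → total αs +ᵛ σ ≡ total βs →
                      length βs ℕ.≤ length αs → 0 ℕ.< length αs → Incomparable αs βs →
                      height (total βs) ℤ.< + suc k → ¬ Any (PairsPositively βs) αs → ⊥
  domination-simple {k} ih αs βs {σ} σ≥0 eq len nonempty inc ht none =
    let (β , βs′ , 0<αᵢβ , βs↭) = extract some-β in
    cancel-simple ih αs β βs′ σ≥0 (trans eq (total-↭ βs↭))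
      (subst (ℕ._≤ length αs) (↭ₚ.↭-length βs↭) len) nonempty
      (↭ₚ.All-resp-↭ βs↭ inc) (subst (λ z → height z ℤ.< + suc k) (total-↭ βs↭) ht) i 0<σᵢ 0<αᵢβ
    where
    B′ = total βs
    αs≤0 : form B′ (total αs) ℤ.≤ 0ℤ
    αs≤0 = form-total≤0 B′ αs (All.map (λ {α} αs→ 0<Bα → ℤₚ.<⇒≱ (subst (λ z → 0ℤ ℤ.< z) (form-sym B′ (coeffs α)) 0<Bα)
      (form-total≤0 (coeffs α) βs (Allₚ.¬Any⇒All¬ βs αs→))) (Allₚ.¬Any⇒All¬ αs none))
    B≢0 : B′ ≢ 0ᵛ
    B≢0 e = contra αs nonempty eq
      where
      contra : ∀ as → 0 ℕ.< length as → total as +ᵛ σ ≡ B′ → ⊥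
      contra (α ∷ as) _ eq = ℤₚ.<-irrefl
        (sym (trans (cong height (trans eq e)) (dot-zero (replicate n 1ℤ))))
        (subst (λ z → 0ℤ ℤ.< z) (sym (height-+ (total (α ∷ as)) σ))
          (ℤₚ.+-mono-<-≤ (height>0 (total-nonNeg (α ∷ as)) (total≢0 α as)) (height≥0 σ≥0)))
    0<Bσ : 0ℤ ℤ.< form B′ σ
    0<Bσ = ℤₚ.<-≤-trans (form-definite (total-nonNeg βs) B≢0)
      (subst (λ z → form B′ z ℤ.≤ form B′ σ) eq
        (subst₂ ℤ._≤_ (sym (form-+ʳ B′ (total αs) σ)) (ℤₚ.+-identityˡ (form B′ σ)) (ℤₚ.+-monoˡ-≤ (form B′ σ) αs≤0)))
    -- The linear form (Σβ , _) is positive at σ ≥ 0, hence positive at some simple root occurring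
    -- in σ.
    entry = dot-positive σ≥0 (gradient B′) (subst (λ z → 0ℤ ℤ.< z) (form-gradient B′ σ) 0<Bσ)
    i     = proj₁ entry
    0<σᵢ  = proj₁ (proj₂ entry)
    0<αᵢB : 0ℤ ℤ.< form (simple i) B′
    0<αᵢB = subst (λ z → 0ℤ ℤ.< z) (trans (sym (dot-simple i (gradient B′)))
      (trans (sym (form-gradient B′ (simple i))) (form-sym B′ (simple i)))) (proj₂ (proj₂ entry))
    some-β : Any (λ β → 0ℤ ℤ.< form (simple i) (coeffs β)) βs
    some-β with any? (λ β → 0ℤ ℤₚ.<? form (simple i) (coeffs β)) βs
    ... | yes p = p
    ... | no ¬p = ⊥-elim (ℤₚ.<⇒≱ 0<αᵢB (form-total≤0 (simple i) βs (Allₚ.¬Any⇒All¬ βs ¬p)))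

  domination : ∀ k → Domination k
  domination zero    αs βs _ _ _ _ _ ht = ℤₚ.<⇒≱ ht (height≥0 (total-nonNeg βs))
  domination (suc k) αs βs σ≥0 eq len nonempty inc ht = cases (any? (pairsPositively? βs) αs)
    where
    cases : Dec (Any (PairsPositively βs) αs) → ⊥
    cases (yes p)    = domination-pair (domination k) αs βs σ≥0 eq len inc ht p
    cases (no  none) = domination-simple (domination k) αs βs σ≥0 eq len nonempty inc ht none

  sum-domination : ∀ αs βs {σ} → NonNeg σ → total αs +ᵛ σ ≡ total βs → length βs ℕ.≤ length αs →
                   0 ℕ.< length αs → ¬ Incomparable αs βs
  sum-domination αs βs σ≥0 eq len nonempty inc =
    domination (suc ℤ.∣ height (total βs) ∣) αs βs σ≥0 eq len nonempty inc
      (subst (ℤ._< + suc ℤ.∣ height (total βs) ∣) (ℤₚ.0≤i⇒+∣i∣≡i (height≥0 (total-nonNeg βs)))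
        (ℤ.+<+ (ℕₚ.n<1+n _)))

-- Integers as rationals, and linear forms at rational points.

opaque
  ι : ℤ → ℚ
  ι c = c ℚ./ 1

  ι≡/1 : ∀ c → ι c ≡ c ℚ./ 1
  ι≡/1 _ = refl

  ι-+ : ∀ a b → ι (a ℤ.+ b) ≡ ι a ℚ.+ ι b
  ι-+ a b = ℚₚ.toℚᵘ-injective (ℚᵘₚ.≃-trans (ℚₚ.toℚᵘ-fromℚᵘ (ℚᵘ.mkℚᵘ (a ℤ.+ b) 0))
    (ℚᵘₚ.≃-trans (ℚᵘ.*≡* (lemma a b)) (ℚᵘₚ.≃-sym (ℚᵘₚ.≃-trans (ℚₚ.toℚᵘ-homo-+ (ι a) (ι b))
      (ℚᵘₚ.+-cong (ℚₚ.toℚᵘ-fromℚᵘ (ℚᵘ.mkℚᵘ a 0)) (ℚₚ.toℚᵘ-fromℚᵘ (ℚᵘ.mkℚᵘ b 0)))))))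
    where
    lemma : ∀ a b → (a ℤ.+ b) ℤ.* 1ℤ ≡ (a ℤ.* 1ℤ ℤ.+ b ℤ.* 1ℤ) ℤ.* 1ℤ
    lemma = solve-∀

  ι-* : ∀ a b → ι (a ℤ.* b) ≡ ι a ℚ.* ι b
  ι-* a b = ℚₚ.toℚᵘ-injective (ℚᵘₚ.≃-trans (ℚₚ.toℚᵘ-fromℚᵘ (ℚᵘ.mkℚᵘ (a ℤ.* b) 0))
    (ℚᵘₚ.≃-sym (ℚᵘₚ.≃-trans (ℚₚ.toℚᵘ-homo-* (ι a) (ι b))
      (ℚᵘₚ.*-cong (ℚₚ.toℚᵘ-fromℚᵘ (ℚᵘ.mkℚᵘ a 0)) (ℚₚ.toℚᵘ-fromℚᵘ (ℚᵘ.mkℚᵘ b 0))))))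

  ι-0 : ι 0ℤ ≡ 0ℚ
  ι-0 = refl

  ι-1 : ι 1ℤ ≡ 1ℚ
  ι-1 = refl

  ι-1/ : ∀ k → ι (+ suc k) ℚ.* (1ℤ ℚ./ suc k) ≡ 1ℚ
  ι-1/ k = ℚₚ.toℚᵘ-injective (ℚᵘₚ.≃-trans (ℚₚ.toℚᵘ-homo-* (ι (+ suc k)) (1ℤ ℚ./ suc k))
    (ℚᵘₚ.≃-trans (ℚᵘₚ.*-cong (ℚₚ.toℚᵘ-fromℚᵘ (ℚᵘ.mkℚᵘ (+ suc k) 0)) (ℚₚ.toℚᵘ-fromℚᵘ (ℚᵘ.mkℚᵘ 1ℤ k)))
      (ℚᵘ.*≡* (lemma (+ suc k)))))
    where
    lemma : ∀ a → (a ℤ.* 1ℤ) ℤ.* 1ℤ ≡ 1ℤ ℤ.* (1ℤ ℤ.* a)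
    lemma = solve-∀

  ι-quotient : ∀ c k → ι c ℚ.* (1ℤ ℚ./ suc k) ≡ c ℚ./ suc k
  ι-quotient c k = ℚₚ.toℚᵘ-injective (ℚᵘₚ.≃-trans (ℚₚ.toℚᵘ-homo-* (ι c) (1ℤ ℚ./ suc k))
    (ℚᵘₚ.≃-trans (ℚᵘₚ.*-cong (ℚₚ.toℚᵘ-fromℚᵘ (ℚᵘ.mkℚᵘ c 0)) (ℚₚ.toℚᵘ-fromℚᵘ (ℚᵘ.mkℚᵘ 1ℤ k)))
      (ℚᵘₚ.≃-trans (ℚᵘ.*≡* (lemma c (+ suc k))) (ℚᵘₚ.≃-sym (ℚₚ.toℚᵘ-fromℚᵘ (ℚᵘ.mkℚᵘ c k))))))
    where
    lemma : ∀ c d → (c ℤ.* 1ℤ) ℤ.* d ≡ c ℤ.* (1ℤ ℤ.* d)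
    lemma = solve-∀

  ι-nonNeg : ∀ {c} → 0ℤ ℤ.≤ c → 0ℚ ℚ.≤ ι c
  ι-nonNeg {+ k} _ = ℚₚ.nonNegative⁻¹ (ι (+ k)) {{ℚₚ.normalize-nonNeg k 1}}

  ι-pos : ∀ {c} → 0ℤ ℤ.< c → 0ℚ ℚ.< ι c
  ι-pos {+ suc k} _ = ℚₚ.positive⁻¹ (ι (+ suc k)) {{ℚₚ.normalize-pos (suc k) 1}}
  ι-pos {+ zero} (ℤ.+<+ ())

ι-neg : ∀ a → ι (ℤ.- a) ≡ ℚ.- ι a
ι-neg a = +-Group.inverseˡ-unique (ι (ℤ.- a)) (ι a)
  (trans (sym (ι-+ (ℤ.- a) a)) (trans (cong ι (ℤₚ.+-inverseˡ a)) ι-0))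

ev : ∀ {n} → Vec ℤ n → Vec ℚ n → ℚ
ev []       []       = 0ℚ
ev (c ∷ cs) (x ∷ xs) = ι c ℚ.* x ℚ.+ ev cs xs

ev-+ : ∀ {n} (u v : Vec ℤ n) x → ev (u +ᵛ v) x ≡ ev u x ℚ.+ ev v x
ev-+ []      []      []      = refl
ev-+ (a ∷ u) (b ∷ v) (x ∷ xs) = trans (cong₂ (λ c e → c ℚ.* x ℚ.+ e) (ι-+ a b) (ev-+ u v xs))
  (solve 5 (λ a b x p q → (a :+ b) :* x :+ (p :+ q) := (a :* x :+ p) :+ (b :* x :+ q)) refl
    (ι a) (ι b) x (ev u xs) (ev v xs))

ev-* : ∀ {n} c (v : Vec ℤ n) x → ev (c *ᵛ v) x ≡ ι c ℚ.* ev v x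
ev-* c []      []       = sym (ℚₚ.*-zeroʳ (ι c))
ev-* c (b ∷ v) (x ∷ xs) = trans (cong₂ (λ e p → e ℚ.* x ℚ.+ p) (ι-* c b) (ev-* c v xs))
  (solve 4 (λ c b x p → (c :* b) :* x :+ c :* p := c :* (b :* x :+ p)) refl (ι c) (ι b) x (ev v xs))

ev-neg : ∀ {n} (v : Vec ℤ n) x → ev (-ᵛ v) x ≡ ℚ.- ev v x
ev-neg []      []       = refl
ev-neg (b ∷ v) (x ∷ xs) = trans (cong₂ (λ e p → e ℚ.* x ℚ.+ p) (ι-neg b) (ev-neg v xs))
  (solve 3 (λ b x p → (:- b) :* x :+ :- p := :- (b :* x :+ p)) refl (ι b) x (ev v xs))

ev-- : ∀ {n} (u v : Vec ℤ n) x → ev (u -ᵛ v) x ≡ ev u x ℚ.- ev v x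
ev-- []      []      []      = refl
ev-- (a ∷ u) (b ∷ v) (x ∷ xs) = trans
  (cong₂ (λ c e → c ℚ.* x ℚ.+ e) (trans (ι-+ a (ℤ.- b)) (cong (λ z → ι a ℚ.+ z) (ι-neg b))) (ev-- u v xs))
  (solve 5 (λ a b x p q → (a :- b) :* x :+ (p :- q) := (a :* x :+ p) :- (b :* x :+ q)) refl
    (ι a) (ι b) x (ev u xs) (ev v xs))

ev-0 : ∀ {n} (x : Vec ℚ n) → ev 0ᵛ x ≡ 0ℚ
ev-0 []       = refl
ev-0 (x ∷ xs) = trans (cong₂ (λ c e → c ℚ.* x ℚ.+ e) ι-0 (ev-0 xs))
  (trans (ℚₚ.+-identityʳ (0ℚ ℚ.* x)) (ℚₚ.*-zeroˡ x))

*-pos : ∀ {p q} → 0ℚ ℚ.< p → 0ℚ ℚ.< q → 0ℚ ℚ.< p ℚ.* q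
*-pos {p} {q} 0<p 0<q = subst (ℚ._< p ℚ.* q) (ℚₚ.*-zeroʳ p) (ℚₚ.*-monoʳ-<-pos p {{ℚ.positive 0<p}} 0<q)

*-nonNegℚ : ∀ {p q} → 0ℚ ℚ.≤ p → 0ℚ ℚ.≤ q → 0ℚ ℚ.≤ p ℚ.* q
*-nonNegℚ {p} {q} 0≤p 0≤q =
  subst (ℚ._≤ p ℚ.* q) (ℚₚ.*-zeroʳ p) (ℚₚ.*-monoˡ-≤-nonNeg p {{ℚ.nonNegative 0≤p}} 0≤q)

0<-⇒< : ∀ {p q} → 0ℚ ℚ.< q ℚ.- p → p ℚ.< q
0<-⇒< {p} {q} h = subst₂ ℚ._<_ (ℚₚ.+-identityʳ p)
  (solve 2 (λ p q → p :+ (q :- p) := q) refl p q) (ℚₚ.+-monoʳ-< p h)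

<⇒0<- : ∀ {p q} → p ℚ.< q → 0ℚ ℚ.< q ℚ.- p
<⇒0<- {p} {q} h = subst (ℚ._< q ℚ.- p) (ℚₚ.+-inverseʳ p) (ℚₚ.+-monoˡ-< (ℚ.- p) h)

-- Gordan's theorem over the integers.

point-below : ∀ u Ls → All (ℚ._< u) Ls → ∃[ r ] r ℚ.< u × All (ℚ._< r) Ls
point-below u []       []       = u ℚ.- 1ℚ ,
  0<-⇒< (subst (λ z → 0ℚ ℚ.< z) (solve 2 (λ u o → o := u :- (u :- o)) refl u 1ℚ) (ℚₚ.positive⁻¹ 1ℚ)) , []
point-below u (l ∷ Ls) (l<u ∷ Ls<u) with point-below u Ls Ls<u | ℚₚ.<-dense l<u
... | r , r<u , Ls<r | m , l<m , m<u with ℚₚ.≤-total r m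
...   | inj₁ r≤m = m , m<u , l<m ∷ All.map (λ p → ℚₚ.<-≤-trans p r≤m) Ls<r
...   | inj₂ m≤r = r , r<u , ℚₚ.<-≤-trans l<m m≤r ∷ Ls<r

p<p+1 : ∀ p → p ℚ.< p ℚ.+ 1ℚ
p<p+1 p = subst (ℚ._< p ℚ.+ 1ℚ) (ℚₚ.+-identityʳ p) (ℚₚ.+-monoʳ-< p (ℚₚ.positive⁻¹ 1ℚ))

point-above : ∀ Ls → ∃[ r ] All (ℚ._< r) Ls
point-above []       = 0ℚ , []
point-above (l ∷ Ls) with point-above Ls
... | r , Ls<r with ℚₚ.≤-total r (l ℚ.+ 1ℚ)
...   | inj₁ r≤l+1 = l ℚ.+ 1ℚ , p<p+1 l ∷ All.map (λ p → ℚₚ.<-≤-trans p r≤l+1) Ls<r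
...   | inj₂ l+1≤r = r , ℚₚ.<-≤-trans (p<p+1 l) l+1≤r ∷ Ls<r

-- If the separator r found for the remaining upper bounds is not below u, a point below u and above
-- all of Ls replaces it; being smaller than r, it stays below the other upper bounds.
between : ∀ Ls Us → All (λ u → All (ℚ._< u) Ls) Us → ∃[ r ] All (ℚ._< r) Ls × All (r ℚ.<_) Us
between Ls []       []       = let (r , Ls<r) = point-above Ls in r , Ls<r , []
between Ls (u ∷ Us) (Ls<u ∷ h) with between Ls Us h
... | r , Ls<r , r<Us with r ℚₚ.<? u
...   | yes r<u = r , Ls<r , r<u ∷ r<Us
...   | no  r≮u = let (s , s<u , Ls<s) = point-below u Ls Ls<u in
  s , Ls<s , s<u ∷ All.map (ℚₚ.<-trans (ℚₚ.<-≤-trans s<u (ℚₚ.≮⇒≥ r≮u))) r<Us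

-- Nonempty sums of generators with repetition. There is no constructor for the empty sum, so
-- `Cone vs 0ᵛ` is a nontrivial dependency.
data Cone {n} (vs : List (Vec ℤ n)) : Vec ℤ n → Set where
  gen : ∀ {v} → v ∈ vs → Cone vs v
  add : ∀ {u v} → Cone vs u → Cone vs v → Cone vs (u +ᵛ v)

cone-scale : ∀ {n} {vs : List (Vec ℤ n)} {v c} → 0ℤ ℤ.< c → Cone vs v → Cone vs (c *ᵛ v)
cone-scale {c = + zero} (ℤ.+<+ ())
cone-scale {vs = vs} {v} {+ suc k} _ cv = positive k
  where
  one : ∀ {m} (u : Vec ℤ m) → u ≡ 1ℤ *ᵛ u
  one []      = refl
  one (x ∷ u) = cong₂ _∷_ (sym (ℤₚ.*-identityˡ x)) (one u)
  next : ∀ {m} k (u : Vec ℤ m) → u +ᵛ k *ᵛ u ≡ (1ℤ ℤ.+ k) *ᵛ u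
  next k []      = refl
  next k (x ∷ u) = cong₂ _∷_ (lemma k x) (next k u)
    where
    lemma : ∀ k x → x ℤ.+ k ℤ.* x ≡ (1ℤ ℤ.+ k) ℤ.* x
    lemma = solve-∀
  positive : ∀ k → Cone vs (+ suc k *ᵛ v)
  positive zero    = subst (Cone vs) (one v) cv
  positive (suc k) = subst (Cone vs) (next (+ suc k) v) (add cv (positive k))

module Elimination {n} (vs : List (Vec ℤ (suc n))) where

  zeros poss negs : List (Vec ℤ (suc n))
  zeros = filter (λ v → head v ℤₚ.≟ 0ℤ) vs
  poss  = filter (λ v → 0ℤ ℤₚ.<? head v) vs
  negs  = filter (λ v → head v ℤₚ.<? 0ℤ) vs

  -- For heads a > 0 > b this is the tail of a q + (-b) p, the positive combination whose head
  -- cancels.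
  combine : Vec ℤ (suc n) → Vec ℤ (suc n) → Vec ℤ n
  combine p q = head p *ᵛ tail q +ᵛ (ℤ.- head q) *ᵛ tail p

  eliminated : List (Vec ℤ n)
  eliminated = map tail zeros ++ cartesianProductWith combine poss negs

  cone-lift : ∀ {w} → Cone eliminated w → Cone vs (0ℤ ∷ w)
  cone-lift (add a b) = add (cone-lift a) (cone-lift b)
  cone-lift (gen w∈) with ∈ₚ.∈-++⁻ (map tail zeros) w∈
  ... | inj₁ z∈ with ∈ₚ.∈-map⁻ tail z∈
  ...   | (a ∷ v) , v∈ , refl with ∈ₚ.∈-filter⁻ (λ v → head v ℤₚ.≟ 0ℤ) {xs = vs} v∈
  ...     | v∈vs , refl = gen v∈vs
  cone-lift (gen w∈) | inj₂ c∈ with ∈ₚ.∈-cartesianProductWith⁻ combine poss negs c∈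
  ... | p@(a ∷ p′) , q@(b ∷ q′) , p∈ , q∈ , refl
    with ∈ₚ.∈-filter⁻ (λ v → 0ℤ ℤₚ.<? head v) {xs = vs} p∈ | ∈ₚ.∈-filter⁻ (λ v → head v ℤₚ.<? 0ℤ) {xs = vs} q∈
  ... | p∈vs , 0<a | q∈vs , b<0 = subst (λ h → Cone vs (h ∷ combine p q)) (cancel a b)
    (add (cone-scale 0<a (gen q∈vs)) (cone-scale (ℤₚ.neg-mono-< b<0) (gen p∈vs)))
    where
    cancel : ∀ a b → a ℤ.* b ℤ.+ (ℤ.- b) ℤ.* a ≡ 0ℤ
    cancel = solve-∀

  -- 1 / c for positive c, junk otherwise.
  inverse : ℤ → ℚ
  inverse (+ suc k) = 1ℤ ℚ./ suc k
  inverse _         = 0ℚ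

  inverse-inverse : ∀ {c} → 0ℤ ℤ.< c → ι c ℚ.* inverse c ≡ 1ℚ
  inverse-inverse {+ suc k}  _ = ι-1/ k
  inverse-inverse {+ zero}   (ℤ.+<+ ())

  inverse-pos : ∀ {c} → 0ℤ ℤ.< c → 0ℚ ℚ.< inverse c
  inverse-pos {+ suc k}  _ = ℚₚ.positive⁻¹ (1ℤ ℚ./ suc k) {{ℚₚ.normalize-pos 1 (suc k)}}
  inverse-pos {+ zero}   (ℤ.+<+ ())

  module _ (x : Vec ℚ n) (x-pos : All (λ v → 0ℚ ℚ.< ev v x) eliminated) where

    -- The bounds on the new first coordinate r: a r + P > 0 means r > -P / a when a > 0, and b r +
    -- Q > 0 means r < Q / (-b) when b < 0.
    lower upper : Vec ℤ (suc n) → ℚ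
    lower p = ℚ.- (ev (tail p) x ℚ.* inverse (head p))
    upper q = ev (tail q) x ℚ.* inverse (ℤ.- head q)

    -- This is positivity of `combine p q` at x, divided by a · (-b).
    lower<upper : ∀ {p q} → p ∈ poss → q ∈ negs → lower p ℚ.< upper q
    lower<upper {p} {q} p∈ q∈ = 0<-⇒< (subst (λ z → 0ℚ ℚ.< z) compute
      (*-pos (*-pos (inverse-pos 0<a) (inverse-pos 0<b)) combination))
      where
      open ≡-Reasoning
      0<a = proj₂ (∈ₚ.∈-filter⁻ (λ v → 0ℤ ℤₚ.<? head v) {xs = vs} p∈)
      0<b = ℤₚ.neg-mono-< (proj₂ (∈ₚ.∈-filter⁻ (λ v → head v ℤₚ.<? 0ℤ) {xs = vs} q∈))
      a = ι (head p)
      b = ι (ℤ.- head q)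
      a⁻¹ = inverse (head p)
      b⁻¹ = inverse (ℤ.- head q)
      P = ev (tail p) x
      Q = ev (tail q) x
      combination : 0ℚ ℚ.< a ℚ.* Q ℚ.+ b ℚ.* P
      combination = subst (λ z → 0ℚ ℚ.< z)
        (trans (ev-+ (head p *ᵛ tail q) ((ℤ.- head q) *ᵛ tail p) x)
          (cong₂ ℚ._+_ (ev-* (head p) (tail q) x) (ev-* (ℤ.- head q) (tail p) x)))
        (All.lookup x-pos (∈ₚ.∈-++⁺ʳ (map tail zeros) (∈ₚ.∈-cartesianProductWith⁺ combine p∈ q∈)))
      compute : (a⁻¹ ℚ.* b⁻¹) ℚ.* (a ℚ.* Q ℚ.+ b ℚ.* P) ≡ Q ℚ.* b⁻¹ ℚ.- ℚ.- (P ℚ.* a⁻¹)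
      compute = begin
        (a⁻¹ ℚ.* b⁻¹) ℚ.* (a ℚ.* Q ℚ.+ b ℚ.* P)
          ≡⟨ solve 6 (λ a b a′ b′ P Q → (a′ :* b′) :* (a :* Q :+ b :* P) :=
               (a :* a′) :* (Q :* b′) :+ (b :* b′) :* (P :* a′)) refl a b a⁻¹ b⁻¹ P Q ⟩
        (a ℚ.* a⁻¹) ℚ.* (Q ℚ.* b⁻¹) ℚ.+ (b ℚ.* b⁻¹) ℚ.* (P ℚ.* a⁻¹)
          ≡⟨ cong₂ (λ s t → s ℚ.* (Q ℚ.* b⁻¹) ℚ.+ t ℚ.* (P ℚ.* a⁻¹)) (inverse-inverse 0<a) (inverse-inverse 0<b) ⟩
        1ℚ ℚ.* (Q ℚ.* b⁻¹) ℚ.+ 1ℚ ℚ.* (P ℚ.* a⁻¹)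
          ≡⟨ cong₂ ℚ._+_ (ℚₚ.*-identityˡ (Q ℚ.* b⁻¹)) (ℚₚ.*-identityˡ (P ℚ.* a⁻¹)) ⟩
        Q ℚ.* b⁻¹ ℚ.+ P ℚ.* a⁻¹
          ≡⟨ solve 2 (λ s t → s :+ t := s :- (:- t)) refl (Q ℚ.* b⁻¹) (P ℚ.* a⁻¹) ⟩
        Q ℚ.* b⁻¹ ℚ.- ℚ.- (P ℚ.* a⁻¹) ∎

    separator : ∃[ r ] All (ℚ._< r) (map lower poss) × All (r ℚ.<_) (map upper negs)
    separator = between (map lower poss) (map upper negs)
      (Allₚ.map⁺ (All.tabulate λ q∈ → Allₚ.map⁺ (All.tabulate λ p∈ → lower<upper p∈ q∈)))

    r : ℚ
    r = proj₁ separator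

    ev-cons : ∀ (v : Vec ℤ (suc n)) → ev v (r ∷ x) ≡ ι (head v) ℚ.* r ℚ.+ ev (tail v) x
    ev-cons (_ ∷ _) = refl

    extended : ∀ {v} → v ∈ vs → 0ℚ ℚ.< ev v (r ∷ x)
    extended {v} v∈ = subst (λ z → 0ℚ ℚ.< z) (sym (ev-cons v)) (cases (ℤₚ.<-cmp 0ℤ (head v)))
      where
      e = ev (tail v) x
      cases : _ → 0ℚ ℚ.< ι (head v) ℚ.* r ℚ.+ e
      cases (tri≈ _ 0≡a _) = subst (λ z → 0ℚ ℚ.< z)
        (sym (trans (cong (λ c → c ℚ.* r ℚ.+ e) (trans (cong ι (sym 0≡a)) ι-0))
          (trans (cong (ℚ._+ e) (ℚₚ.*-zeroˡ r)) (ℚₚ.+-identityˡ e))))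
        (All.lookup x-pos (∈ₚ.∈-++⁺ˡ (∈ₚ.∈-map⁺ tail (∈ₚ.∈-filter⁺ (λ v → head v ℤₚ.≟ 0ℤ) v∈ (sym 0≡a)))))
      cases (tri< 0<a _ _) = subst (λ z → 0ℚ ℚ.< z) (begin
        a ℚ.* (r ℚ.- ℚ.- (e ℚ.* a⁻¹))    ≡⟨ solve 4 (λ a a′ e r → a :* (r :- (:- (e :* a′))) := a :* r :+ (a :* a′) :* e) refl a a⁻¹ e r ⟩
        a ℚ.* r ℚ.+ (a ℚ.* a⁻¹) ℚ.* e    ≡⟨ cong (λ z → a ℚ.* r ℚ.+ z ℚ.* e) (inverse-inverse 0<a) ⟩
        a ℚ.* r ℚ.+ 1ℚ ℚ.* e             ≡⟨ cong (λ z → a ℚ.* r ℚ.+ z) (ℚₚ.*-identityˡ e) ⟩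
        a ℚ.* r ℚ.+ e                    ∎)
        (*-pos (ι-pos 0<a) (<⇒0<- (All.lookup (proj₁ (proj₂ separator))
          (∈ₚ.∈-map⁺ lower (∈ₚ.∈-filter⁺ (λ v → 0ℤ ℤₚ.<? head v) v∈ 0<a)))))
        where
        open ≡-Reasoning
        a = ι (head v)
        a⁻¹ = inverse (head v)
      cases (tri> _ _ a<0) = subst (λ z → 0ℚ ℚ.< z) (begin
        b ℚ.* (e ℚ.* b⁻¹ ℚ.- r)          ≡⟨ solve 4 (λ b b′ e r → b :* (e :* b′ :- r) := (:- b) :* r :+ (b :* b′) :* e) refl b b⁻¹ e r ⟩
        ℚ.- b ℚ.* r ℚ.+ (b ℚ.* b⁻¹) ℚ.* e ≡⟨ cong₂ (λ y z → y ℚ.* r ℚ.+ z ℚ.* e) -b≡a (inverse-inverse 0<b) ⟩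
        ι (head v) ℚ.* r ℚ.+ 1ℚ ℚ.* e    ≡⟨ cong (λ z → ι (head v) ℚ.* r ℚ.+ z) (ℚₚ.*-identityˡ e) ⟩
        ι (head v) ℚ.* r ℚ.+ e           ∎)
        (*-pos (ι-pos 0<b) (<⇒0<- (All.lookup (proj₂ (proj₂ separator))
          (∈ₚ.∈-map⁺ upper (∈ₚ.∈-filter⁺ (λ v → head v ℤₚ.<? 0ℤ) v∈ a<0)))))
        where
        open ≡-Reasoning
        0<b = ℤₚ.neg-mono-< a<0
        b = ι (ℤ.- head v)
        b⁻¹ = inverse (ℤ.- head v)
        -b≡a : ℚ.- b ≡ ι (head v)
        -b≡a = trans (sym (ι-neg (ℤ.- head v))) (cong ι (ℤₚ.neg-involutive (head v)))

-- Gordan's theorem, by Fourier–Motzkin elimination of the first coordinate.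
gordan : ∀ {n} (vs : List (Vec ℤ n)) → (∃[ x ] All (λ v → 0ℚ ℚ.< ev v x) vs) ⊎ Cone vs 0ᵛ
gordan {zero}  []        = inj₁ ([] , [])
-- In dimension 0 every constraint reads 0 < 0, and its vector is already a dependency.
gordan {zero}  ([] ∷ vs) = inj₂ (gen (here refl))
gordan {suc n} vs with gordan (Elimination.eliminated vs)
... | inj₂ c           = inj₂ (Elimination.cone-lift vs c)
... | inj₁ (x , x-pos) = inj₁ (Elimination.r vs x x-pos ∷ x , All.tabulate (Elimination.extended vs x x-pos))

ev-scale : ∀ {n} (v : Vec ℤ n) x s → ev v (Vec.map (ℚ._* s) x) ≡ ev v x ℚ.* s
ev-scale []      []       s = sym (ℚₚ.*-zeroˡ s)
ev-scale (a ∷ v) (x ∷ xs) s = trans (cong (λ z → ι a ℚ.* (x ℚ.* s) ℚ.+ z) (ev-scale v xs s))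
  (solve 4 (λ a x s e → a :* (x :* s) :+ e :* s := (a :* x :+ e) :* s) refl (ι a) x s (ev v xs))

-- Separating two incomparable families by a dominant rational point.

module Separation {n} {X : Dynkin n} (Φ : RootSystem X) where
  open RootSystem Φ
  open RootTheory Φ
  open PosRoot
  open Domination Φ
  open Descent Φ

  module _ (ins outs : List PosRoot) (inc : Incomparable ins outs) where

    -- The inequalities α(x) > t, t > β(x), t > 0 and xᵢ > 0 in the unknowns (t , x).
    inVec outVec : PosRoot → Vec ℤ (suc n)
    inVec  α = -[1+ 0 ] ∷ coeffs α
    outVec β = 1ℤ ∷ -ᵛ coeffs β

    tVec : Vec ℤ (suc n)
    tVec = 1ℤ ∷ 0ᵛ

    simpleVec : Fin n → Vec ℤ (suc n)
    simpleVec i = 0ℤ ∷ simple i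

    system : List (Vec ℤ (suc n))
    system = map inVec ins ++ map outVec outs ++ tVec ∷ map simpleVec (allFin n)

    -- A cone element sorted by kind of generator: αs and βs list the root generators with
    -- multiplicity, j counts `tVec`, and σ sums the simple ones. The two equations are the
    -- t-coordinate and the x-coordinates of w with negative terms moved across; `nontrivial`
    -- remembers that some generator was used.
    record Dependency (w : Vec ℤ (suc n)) : Set where
      field
        αs βs      : List PosRoot
        j          : ℕ
        σ          : Vec ℤ n
        αs∈        : All (_∈ ins) αs
        βs∈        : All (_∈ outs) βs
        σ≥0        : NonNeg σ
        head-eq    : head w ℤ.+ + length αs ≡ + (length βs ℕ.+ j)
        tail-eq    : tail w +ᵛ total βs ≡ total αs +ᵛ σ
        nontrivial : 0 ℕ.< length αs ℕ.+ (length βs ℕ.+ j) ⊎ 0ℤ ℤ.< height σ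

    total-++ : ∀ as bs → total (as ++ bs) ≡ total as +ᵛ total bs
    total-++ []       bs = sym (+ᵛ-identityˡ (total bs))
    total-++ (α ∷ as) bs = trans (cong (coeffs α +ᵛ_) (total-++ as bs)) (assoc (coeffs α) (total as) (total bs))
      where
      assoc : ∀ {m} (u v w : Vec ℤ m) → u +ᵛ (v +ᵛ w) ≡ (u +ᵛ v) +ᵛ w
      assoc []      []      []      = refl
      assoc (x ∷ u) (y ∷ v) (z ∷ w) = cong₂ _∷_ (sym (ℤₚ.+-assoc x y z)) (assoc u v w)

    interchange : ∀ {m} (a b c d : Vec ℤ m) → (a +ᵛ b) +ᵛ (c +ᵛ d) ≡ (a +ᵛ c) +ᵛ (b +ᵛ d)
    interchange []      []      []      []      = refl
    interchange (a ∷ u) (b ∷ v) (c ∷ w) (d ∷ z) = cong₂ _∷_ (lemma a b c d) (interchange u v w z)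
      where
      lemma : ∀ a b c d → (a ℤ.+ b) ℤ.+ (c ℤ.+ d) ≡ (a ℤ.+ c) ℤ.+ (b ℤ.+ d)
      lemma = solve-∀

    +ᵛ-identityʳ : ∀ {m} (v : Vec ℤ m) → v +ᵛ 0ᵛ ≡ v
    +ᵛ-identityʳ []      = refl
    +ᵛ-identityʳ (x ∷ v) = cong₂ _∷_ (ℤₚ.+-identityʳ x) (+ᵛ-identityʳ v)

    neg-+ᵛ : ∀ {m} (v : Vec ℤ m) → -ᵛ v +ᵛ v ≡ 0ᵛ
    neg-+ᵛ []      = refl
    neg-+ᵛ (x ∷ v) = cong₂ _∷_ (ℤₚ.+-inverseˡ x) (neg-+ᵛ v)

    dependency-add : ∀ {u v} → Dependency u → Dependency v → Dependency (u +ᵛ v)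
    dependency-add {x ∷ u} {y ∷ v} d e = record
      { αs = D.αs ++ E.αs ; βs = D.βs ++ E.βs ; j = D.j ℕ.+ E.j ; σ = D.σ +ᵛ E.σ
      ; αs∈ = Allₚ.++⁺ D.αs∈ E.αs∈ ; βs∈ = Allₚ.++⁺ D.βs∈ E.βs∈ ; σ≥0 = nonNeg-+ D.σ≥0 E.σ≥0
      ; head-eq = heads
      ; tail-eq = trans (cong (λ z → (u +ᵛ v) +ᵛ z) (total-++ D.βs E.βs))
          (trans (interchange u v (total D.βs) (total E.βs)) (trans (cong₂ _+ᵛ_ D.tail-eq E.tail-eq)
            (trans (interchange (total D.αs) D.σ (total E.αs) E.σ) (cong (_+ᵛ (D.σ +ᵛ E.σ)) (sym (total-++ D.αs E.αs))))))
      ; nontrivial = nontriv D.nontrivial }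
      where
      module D = Dependency d
      module E = Dependency e
      open ≡-Reasoning
      heads : (x ℤ.+ y) ℤ.+ + length (D.αs ++ E.αs) ≡ + (length (D.βs ++ E.βs) ℕ.+ (D.j ℕ.+ E.j))
      heads = begin
        (x ℤ.+ y) ℤ.+ + length (D.αs ++ E.αs)
          ≡⟨ cong (λ l → (x ℤ.+ y) ℤ.+ + l) (Listₚ.length-++ D.αs) ⟩
        (x ℤ.+ y) ℤ.+ (+ length D.αs ℤ.+ + length E.αs)
          ≡⟨ lemma x y (+ length D.αs) (+ length E.αs) ⟩
        (x ℤ.+ + length D.αs) ℤ.+ (y ℤ.+ + length E.αs)
          ≡⟨ cong₂ ℤ._+_ D.head-eq E.head-eq ⟩
        + (length D.βs ℕ.+ D.j ℕ.+ (length E.βs ℕ.+ E.j))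
          ≡⟨ lemma (+ length D.βs) (+ D.j) (+ length E.βs) (+ E.j) ⟩
        + (length D.βs ℕ.+ length E.βs ℕ.+ (D.j ℕ.+ E.j))
          ≡⟨ cong (λ l → + (l ℕ.+ (D.j ℕ.+ E.j))) (Listₚ.length-++ D.βs) ⟨
        + (length (D.βs ++ E.βs) ℕ.+ (D.j ℕ.+ E.j)) ∎
        where
        lemma : ∀ a b c d → (a ℤ.+ b) ℤ.+ (c ℤ.+ d) ≡ (a ℤ.+ c) ℤ.+ (b ℤ.+ d)
        lemma = solve-∀
      nontriv : 0 ℕ.< length D.αs ℕ.+ (length D.βs ℕ.+ D.j) ⊎ 0ℤ ℤ.< height D.σ →
                0 ℕ.< length (D.αs ++ E.αs) ℕ.+ (length (D.βs ++ E.βs) ℕ.+ (D.j ℕ.+ E.j)) ⊎ 0ℤ ℤ.< height (D.σ +ᵛ E.σ)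
      nontriv (inj₁ p) = inj₁ (ℕₚ.<-≤-trans p (ℕₚ.+-mono-≤ (longer D.αs E.αs)
        (ℕₚ.+-mono-≤ (longer D.βs E.βs) (ℕₚ.m≤m+n D.j E.j))))
        where
        longer : ∀ (as bs : List PosRoot) → length as ℕ.≤ length (as ++ bs)
        longer as bs = subst (length as ℕ.≤_) (sym (Listₚ.length-++ as)) (ℕₚ.m≤m+n (length as) (length bs))
      nontriv (inj₂ p) = inj₂ (subst (λ z → 0ℤ ℤ.< z) (sym (height-+ D.σ E.σ)) (ℤₚ.+-mono-<-≤ p (height≥0 E.σ≥0)))

    dependency-gen : ∀ {w} → w ∈ system → Dependency w
    dependency-gen w∈ with ∈ₚ.∈-++⁻ (map inVec ins) w∈
    ... | inj₁ i∈ with ∈ₚ.∈-map⁻ inVec i∈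
    ...   | α , α∈ , refl = record
      { αs = α ∷ [] ; βs = [] ; j = 0 ; σ = 0ᵛ ; αs∈ = α∈ ∷ [] ; βs∈ = [] ; σ≥0 = nonNeg-0
      ; head-eq = refl ; tail-eq = sym (+ᵛ-identityʳ (coeffs α +ᵛ 0ᵛ)) ; nontrivial = inj₁ (ℕ.s≤s ℕ.z≤n) }
    dependency-gen w∈ | inj₂ w∈′ with ∈ₚ.∈-++⁻ (map outVec outs) w∈′
    ... | inj₁ o∈ with ∈ₚ.∈-map⁻ outVec o∈
    ...   | β , β∈ , refl = record
      { αs = [] ; βs = β ∷ [] ; j = 0 ; σ = 0ᵛ ; αs∈ = [] ; βs∈ = β∈ ∷ [] ; σ≥0 = nonNeg-0
      ; head-eq = refl
      ; tail-eq = trans (cong (λ z → -ᵛ coeffs β +ᵛ z) (+ᵛ-identityʳ (coeffs β)))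
          (trans (neg-+ᵛ (coeffs β)) (sym (+ᵛ-identityʳ 0ᵛ)))
      ; nontrivial = inj₁ (ℕ.s≤s ℕ.z≤n) }
    dependency-gen w∈ | inj₂ w∈′ | inj₂ (here refl) = record
      { αs = [] ; βs = [] ; j = 1 ; σ = 0ᵛ ; αs∈ = [] ; βs∈ = [] ; σ≥0 = nonNeg-0
      ; head-eq = refl ; tail-eq = refl ; nontrivial = inj₁ (ℕ.s≤s ℕ.z≤n) }
    dependency-gen w∈ | inj₂ w∈′ | inj₂ (there s∈) with ∈ₚ.∈-map⁻ simpleVec s∈
    ... | i , _ , refl = record
      { αs = [] ; βs = [] ; j = 0 ; σ = simple i ; αs∈ = [] ; βs∈ = [] ; σ≥0 = simple-nonNeg i
      ; head-eq = refl ; tail-eq = trans (+ᵛ-identityʳ (simple i)) (sym (+ᵛ-identityˡ (simple i)))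
      ; nontrivial = inj₂ (subst (λ z → 0ℤ ℤ.< z) (sym (height-simple i)) (ℤ.+<+ (ℕ.s≤s ℕ.z≤n))) }

    dependency : ∀ {w} → Cone system w → Dependency w
    dependency (gen w∈)  = dependency-gen w∈
    dependency (add a b) = dependency-add (dependency a) (dependency b)

    -- The t-coordinate says length αs = length βs + j, the length bound of the descent. If αs is
    -- empty, then so are βs and j, the other coordinates give σ = 0, and no generator is left.
    no-dependency : ¬ Dependency 0ᵛ
    no-dependency d = go (Dependency.αs d) (Dependency.βs d) (Dependency.αs∈ d) (Dependency.βs∈ d)
      (trans (sym (ℤₚ.+-identityˡ _)) (Dependency.head-eq d))
      (trans (sym (+ᵛ-identityˡ _)) (Dependency.tail-eq d)) (Dependency.nontrivial d)
      where
      σ = Dependency.σ d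
      j = Dependency.j d
      go : ∀ αs βs → All (_∈ ins) αs → All (_∈ outs) βs → + length αs ≡ + (length βs ℕ.+ j) →
           total βs ≡ total αs +ᵛ σ →
           0 ℕ.< length αs ℕ.+ (length βs ℕ.+ j) ⊎ 0ℤ ℤ.< height σ → ⊥
      go []      _       _  _  heq teq (inj₁ p) =
        ℕₚ.<-irrefl refl (subst (0 ℕ.<_) (sym (ℤₚ.+-injective heq)) p)
      go []      []      _  _  heq teq (inj₂ p) =
        ℤₚ.<-irrefl (sym (trans (cong height (trans (sym (+ᵛ-identityˡ σ)) (sym teq))) (dot-zero (replicate n 1ℤ)))) p
      go (_ ∷ _) βs      α∈ β∈ heq teq _        =
        sum-domination _ βs (Dependency.σ≥0 d) (sym teq)
          (subst (length βs ℕ.≤_) (sym (ℤₚ.+-injective heq)) (ℕₚ.m≤m+n (length βs) j)) (ℕ.s≤s ℕ.z≤n)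
          (All.map (λ b∈ → All.map (All.lookup (All.lookup inc b∈)) α∈) β∈)

    record Separator (y : Vec ℚ n) : Set where
      field
        in>1     : ∀ {α} → α ∈ ins → 1ℚ ℚ.< ev (coeffs α) y
        out<1    : ∀ {β} → β ∈ outs → ev (coeffs β) y ℚ.< 1ℚ
        simple>0 : ∀ i → 0ℚ ℚ.< ev (simple i) y

    separator : ∃[ y ] Separator y
    separator with gordan system
    ... | inj₂ c = ⊥-elim (no-dependency (dependency c))
    ... | inj₁ (t ∷ x , pos′) = Vec.map (ℚ._* s) x , record
      { in>1 = λ {α} α∈ → 0<-⇒< (subst (λ z → 0ℚ ℚ.< z) (in-eq α)
          (*-pos (All.lookup pos′ (∈ₚ.∈-++⁺ˡ (∈ₚ.∈-map⁺ inVec α∈))) 0<s))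
      ; out<1 = λ {β} β∈ → 0<-⇒< (subst (λ z → 0ℚ ℚ.< z) (out-eq β)
          (*-pos (All.lookup pos′ (∈ₚ.∈-++⁺ʳ (map inVec ins) (∈ₚ.∈-++⁺ˡ (∈ₚ.∈-map⁺ outVec β∈)))) 0<s))
      ; simple>0 = λ i → subst (λ z → 0ℚ ℚ.< z) (simple-eq i)
          (*-pos (All.lookup pos′ (∈ₚ.∈-++⁺ʳ (map inVec ins) (∈ₚ.∈-++⁺ʳ (map outVec outs)
            (there (∈ₚ.∈-map⁺ simpleVec (∈ₚ.∈-allFin i)))))) 0<s) }
      where
      open ≡-Reasoning
      0<t : 0ℚ ℚ.< t
      0<t = subst (λ z → 0ℚ ℚ.< z) (begin
        ι 1ℤ ℚ.* t ℚ.+ ev 0ᵛ x    ≡⟨ cong₂ (λ a b → a ℚ.* t ℚ.+ b) ι-1 (ev-0 x) ⟩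
        1ℚ ℚ.* t ℚ.+ 0ℚ           ≡⟨ ℚₚ.+-identityʳ (1ℚ ℚ.* t) ⟩
        1ℚ ℚ.* t                  ≡⟨ ℚₚ.*-identityˡ t ⟩
        t                         ∎)
        (All.lookup pos′ (∈ₚ.∈-++⁺ʳ (map inVec ins) (∈ₚ.∈-++⁺ʳ (map outVec outs) (here refl))))
      instance
        t-pos : ℚ.Positive t
        t-pos = ℚ.positive 0<t
        t-nonZero : ℚ.NonZero t
        t-nonZero = ℚₚ.pos⇒nonZero t
      -- Dividing by t > 0 turns the unknown threshold t into 1.
      s : ℚ
      s = ℚ.1/ t
      0<s : 0ℚ ℚ.< s
      0<s = ℚₚ.positive⁻¹ s {{ℚₚ.1/pos⇒pos t}}
      ts≡1 : t ℚ.* s ≡ 1ℚ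
      ts≡1 = ℚₚ.*-inverseʳ t
      in-eq : ∀ α → ev (inVec α) (t ∷ x) ℚ.* s ≡ ev (coeffs α) (Vec.map (ℚ._* s) x) ℚ.- 1ℚ
      in-eq α = begin
        (ι -[1+ 0 ] ℚ.* t ℚ.+ e) ℚ.* s     ≡⟨ cong (λ c → (c ℚ.* t ℚ.+ e) ℚ.* s) (trans (ι-neg 1ℤ) (cong ℚ.-_ ι-1)) ⟩
        (ℚ.- 1ℚ ℚ.* t ℚ.+ e) ℚ.* s         ≡⟨ solve 4 (λ o t s e → ((:- o) :* t :+ e) :* s := e :* s :- o :* (t :* s)) refl 1ℚ t s e ⟩
        e ℚ.* s ℚ.- 1ℚ ℚ.* (t ℚ.* s)       ≡⟨ cong₂ (λ a b → a ℚ.- 1ℚ ℚ.* b) (sym (ev-scale (coeffs α) x s)) ts≡1 ⟩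
        ev (coeffs α) (Vec.map (ℚ._* s) x) ℚ.- 1ℚ ∎
        where e = ev (coeffs α) x
      out-eq : ∀ β → ev (outVec β) (t ∷ x) ℚ.* s ≡ 1ℚ ℚ.- ev (coeffs β) (Vec.map (ℚ._* s) x)
      out-eq β = begin
        (ι 1ℤ ℚ.* t ℚ.+ ev (-ᵛ coeffs β) x) ℚ.* s ≡⟨ cong₂ (λ c d → (c ℚ.* t ℚ.+ d) ℚ.* s) ι-1 (ev-neg (coeffs β) x) ⟩
        (1ℚ ℚ.* t ℚ.+ ℚ.- e) ℚ.* s         ≡⟨ solve 4 (λ o t s e → (o :* t :+ :- e) :* s := o :* (t :* s) :- e :* s) refl 1ℚ t s e ⟩
        1ℚ ℚ.* (t ℚ.* s) ℚ.- e ℚ.* s       ≡⟨ cong₂ (λ a b → 1ℚ ℚ.* a ℚ.- b) ts≡1 (sym (ev-scale (coeffs β) x s)) ⟩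
        1ℚ ℚ.- ev (coeffs β) (Vec.map (ℚ._* s) x) ∎
        where e = ev (coeffs β) x
      simple-eq : ∀ i → ev (simpleVec i) (t ∷ x) ℚ.* s ≡ ev (simple i) (Vec.map (ℚ._* s) x)
      simple-eq i = begin
        (ι 0ℤ ℚ.* t ℚ.+ ev (simple i) x) ℚ.* s ≡⟨ cong (λ c → (c ℚ.* t ℚ.+ ev (simple i) x) ℚ.* s) ι-0 ⟩
        (0ℚ ℚ.* t ℚ.+ ev (simple i) x) ℚ.* s   ≡⟨ cong (λ c → (c ℚ.+ ev (simple i) x) ℚ.* s) (ℚₚ.*-zeroˡ t) ⟩
        (0ℚ ℚ.+ ev (simple i) x) ℚ.* s         ≡⟨ cong (ℚ._* s) (ℚₚ.+-identityˡ (ev (simple i) x)) ⟩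
        ev (simple i) x ℚ.* s                  ≡⟨ ev-scale (simple i) x s ⟨
        ev (simple i) (Vec.map (ℚ._* s) x)     ∎

-- Segments in real space, computed on approximants.

at : ∀ {n} → Vec ℝ n → ℕ → Vec ℚ n
at x k = Vec.map (λ r → seq r k) x

-- Reduces statements about linear forms at real points to rational statements about the k-th
-- approximants.
seq-value : ∀ {n} (c : Vec ℤ n) x k → seq (c ⟨ x ⟩) k ≡ ev c (at x k)
seq-value []      []       k = refl
seq-value (c ∷ cs) (x ∷ xs) k = cong₂ (λ a b → a ℚ.* seq x k ℚ.+ b) (sym (ι≡/1 c)) (seq-value cs xs k)

eventually-× : ∀ {P Q : ℕ → Set} → Eventually P → Eventually Q → Eventually (λ k → P k × Q k)
eventually-× (N , p) (M , q) = N ℕ.⊔ M , λ k k≥ →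
  p k (ℕₚ.m⊔n≤o⇒m≤o N M k≥) , q k (ℕₚ.m⊔n≤o⇒n≤o N M k≥)

eventually-map : ∀ {P Q : ℕ → Set} → (∀ k → P k → Q k) → Eventually P → Eventually Q
eventually-map f (N , p) = N , λ k k≥ → f k (p k k≥)

eventually-all : ∀ {n} {P : Fin n → ℕ → Set} → (∀ i → Eventually (P i)) → Eventually (λ k → ∀ i → P i k)
eventually-all {zero}  _ = 0 , λ _ _ ()
eventually-all {suc n} h = eventually-map (λ { k (p , ps) zero → p ; k (p , ps) (suc i) → ps i })
  (eventually-× (h zero) (eventually-all (h ∘ suc)))

ev-simple : ∀ {n} (i : Fin n) x → ev (simple i) x ≡ lookup x i
ev-simple zero    (x ∷ xs) = trans (cong₂ (λ a b → a ℚ.* x ℚ.+ b) ι-1 (ev-0 xs))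
  (trans (ℚₚ.+-identityʳ _) (ℚₚ.*-identityˡ x))
ev-simple (suc i) (x ∷ xs) = trans (cong₂ (λ a b → a ℚ.* x ℚ.+ b) ι-0 (ev-simple i xs))
  (trans (cong (ℚ._+ lookup xs i) (ℚₚ.*-zeroˡ x)) (ℚₚ.+-identityˡ _))

ev-nonNeg : ∀ {n} {c : Vec ℤ n} → NonNeg c → ∀ x → (∀ i → 0ℚ ℚ.≤ lookup x i) → 0ℚ ℚ.≤ ev c x
ev-nonNeg []          []       _ = ℚₚ.≤-refl
ev-nonNeg (c≥0 ∷ cs≥0) (x ∷ xs) h = ℚₚ.+-mono-≤ (*-nonNegℚ (ι-nonNeg c≥0) (h zero)) (ev-nonNeg cs≥0 xs (h ∘ suc))

ev-pos : ∀ {n} {c : Vec ℤ n} → NonNeg c → c ≢ 0ᵛ → ∀ x → (∀ i → 0ℚ ℚ.< lookup x i) → 0ℚ ℚ.< ev c x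
ev-pos []                           c≢0 _        _ = ⊥-elim (c≢0 refl)
ev-pos (_∷_ {x = c} {xs = cs} c≥0 cs≥0) c≢0 (x ∷ xs) h with c ℤₚ.≟ 0ℤ
... | yes refl = ℚₚ.+-mono-≤-< (*-nonNegℚ (ι-nonNeg c≥0) (ℚₚ.<⇒≤ (h zero)))
                   (ev-pos cs≥0 (c≢0 ∘ cong (0ℤ ∷_)) xs (h ∘ suc))
... | no  c≢0′ = ℚₚ.+-mono-<-≤ (*-pos (ι-pos (ℤₚ.≤∧≢⇒< c≥0 (c≢0′ ∘ sym))) (h zero))
                   (ev-nonNeg cs≥0 xs (ℚₚ.<⇒≤ ∘ h ∘ suc))

const-< : ∀ {p q} (a b : ℝ) → (∀ k → seq a k ≡ p) → (∀ k → seq b k ≡ q) → p ℚ.< q → a < b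
const-< {p} {q} a b a≡p b≡q p<q = q ℚ.- p , <⇒0<- p<q , 0 , λ k _ →
  ℚₚ.≤-reflexive (trans (cong (ℚ._+ (q ℚ.- p)) (a≡p k))
    (trans (solve 2 (λ p q → p :+ (q :- p) := q) refl p q) (sym (b≡q k))))

<⇒≱-eventually : ∀ (a b : ℝ) → a < b → ¬ Eventually (λ k → seq b k ℚ.≤ seq a k)
<⇒≱-eventually a b (ε , ε>0 , a<b) b≤a with eventually-× a<b b≤a
... | N , h = let (p , q) = h N ℕₚ.≤-refl in
  ℚₚ.<-irrefl refl (ℚₚ.<-≤-trans ε>0 (ℚₚ.≤-trans
    (subst (λ z → z ℚ.≤ seq b N ℚ.- seq a N) (solve 2 (λ a e → (a :+ e) :- a := e) refl (seq a N) ε)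
      (ℚₚ.+-monoˡ-≤ (ℚ.- seq a N) p))
    (subst (λ z → seq b N ℚ.- seq a N ℚ.≤ z) (ℚₚ.+-inverseʳ (seq a N)) (ℚₚ.+-monoˡ-≤ (ℚ.- seq a N) q))))

∣∣-bounds : ∀ {p q} → p ℚ.≤ q → ℚ.- p ℚ.≤ q → ℚ.∣ p ∣ ℚ.≤ q
∣∣-bounds {p} {q} p≤q -p≤q with ℚₚ.∣p∣≡p∨∣p∣≡-p p
... | inj₁ e = subst (ℚ._≤ q) (sym e) p≤q
... | inj₂ e = subst (ℚ._≤ q) (sym e) -p≤q

≤∣∣ : ∀ p → p ℚ.≤ ℚ.∣ p ∣
≤∣∣ p with ℚₚ.≤-total 0ℚ p
... | inj₁ 0≤p = ℚₚ.≤-reflexive (sym (ℚₚ.0≤p⇒∣p∣≡p 0≤p))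
... | inj₂ p≤0 = ℚₚ.≤-trans p≤0 (ℚₚ.0≤∣p∣ p)

eventually-bounded : ∀ (d : ℝ) → ∃[ c ] 0ℚ ℚ.≤ c × Eventually (λ k → ℚ.∣ seq d k ∣ ℚ.≤ c)
eventually-bounded d = from-cauchy (cauchy d 1ℚ (ℚₚ.positive⁻¹ 1ℚ))
  where
  open ℚₚ.≤-Reasoning
  bound : ∀ a b → ℚ.∣ a ℚ.- b ∣ ℚ.< 1ℚ → ℚ.∣ a ∣ ℚ.≤ ℚ.∣ b ∣ ℚ.+ 1ℚ
  bound a b h = begin
    ℚ.∣ a ∣                        ≡⟨ cong ℚ.∣_∣ (solve 2 (λ a b → a := b :+ (a :- b)) refl a b) ⟩
    ℚ.∣ b ℚ.+ (a ℚ.- b) ∣          ≤⟨ ℚₚ.∣p+q∣≤∣p∣+∣q∣ b (a ℚ.- b) ⟩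
    ℚ.∣ b ∣ ℚ.+ ℚ.∣ a ℚ.- b ∣      ≤⟨ ℚₚ.+-monoʳ-≤ ℚ.∣ b ∣ (ℚₚ.<⇒≤ h) ⟩
    ℚ.∣ b ∣ ℚ.+ 1ℚ                 ∎
  from-cauchy : (∃[ N ] ∀ m n → N ℕ.≤ m → N ℕ.≤ n → ℚ.∣ seq d m ℚ.- seq d n ∣ ℚ.< 1ℚ) →
                ∃[ c ] 0ℚ ℚ.≤ c × Eventually (λ k → ℚ.∣ seq d k ∣ ℚ.≤ c)
  from-cauchy (N , h) = ℚ.∣ seq d N ∣ ℚ.+ 1ℚ ,
    ℚₚ.+-mono-≤ (ℚₚ.0≤∣p∣ (seq d N)) (ℚₚ.<⇒≤ (ℚₚ.positive⁻¹ 1ℚ)) ,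
    N , λ k k≥ → bound (seq d k) (seq d N) (h k N k≥ ℕₚ.≤-refl)

bounded-scale : ∀ (d : ℝ) {ε} → 0ℚ ℚ.< ε → ∃[ η ] 0ℚ ℚ.< η ×
                Eventually (λ k → ∀ δ → ℚ.∣ δ ∣ ℚ.< η → ℚ.∣ δ ℚ.* seq d k ∣ ℚ.< ε)
bounded-scale d {ε} ε>0 =
  let (c , 0≤c , d≤c)   = eventually-bounded d
      (η , η>0 , scale) = scale-bound c ε>0
  in η , η>0 , eventually-map (λ k h δ δ<η → bound c (seq d k) δ 0≤c h (scale δ δ<η)) d≤c
  where
  open ℚₚ.≤-Reasoning
  bound : ∀ c e δ → 0ℚ ℚ.≤ c → ℚ.∣ e ∣ ℚ.≤ c → ℚ.∣ c ℚ.* δ ∣ ℚ.< ε → ℚ.∣ δ ℚ.* e ∣ ℚ.< ε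
  bound c e δ 0≤c e≤c h = begin-strict
    ℚ.∣ δ ℚ.* e ∣            ≡⟨ ℚₚ.∣p*q∣≡∣p∣*∣q∣ δ e ⟩
    ℚ.∣ δ ∣ ℚ.* ℚ.∣ e ∣      ≤⟨ ℚₚ.*-monoˡ-≤-nonNeg ℚ.∣ δ ∣ {{ℚₚ.∣-∣-nonNeg δ}} e≤c ⟩
    ℚ.∣ δ ∣ ℚ.* c            ≡⟨ cong (ℚ.∣ δ ∣ ℚ.*_) (ℚₚ.0≤p⇒∣p∣≡p 0≤c) ⟨
    ℚ.∣ δ ∣ ℚ.* ℚ.∣ c ∣      ≡⟨ ℚₚ.∣p*q∣≡∣p∣*∣q∣ δ c ⟨
    ℚ.∣ δ ℚ.* c ∣            ≡⟨ cong ℚ.∣_∣ (ℚₚ.*-comm δ c) ⟩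
    ℚ.∣ c ℚ.* δ ∣            <⟨ h ⟩
    ε                        ∎

-- A real number of [0 , 1] whose bounds hold for every term of the sequence, so that convexity
-- estimates apply at each index.
record Parameter : Set where
  field
    param   : ℕ → ℚ
    pcauchy : Cauchy param
    0≤param : ∀ k → 0ℚ ℚ.≤ param k
    param≤1 : ∀ k → param k ℚ.≤ 1ℚ
open Parameter

constant : ∀ s → 0ℚ ℚ.≤ s → s ℚ.≤ 1ℚ → Parameter
constant s 0≤s s≤1 = record
  { param = λ _ → s ; pcauchy = const-cauchy s ; 0≤param = λ _ → 0≤s ; param≤1 = λ _ → s≤1 }

difference : ℝ → ℝ → ℝ
difference a b = b + (-[1+ 0 ] · a)

abstract
  -- Uses s d - t e = s (d - e) + (s - t) e: the first summand is controlled by ∣ s ∣ ≤ 1, the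
  -- second by the eventual boundedness of d.
  product-cauchy : ∀ (t : Parameter) (d : ℝ) → Cauchy (λ k → param t k ℚ.* seq d k)
  product-cauchy t d ε ε>0 =
    let (η , η>0 , N₁ , bound) = bounded-scale d (half ε>0)
        (N₂ , t-close)         = pcauchy t η η>0
        (N₃ , d-close)         = cauchy d (½ ℚ.* ε) (half ε>0)
    in N₁ ℕ.⊔ (N₂ ℕ.⊔ N₃) , λ m n m≥ n≥ →
    combine (param t m) (param t n) (seq d m) (seq d n)
      (ℚₚ.≤-<-trans (shrink m (seq d m ℚ.- seq d n)) (d-close m n (≥₃ N₁ N₂ N₃ m≥) (≥₃ N₁ N₂ N₃ n≥)))
      (bound n (≥₁ N₁ N₂ N₃ n≥) (param t m ℚ.- param t n) (t-close m n (≥₂ N₁ N₂ N₃ m≥) (≥₂ N₁ N₂ N₃ n≥)))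
    where
    ≥₁ : ∀ a b c {k} → a ℕ.⊔ (b ℕ.⊔ c) ℕ.≤ k → a ℕ.≤ k
    ≥₁ a b c = ℕₚ.m⊔n≤o⇒m≤o a (b ℕ.⊔ c)
    ≥₂ : ∀ a b c {k} → a ℕ.⊔ (b ℕ.⊔ c) ℕ.≤ k → b ℕ.≤ k
    ≥₂ a b c h = ℕₚ.m⊔n≤o⇒m≤o b c (ℕₚ.m⊔n≤o⇒n≤o a (b ℕ.⊔ c) h)
    ≥₃ : ∀ a b c {k} → a ℕ.⊔ (b ℕ.⊔ c) ℕ.≤ k → c ℕ.≤ k
    ≥₃ a b c h = ℕₚ.m⊔n≤o⇒n≤o b c (ℕₚ.m⊔n≤o⇒n≤o a (b ℕ.⊔ c) h)
    combine : ∀ s t d e → ℚ.∣ s ℚ.* (d ℚ.- e) ∣ ℚ.< ½ ℚ.* ε → ℚ.∣ (s ℚ.- t) ℚ.* e ∣ ℚ.< ½ ℚ.* ε →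
              ℚ.∣ s ℚ.* d ℚ.- t ℚ.* e ∣ ℚ.< ε
    combine s t d e p q = subst (λ z → ℚ.∣ z ∣ ℚ.< ε)
      (solve 4 (λ s t d e → s :* (d :- e) :+ (s :- t) :* e := s :* d :- t :* e) refl s t d e)
      (∣+∣-bound (s ℚ.* (d ℚ.- e)) ((s ℚ.- t) ℚ.* e) p q)
    shrink : ∀ m p → ℚ.∣ param t m ℚ.* p ∣ ℚ.≤ ℚ.∣ p ∣
    shrink m p = subst₂ ℚ._≤_ (sym (ℚₚ.∣p*q∣≡∣p∣*∣q∣ (param t m) p)) (ℚₚ.*-identityˡ ℚ.∣ p ∣)
      (ℚₚ.*-monoʳ-≤-nonNeg ℚ.∣ p ∣ {{ℚₚ.∣-∣-nonNeg p}}
        (subst (ℚ._≤ 1ℚ) (sym (ℚₚ.0≤p⇒∣p∣≡p (0≤param t m))) (param≤1 t m)))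

  mix-cauchy : ∀ (t : Parameter) (a b : ℝ) → Cauchy (λ k → seq a k ℚ.+ param t k ℚ.* seq (difference a b) k)
  mix-cauchy t a b = +-cauchy (seq a) (λ k → param t k ℚ.* seq (difference a b) k)
    (cauchy a) (product-cauchy t (difference a b))

mix : Parameter → ℝ → ℝ → ℝ
mix t a b = mkℝ (λ k → seq a k ℚ.+ param t k ℚ.* seq (difference a b) k) (mix-cauchy t a b)

seq-mix : ∀ t a b k → seq (mix t a b) k ≡ seq a k ℚ.+ param t k ℚ.* (seq b k ℚ.- seq a k)
seq-mix t a b k = cong (λ z → seq a k ℚ.+ param t k ℚ.* (seq b k ℚ.+ z))
  (trans (sym (ℚₚ.neg-distribˡ-* 1ℚ (seq a k))) (cong ℚ.-_ (ℚₚ.*-identityˡ (seq a k))))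

mixᵛ : ∀ {n} → Parameter → Vec ℝ n → Vec ℝ n → Vec ℝ n
mixᵛ t = zipWith (mix t)

ev-mix : ∀ {n} t (c : Vec ℤ n) x y k →
         ev c (at (mixᵛ t x y) k) ≡ ev c (at x k) ℚ.+ param t k ℚ.* (ev c (at y k) ℚ.- ev c (at x k))
ev-mix t []       []       []       k = solve 2 (λ o t → o := o :+ t :* (o :- o)) refl 0ℚ (param t k)
ev-mix t (c ∷ cs) (a ∷ x) (b ∷ y) k = trans
  (cong₂ (λ p q → ι c ℚ.* p ℚ.+ q) (seq-mix t a b k) (ev-mix t cs x y k))
  (solve 6 (λ c a b t p q → c :* (a :+ t :* (b :- a)) :+ (p :+ t :* (q :- p)) :=
     (c :* a :+ p) :+ t :* ((c :* b :+ q) :- (c :* a :+ p))) refl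
     (ι c) (seq a k) (seq b k) (param t k) (ev cs (at x k)) (ev cs (at y k)))

convex≥ : ∀ {m a b t} → 0ℚ ℚ.≤ t → t ℚ.≤ 1ℚ → m ℚ.≤ a → m ℚ.≤ b → m ℚ.≤ a ℚ.+ t ℚ.* (b ℚ.- a)
convex≥ {m} {a} {b} {t} 0≤t t≤1 m≤a m≤b = subst₂ ℚ._≤_
  (solve 3 (λ m t o → (o :- t) :* m :+ t :* m := o :* m) refl m t 1ℚ ▸ ℚₚ.*-identityˡ m)
  (solve 4 (λ a b t o → (o :- t) :* a :+ t :* b := o :* a :+ t :* (b :- a)) refl a b t 1ℚ
    ▸ cong (ℚ._+ t ℚ.* (b ℚ.- a)) (ℚₚ.*-identityˡ a))
  (ℚₚ.+-mono-≤
    (ℚₚ.*-monoˡ-≤-nonNeg (1ℚ ℚ.- t) {{ℚ.nonNegative 0≤1-t}} m≤a)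
    (ℚₚ.*-monoˡ-≤-nonNeg t {{ℚ.nonNegative 0≤t}} m≤b))
  where
  infixl 5 _▸_
  _▸_ : ∀ {p q r : ℚ} → p ≡ q → q ≡ r → p ≡ r
  _▸_ = trans
  0≤1-t : 0ℚ ℚ.≤ 1ℚ ℚ.- t
  0≤1-t = subst (ℚ._≤ 1ℚ ℚ.- t) (ℚₚ.+-inverseʳ t) (ℚₚ.+-monoˡ-≤ (ℚ.- t) t≤1)

neg-cancel-≤ℚ : ∀ {p q} → ℚ.- p ℚ.≤ ℚ.- q → q ℚ.≤ p
neg-cancel-≤ℚ {p} {q} h =
  subst₂ ℚ._≤_ (+-Group.⁻¹-involutive q) (+-Group.⁻¹-involutive p) (ℚₚ.neg-antimono-≤ h)

convex≤ : ∀ {m a b t} → 0ℚ ℚ.≤ t → t ℚ.≤ 1ℚ → a ℚ.≤ m → b ℚ.≤ m → a ℚ.+ t ℚ.* (b ℚ.- a) ℚ.≤ m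
convex≤ {m} {a} {b} {t} 0≤t t≤1 a≤m b≤m = neg-cancel-≤ℚ (subst (ℚ.- m ℚ.≤_)
  (solve 3 (λ a b t → :- a :+ t :* (:- b :- (:- a)) := :- (a :+ t :* (b :- a))) refl a b t)
  (convex≥ 0≤t t≤1 (ℚₚ.neg-antimono-≤ a≤m) (ℚₚ.neg-antimono-≤ b≤m)))

-- A relation between sequences: the value of a linear form on `mixᵛ` is not syntactically a `mix`,
-- but its terms are these.
Mixed : Parameter → ℝ → ℝ → ℝ → Set
Mixed t a b c = ∀ k → seq c k ≡ seq a k ℚ.+ param t k ℚ.* (seq b k ℚ.- seq a k)

mixed-> : ∀ t q a b c → Mixed t a b c → fromℚ q < a → fromℚ q < b → fromℚ q < c
mixed-> t q a b c c-mixed (ε , ε>0 , q<a) (η , η>0 , q<b) = ε ℚ.⊓ η , min>0 ε>0 η>0 ,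
  eventually-map (λ k (p , r) → subst (q ℚ.+ ε ℚ.⊓ η ℚ.≤_) (sym (c-mixed k))
    (convex≥ (0≤param t k) (param≤1 t k)
      (ℚₚ.≤-trans (ℚₚ.+-monoʳ-≤ q (ℚₚ.p⊓q≤p ε η)) p)
      (ℚₚ.≤-trans (ℚₚ.+-monoʳ-≤ q (ℚₚ.p⊓q≤q ε η)) r)))
    (eventually-× q<a q<b)

mixed-< : ∀ t q a b c → Mixed t a b c → a < fromℚ q → b < fromℚ q → c < fromℚ q
mixed-< t q a b c c-mixed (ε , ε>0 , a<q) (η , η>0 , b<q) = ζ , min>0 ε>0 η>0 ,
  eventually-map (λ k (p , r) → subst (ℚ._≤ q)
    (trans (solve 4 (λ a b t e → (a :+ e) :+ t :* ((b :+ e) :- (a :+ e)) := (a :+ t :* (b :- a)) :+ e) refl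
        (seq a k) (seq b k) (param t k) ζ)
      (cong (ℚ._+ ζ) (sym (c-mixed k))))
    (convex≤ (0≤param t k) (param≤1 t k)
      (ℚₚ.≤-trans (ℚₚ.+-monoʳ-≤ (seq a k) (ℚₚ.p⊓q≤p ε η)) p)
      (ℚₚ.≤-trans (ℚₚ.+-monoʳ-≤ (seq b k) (ℚₚ.p⊓q≤q ε η)) r)))
    (eventually-× a<q b<q)
  where ζ = ε ℚ.⊓ η

-- One half of ε bounds the difference; the other half is the margin that `_<_` demands.
within-intro : ∀ {ε} (a b : ℝ) → 0ℚ ℚ.< ε → Eventually (λ k → ℚ.∣ seq a k ℚ.- seq b k ∣ ℚ.< ½ ℚ.* ε) → Within ε a b
within-intro {ε} a b ε>0 h = (δ , half ε>0 , eventually-map (λ k p → one (seq a k) (seq b k) p) h)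
  , (δ , half ε>0 , eventually-map (λ k p → one (seq b k) (seq a k) (subst (ℚ._< δ) (∣-∣-comm (seq a k) (seq b k)) p)) h)
  where
  δ = ½ ℚ.* ε
  one : ∀ p q → ℚ.∣ p ℚ.- q ∣ ℚ.< δ → p ℚ.+ δ ℚ.≤ q ℚ.+ ε
  one p q p-q<δ = subst₂ ℚ._≤_ (solve 3 (λ p q d → (p :- q) :+ (q :+ d) := p :+ d) refl p q δ)
    (trans (solve 2 (λ q d → d :+ (q :+ d) := q :+ (d :+ d)) refl q δ) (cong (λ z → q ℚ.+ z) (half+half ε)))
    (ℚₚ.+-monoˡ-≤ (q ℚ.+ δ) (ℚₚ.<⇒≤ (ℚₚ.≤-<-trans (≤∣∣ (p ℚ.- q)) p-q<δ)))

-- Coordinates with equal terms need not be equal in ℝ, since their Cauchy proofs may differ. Being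
-- arbitrarily near is what a locally constant function can use instead.
near-≡ : ∀ {n ε} → 0ℚ ℚ.< ε → (x y : Vec ℝ n) → (∀ i k → seq (lookup x i) k ≡ seq (lookup y i) k) → Near ε x y
near-≡ ε>0 []      []      _ = []
near-≡ {ε = ε} ε>0 (a ∷ x) (b ∷ y) h = within-intro a b ε>0
  (0 , λ k _ → subst (λ z → ℚ.∣ z ∣ ℚ.< ½ ℚ.* ε)
    (sym (trans (cong (ℚ._- seq b k) (h zero k)) (ℚₚ.+-inverseʳ (seq b k)))) (half ε>0))
  ∷ near-≡ ε>0 x y (h ∘ suc)

-- The mixtures differ in each coordinate by (s - t)(b - a), and b - a is eventually bounded. So η
-- depends on the endpoints and ε alone.
near-mix : ∀ {n} (x y : Vec ℝ n) {ε} → 0ℚ ℚ.< ε → ∃[ η ] 0ℚ ℚ.< η × (∀ s t →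
           Eventually (λ k → ℚ.∣ param s k ℚ.- param t k ∣ ℚ.< η) → Near ε (mixᵛ s x y) (mixᵛ t x y))
near-mix []      []      _ = 1ℚ , ℚₚ.positive⁻¹ 1ℚ , λ _ _ _ → []
near-mix (a ∷ x) (b ∷ y) {ε} ε>0 = η ℚ.⊓ ζ , min>0 (proj₁ (proj₂ scale)) (proj₁ (proj₂ ih)) , λ s t h →
  within-intro (mix s a b) (mix t a b) ε>0 (eventually-map (λ k (p , q) →
    subst (λ z → ℚ.∣ z ∣ ℚ.< ½ ℚ.* ε)
      (solve 4 (λ a s t d → (s :- t) :* d := (a :+ s :* d) :- (a :+ t :* d)) refl
        (seq a k) (param s k) (param t k) (seq (difference a b) k))
      (q (param s k ℚ.- param t k) (ℚₚ.<-≤-trans p (ℚₚ.p⊓q≤p η ζ))))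
    (eventually-× h (proj₂ (proj₂ scale))))
  ∷ proj₂ (proj₂ ih) s t (eventually-map (λ k p → ℚₚ.<-≤-trans p (ℚₚ.p⊓q≤q η ζ)) h)
  where
  scale = bounded-scale (difference a b) (half ε>0)
  ih    = near-mix x y ε>0
  η     = proj₁ scale
  ζ     = proj₁ ih

-- Powers of 1/2 tend to zero.

halving : ℕ → ℚ
halving zero    = 1ℚ
halving (suc k) = ½ ℚ.* halving k

½*-mono-< : ∀ {p q} → p ℚ.< q → ½ ℚ.* p ℚ.< ½ ℚ.* q
½*-mono-< = ℚₚ.*-monoʳ-<-pos ½

halving≤1 : ∀ k → halving k ℚ.≤ 1ℚ
halving≤1 zero    = ℚₚ.≤-refl
halving≤1 (suc k) = ℚₚ.≤-trans (ℚₚ.*-monoˡ-≤-nonNeg ½ (halving≤1 k)) (ℚₚ.<⇒≤ (0<-⇒< (ℚₚ.positive⁻¹ _)))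

multiple-halving<1 : ∀ k → ι (+ k) ℚ.* halving k ℚ.< 1ℚ
multiple-halving<1 zero    = subst (ℚ._< 1ℚ) (sym (cong (ℚ._* 1ℚ) ι-0)) (ℚₚ.positive⁻¹ 1ℚ)
multiple-halving<1 (suc k) = subst (ℚ._< 1ℚ) (begin
  ½ ℚ.* (ι (+ k) ℚ.* w ℚ.+ w)        ≡⟨ cong (λ z → ½ ℚ.* (ι (+ k) ℚ.* w ℚ.+ z)) (ℚₚ.*-identityˡ w) ⟨
  ½ ℚ.* (ι (+ k) ℚ.* w ℚ.+ 1ℚ ℚ.* w) ≡⟨ solve 4 (λ h k w o → h :* (k :* w :+ o :* w) := (o :+ k) :* (h :* w)) refl ½ (ι (+ k)) w 1ℚ ⟩
  (1ℚ ℚ.+ ι (+ k)) ℚ.* (½ ℚ.* w)     ≡⟨ cong (λ z → (z ℚ.+ ι (+ k)) ℚ.* (½ ℚ.* w)) ι-1 ⟨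
  (ι 1ℤ ℚ.+ ι (+ k)) ℚ.* (½ ℚ.* w)   ≡⟨ cong (ℚ._* (½ ℚ.* w)) (ι-+ 1ℤ (+ k)) ⟨
  ι (+ suc k) ℚ.* (½ ℚ.* w)          ∎)
  (½*-mono-< (ℚₚ.+-mono-<-≤ (multiple-halving<1 k) (halving≤1 k)))
  where
  open ≡-Reasoning
  w = halving k

-- The denominator of η serves as k: it multiplies η to its numerator, which is at least 1.
archimedean : ∀ {η} → 0ℚ ℚ.< η → ∃[ k ] 1ℚ ℚ.≤ ι (+ k) ℚ.* η
archimedean {η} η>0 = ℚ.↧ₙ η , subst (1ℚ ℚ.≤_) (sym numerator)
  (subst (ℚ._≤ ι (ℚ.↥ η)) ι-1 (ι-mono (positive-numerator η (ℚ.positive η>0))))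
  where
  positive-numerator : ∀ p → ℚ.Positive p → 1ℤ ℤ.≤ ℚ.↥ p
  positive-numerator (ℚ.mkℚ (+ suc _) _ _) _ = ℤ.+≤+ (ℕ.s≤s ℕ.z≤n)
  ι-mono : ∀ {a b} → a ℤ.≤ b → ι a ℚ.≤ ι b
  ι-mono {a} {b} a≤b = subst₂ ℚ._≤_ (ℚₚ.+-identityˡ (ι a))
    (trans (sym (ι-+ (b ℤ.- a) a)) (cong ι (trans (ℤₚ.+-assoc b (ℤ.- a) a)
      (trans (cong (λ z → b ℤ.+ z) (ℤₚ.+-inverseˡ a)) (ℤₚ.+-identityʳ b)))))
    (ℚₚ.+-monoˡ-≤ (ι a) (ι-nonNeg (ℤₚ.i≤j⇒0≤j-i a≤b)))
  numerator : ι (+ ℚ.↧ₙ η) ℚ.* η ≡ ι (ℚ.↥ η)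
  numerator = begin
    ι (+ ℚ.↧ₙ η) ℚ.* η
      ≡⟨ cong (λ z → ι (+ ℚ.↧ₙ η) ℚ.* z) (sym (trans (ι-quotient (ℚ.↥ η) (ℚ.denominator-1 η)) (ℚₚ.↥p/↧p≡p η))) ⟩
    ι (+ ℚ.↧ₙ η) ℚ.* (ι (ℚ.↥ η) ℚ.* (1ℤ ℚ./ ℚ.↧ₙ η))
      ≡⟨ solve 3 (λ d u v → d :* (u :* v) := (d :* v) :* u) refl (ι (+ ℚ.↧ₙ η)) (ι (ℚ.↥ η)) (1ℤ ℚ./ ℚ.↧ₙ η) ⟩
    (ι (+ ℚ.↧ₙ η) ℚ.* (1ℤ ℚ./ ℚ.↧ₙ η)) ℚ.* ι (ℚ.↥ η)
      ≡⟨ cong (ℚ._* ι (ℚ.↥ η)) (ι-1/ (ℚ.denominator-1 η)) ⟩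
    1ℚ ℚ.* ι (ℚ.↥ η)
      ≡⟨ ℚₚ.*-identityˡ (ι (ℚ.↥ η)) ⟩
    ι (ℚ.↥ η) ∎
    where open ≡-Reasoning

-- With 1 ≤ N η, assuming η ≤ 2^(-N) would give 1 ≤ N · 2^(-N) < 1.
halving-small : ∀ {η} → 0ℚ ℚ.< η → ∃[ N ] halving N ℚ.< η
halving-small {η} η>0 = N , ℚₚ.≰⇒> λ η≤w → ℚₚ.<-irrefl refl (ℚₚ.≤-<-trans 1≤Nη
  (ℚₚ.≤-<-trans (ℚₚ.*-monoˡ-≤-nonNeg (ι (+ N)) {{ℚ.nonNegative (ι-nonNeg (ℤ.+≤+ ℕ.z≤n))}} η≤w) (multiple-halving<1 N)))
  where
  N    = proj₁ (archimedean η>0)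
  1≤Nη = proj₂ (archimedean η>0)

at-fromℚ : ∀ {n} (y : Vec ℚ n) k → at (Vec.map fromℚ y) k ≡ y
at-fromℚ []      k = refl
at-fromℚ (q ∷ y) k = cong (q ∷_) (at-fromℚ y k)

midpoint≥ : ∀ {a b} → a ℚ.≤ b → a ℚ.≤ ½ ℚ.* (a ℚ.+ b)
midpoint≥ {a} {b} a≤b = subst (ℚ._≤ ½ ℚ.* (a ℚ.+ b))
  (trans (ℚₚ.*-distribˡ-+ ½ a a) (half+half a)) (ℚₚ.*-monoˡ-≤-nonNeg ½ (ℚₚ.+-monoʳ-≤ a a≤b))

midpoint≤ : ∀ {a b} → a ℚ.≤ b → ½ ℚ.* (a ℚ.+ b) ℚ.≤ b
midpoint≤ {a} {b} a≤b = subst (½ ℚ.* (a ℚ.+ b) ℚ.≤_)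
  (trans (ℚₚ.*-distribˡ-+ ½ b b) (half+half b)) (ℚₚ.*-monoˡ-≤-nonNeg ½ (ℚₚ.+-monoˡ-≤ b a≤b))

-- Regions of the arrangement and constancy of functions on them.

module Regions {n} {X : Dynkin n} (Φ : RootSystem X) where
  open RootSystem Φ
  open PosRoot
  open Descent Φ using (coeffs≢0)

  simpleRoot : Fin n → PosRoot
  simpleRoot i = record { coeffs = simple i ; root = simple∈ i ; pos = simple-nonNeg i }

  Above Below : PosRoot → Vec ℝ n → Set
  Above α x = 1ℝ < value Φ α x
  Below α x = value Φ α x < 1ℝ

  value-fromℚ : ∀ α y k → seq (value Φ α (Vec.map fromℚ y)) k ≡ ev (coeffs α) y
  value-fromℚ α y k = trans (seq-value (coeffs α) (Vec.map fromℚ y) k) (cong (ev (coeffs α)) (at-fromℚ y k))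

  above-fromℚ : ∀ α y → 1ℚ ℚ.< ev (coeffs α) y → Above α (Vec.map fromℚ y)
  above-fromℚ α y = const-< 1ℝ (value Φ α (Vec.map fromℚ y)) (λ _ → refl) (value-fromℚ α y)

  below-fromℚ : ∀ α y → ev (coeffs α) y ℚ.< 1ℚ → Below α (Vec.map fromℚ y)
  below-fromℚ α y = const-< (value Φ α (Vec.map fromℚ y)) 1ℝ (value-fromℚ α y) (λ _ → refl)

  rationalPoint : (y : Vec ℚ n) → (∀ i → 0ℚ ℚ.< ev (simple i) y) →
                  (∀ α → Below α (Vec.map fromℚ y) ⊎ Above α (Vec.map fromℚ y)) → Point Φ
  rationalPoint y y>0 side = record
    { coords   = Vec.map fromℚ y
    ; dominant = positive
    ; offShi   = λ α → inj₂ (positive α) , side α }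
    where
    positive : ∀ α → 0ℝ < value Φ α (Vec.map fromℚ y)
    positive α = const-< 0ℝ (value Φ α (Vec.map fromℚ y)) (λ _ → refl) (value-fromℚ α y)
      (ev-pos (pos α) (coeffs≢0 α) y (λ i → subst (λ z → 0ℚ ℚ.< z) (ev-simple i y) (y>0 i)))

  coordinates≥0 : ∀ (p : Point Φ) → Eventually λ k → ∀ i → 0ℚ ℚ.≤ lookup (at (coords p) k) i
  coordinates≥0 p = eventually-all λ i → let (ε , ε>0 , N , h) = dominant p (simpleRoot i) in
    N , λ k k≥ → ℚₚ.≤-trans (ℚₚ.<⇒≤ ε>0) (subst₂ ℚ._≤_ (ℚₚ.+-identityˡ ε)
      (trans (seq-value (simple i) (coords p) k) (ev-simple i (at (coords p) k))) (h k k≥))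

  -- The coordinates of a dominant point are the values of the simple roots, hence eventually
  -- nonnegative, and β - α has nonnegative coefficients.
  value-mono : ∀ (p : Point Φ) {α β} → α ≼ β →
               Eventually λ k → seq (value Φ α (coords p)) k ℚ.≤ seq (value Φ β (coords p)) k
  value-mono p {α} {β} α≼β = eventually-map (λ k h →
    subst₂ ℚ._≤_ (sym (seq-value (coeffs α) (coords p) k)) (sym (seq-value (coeffs β) (coords p) k))
      (monotone (at (coords p) k) h)) (coordinates≥0 p)
    where
    monotone : ∀ x → (∀ i → 0ℚ ℚ.≤ lookup x i) → ev (coeffs α) x ℚ.≤ ev (coeffs β) x
    monotone x h = subst₂ ℚ._≤_ (ℚₚ.+-identityʳ (ev (coeffs α) x))
      (solve 2 (λ a b → a :+ (b :- a) := b) refl (ev (coeffs α) x) (ev (coeffs β) x))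
      (ℚₚ.+-monoʳ-≤ (ev (coeffs α) x) (subst (λ z → 0ℚ ℚ.≤ z) (ev-- (coeffs β) (coeffs α) x) (ev-nonNeg α≼β x h)))

  above-below-absurd : ∀ (p : Point Φ) {α β} → α ≼ β → Above α (coords p) → ¬ Below β (coords p)
  above-below-absurd p {α} {β} α≼β (ε , ε>0 , above) below = <⇒≱-eventually (value Φ β (coords p)) 1ℝ below
    (eventually-map (λ k (1+ε≤α , α≤β) → ℚₚ.≤-trans
        (subst (ℚ._≤ 1ℚ ℚ.+ ε) (ℚₚ.+-identityʳ 1ℚ) (ℚₚ.+-monoʳ-≤ 1ℚ (ℚₚ.<⇒≤ ε>0))) (ℚₚ.≤-trans 1+ε≤α α≤β))
      (eventually-× above (value-mono p {α} {β} α≼β)))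

  SameRegion : Point Φ → Point Φ → Set
  SameRegion p q = ∀ α → (Below α (coords p) × Below α (coords q)) ⊎ (Above α (coords p) × Above α (coords q))

  module Segment (p q : Point Φ) (same : SameRegion p q) where

    -- Regions are convex: along the segment every value stays positive and on the side of 1 shared
    -- by the two ends. Real parameters are allowed because the bisection limit need not be
    -- rational.
    on : Parameter → Point Φ
    on t = record
      { coords   = z
      ; dominant = positive
      ; offShi   = λ α → inj₂ (positive α) , off α (same α) }
      where
      z = mixᵛ t (coords p) (coords q)
      mixed : ∀ α → Mixed t (value Φ α (coords p)) (value Φ α (coords q)) (value Φ α z)
      mixed α k = trans (seq-value (coeffs α) z k) (trans (ev-mix t (coeffs α) (coords p) (coords q) k)
        (sym (cong₂ (λ a b → a ℚ.+ param t k ℚ.* (b ℚ.- a))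
          (seq-value (coeffs α) (coords p) k) (seq-value (coeffs α) (coords q) k))))
      positive : ∀ α → 0ℝ < value Φ α z
      positive α = mixed-> t 0ℚ (value Φ α (coords p)) (value Φ α (coords q)) (value Φ α z)
        (mixed α) (dominant p α) (dominant q α)
      off : ∀ α → _ → value Φ α z # 1ℝ
      off α (inj₁ (a , b)) = inj₁ (mixed-< t 1ℚ (value Φ α (coords p)) (value Φ α (coords q)) (value Φ α z) (mixed α) a b)
      off α (inj₂ (a , b)) = inj₂ (mixed-> t 1ℚ (value Φ α (coords p)) (value Φ α (coords q)) (value Φ α z) (mixed α) a b)

    module _ (f : LocConst Φ) (fp≢fq : fun f p ≢ fun f q) where

      agree : ∀ (r s : Point Φ) → (∀ i k → seq (lookup (coords r) i) k ≡ seq (lookup (coords s) i) k) →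
              fun f r ≡ fun f s
      agree r s h = let (ε , ε>0 , constant-near) = locConst f r in
        constant-near s (near-≡ ε>0 (coords r) (coords s) h)

      value-at : ∀ s → 0ℚ ℚ.≤ s → s ℚ.≤ 1ℚ → ℤ
      value-at s 0≤s s≤1 = fun f (on (constant s 0≤s s≤1))

      -- The state of the bisection: f still has its value at p at `lo` and no longer has it at
      -- `hi`. Equality in ℤ is decidable, so the value at the midpoint tells which half to keep.
      record Bracket (k : ℕ) : Set where
        field
          lo hi   : ℚ
          0≤lo    : 0ℚ ℚ.≤ lo
          lo≤hi   : lo ℚ.≤ hi
          hi≤1    : hi ℚ.≤ 1ℚ
          width   : hi ℚ.- lo ℚ.≤ halving k
        lo≤1 : lo ℚ.≤ 1ℚ
        lo≤1 = ℚₚ.≤-trans lo≤hi hi≤1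
        0≤hi : 0ℚ ℚ.≤ hi
        0≤hi = ℚₚ.≤-trans 0≤lo lo≤hi
        field
          at-lo   : value-at lo 0≤lo lo≤1 ≡ fun f p
          at-hi   : value-at hi 0≤hi hi≤1 ≢ fun f p
      open Bracket

      end-coordinate : ∀ t (x y : Vec ℝ n) i k → seq (lookup (mixᵛ t x y) i) k ≡
                       seq (lookup x i) k ℚ.+ param t k ℚ.* (seq (lookup y i) k ℚ.- seq (lookup x i) k)
      end-coordinate t x y = over x y
        where
        over : ∀ {m} (x y : Vec ℝ m) i k → seq (lookup (mixᵛ t x y) i) k ≡
               seq (lookup x i) k ℚ.+ param t k ℚ.* (seq (lookup y i) k ℚ.- seq (lookup x i) k)
        over (a ∷ x) (b ∷ y) zero    k = seq-mix t a b k
        over (a ∷ x) (b ∷ y) (suc i) k = over x y i k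

      initial : Bracket 0
      initial = record
        { lo = 0ℚ ; hi = 1ℚ ; 0≤lo = ℚₚ.≤-refl ; lo≤hi = 0≤1 ; hi≤1 = ℚₚ.≤-refl ; width = ℚₚ.≤-refl
        ; at-lo = agree (on (constant 0ℚ _ _)) p (λ i k → trans (end-coordinate _ (coords p) (coords q) i k)
            (trans (cong (λ z → seq (lookup (coords p) i) k ℚ.+ z) (ℚₚ.*-zeroˡ (seq (lookup (coords q) i) k ℚ.- seq (lookup (coords p) i) k))) (ℚₚ.+-identityʳ (seq (lookup (coords p) i) k))))
        ; at-hi = λ e → fp≢fq (trans (sym e) (agree (on (constant 1ℚ _ _)) q
            (λ i k → trans (end-coordinate _ (coords p) (coords q) i k)
              (trans (cong (λ z → seq (lookup (coords p) i) k ℚ.+ z) (ℚₚ.*-identityˡ (seq (lookup (coords q) i) k ℚ.- seq (lookup (coords p) i) k)))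
                (solve 2 (λ a b → a :+ (b :- a) := b) refl (seq (lookup (coords p) i) k) (seq (lookup (coords q) i) k)))))) }
        where
        0≤1 : 0ℚ ℚ.≤ 1ℚ
        0≤1 = ℚₚ.<⇒≤ (ℚₚ.positive⁻¹ 1ℚ)

      -- Bounds on s are stored in the point, so other proofs give another argument of f; local
      -- constancy absorbs the difference.
      value-at-irrelevant : ∀ s {a b a′ b′} → value-at s a b ≡ value-at s a′ b′
      value-at-irrelevant s {a} {b} {a′} {b′} = agree (on (constant s a b)) (on (constant s a′ b′)) λ i k →
        trans (end-coordinate (constant s a b) (coords p) (coords q) i k)
          (sym (end-coordinate (constant s a′ b′) (coords p) (coords q) i k))

      Inside : ∀ {k} → Bracket k → Bracket (suc k) → Set
      Inside s s′ = lo s ℚ.≤ lo s′ × hi s′ ℚ.≤ hi s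

      bisect : ∀ {k} (s : Bracket k) → ∃[ s′ ] Inside s s′
      bisect {k} s = cases (value-at mid 0≤mid mid≤1 ℤₚ.≟ fun f p)
        where
        mid   = ½ ℚ.* (lo s ℚ.+ hi s)
        lo≤mid : lo s ℚ.≤ mid
        lo≤mid = midpoint≥ (lo≤hi s)
        mid≤hi : mid ℚ.≤ hi s
        mid≤hi = midpoint≤ (lo≤hi s)
        mid≤1 : mid ℚ.≤ 1ℚ
        mid≤1 = ℚₚ.≤-trans mid≤hi (hi≤1 s)
        0≤mid : 0ℚ ℚ.≤ mid
        0≤mid = ℚₚ.≤-trans (0≤lo s) lo≤mid
        half-width : ½ ℚ.* (hi s ℚ.- lo s) ℚ.≤ halving (suc k)
        half-width = ℚₚ.*-monoˡ-≤-nonNeg ½ (width s)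
        upper-half : ∀ a b → ½ ℚ.* (b ℚ.- a) ≡ b ℚ.- ½ ℚ.* (a ℚ.+ b)
        upper-half a b = trans (solve 3 (λ h a b → h :* (b :- a) := (h :* b :+ h :* b) :- h :* (a :+ b)) refl ½ a b)
          (cong (ℚ._- ½ ℚ.* (a ℚ.+ b)) (half+half b))
        lower-half : ∀ a b → ½ ℚ.* (b ℚ.- a) ≡ ½ ℚ.* (a ℚ.+ b) ℚ.- a
        lower-half a b = trans (solve 3 (λ h a b → h :* (b :- a) := h :* (a :+ b) :- (h :* a :+ h :* a)) refl ½ a b)
          (cong (λ z → ½ ℚ.* (a ℚ.+ b) ℚ.- z) (half+half a))
        cases : Dec (value-at mid 0≤mid mid≤1 ≡ fun f p) → ∃[ s′ ] Inside s s′
        cases (yes e) = record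
          { lo = mid ; hi = hi s ; 0≤lo = 0≤mid ; lo≤hi = mid≤hi ; hi≤1 = hi≤1 s
          ; width = subst (ℚ._≤ halving (suc k)) (upper-half (lo s) (hi s)) half-width
          ; at-lo = trans (value-at-irrelevant mid) e
          ; at-hi = at-hi s ∘ trans (value-at-irrelevant (hi s)) } , lo≤mid , ℚₚ.≤-refl
        cases (no ¬e) = record
          { lo = lo s ; hi = mid ; 0≤lo = 0≤lo s ; lo≤hi = lo≤mid ; hi≤1 = mid≤1
          ; width = subst (ℚ._≤ halving (suc k)) (lower-half (lo s) (hi s)) half-width
          ; at-lo = trans (value-at-irrelevant (lo s)) (at-lo s)
          ; at-hi = ¬e ∘ trans (value-at-irrelevant mid) } , ℚₚ.≤-refl , mid≤hi

      bracket : ∀ k → Bracket k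
      bracket zero    = initial
      bracket (suc k) = proj₁ (bisect (bracket k))

      nested : ∀ k j → lo (bracket k) ℚ.≤ lo (bracket (j ℕ.+ k)) × hi (bracket (j ℕ.+ k)) ℚ.≤ hi (bracket k)
      nested k zero    = ℚₚ.≤-refl , ℚₚ.≤-refl
      nested k (suc j) = let (a , b) = nested k j ; (c , d) = proj₂ (bisect (bracket (j ℕ.+ k))) in
        ℚₚ.≤-trans a c , ℚₚ.≤-trans d b

      lo∈bracket : ∀ {k m} → k ℕ.≤ m → lo (bracket k) ℚ.≤ lo (bracket m) × lo (bracket m) ℚ.≤ hi (bracket k)
      lo∈bracket {k} {m} k≤m = subst (λ m → lo (bracket k) ℚ.≤ lo (bracket m) × lo (bracket m) ℚ.≤ hi (bracket k))
        (ℕₚ.m∸n+n≡m k≤m) (proj₁ (nested k (m ℕ.∸ k)) ,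
          ℚₚ.≤-trans (lo≤hi (bracket (m ℕ.∸ k ℕ.+ k))) (proj₂ (nested k (m ℕ.∸ k))))

      within-bracket : ∀ k {a b} → lo (bracket k) ℚ.≤ a × a ℚ.≤ hi (bracket k) →
                       lo (bracket k) ℚ.≤ b × b ℚ.≤ hi (bracket k) → ℚ.∣ a ℚ.- b ∣ ℚ.≤ halving k
      within-bracket k {a} {b} (l≤a , a≤h) (l≤b , b≤h) = ℚₚ.≤-trans
        (∣∣-bounds (ℚₚ.+-mono-≤ a≤h (ℚₚ.neg-antimono-≤ l≤b))
          (subst (ℚ._≤ hi (bracket k) ℚ.- lo (bracket k)) (sym (+-Group.⁻¹-anti-homo‿- a b))
            (ℚₚ.+-mono-≤ b≤h (ℚₚ.neg-antimono-≤ l≤a))))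
        (width (bracket k))

      -- The lower ends are Cauchy because all later ones lie in the N-th bracket, of width at most
      -- 2^(-N).
      limit : Parameter
      limit = record
        { param   = λ k → lo (bracket k)
        ; pcauchy = λ ε ε>0 → let (N , small) = halving-small ε>0 in N , λ m n m≥ n≥ →
            ℚₚ.≤-<-trans (within-bracket N (lo∈bracket m≥) (lo∈bracket n≥)) small
        ; 0≤param = λ k → 0≤lo (bracket k)
        ; param≤1 = λ k → lo≤1 (bracket k) }

      -- f is constant near the limit point, and for large K both ends of the K-th bracket lie in
      -- that neighbourhood, although f separates them.
      impossible : ⊥
      impossible =
        let (ε , ε>0 , constant-near) = locConst f (on limit)
            (η , η>0 , near)          = near-mix (coords p) (coords q) ε>0
            (K , small)               = halving-small η>0
            s                         = bracket K
            at-limit : ∀ r a b → lo s ℚ.≤ r × r ℚ.≤ hi s → fun f (on limit) ≡ value-at r a b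
            at-limit = λ r a b r∈ → constant-near (on (constant r a b))
              (near limit (constant r a b) (K , λ n n≥ → ℚₚ.≤-<-trans (within-bracket K (lo∈bracket n≥) r∈) small))
        in at-hi s (trans (sym (at-limit (hi s) (0≤hi s) (hi≤1 s) (lo≤hi s , ℚₚ.≤-refl)))
             (trans (at-limit (lo s) (0≤lo s) (lo≤1 s) (ℚₚ.≤-refl , lo≤hi s)) (at-lo s)))

  constant-on-regions : ∀ (f : LocConst Φ) p q → SameRegion p q → fun f p ≡ fun f q
  constant-on-regions f p q same with fun f p ℤₚ.≟ fun f q
  ... | yes e  = e
  ... | no  ¬e = ⊥-elim (Segment.impossible p q same f ¬e)

-- The canonical map from ℤ to a commutative ring.

module IntegerImage (R : CommutativeRing 0ℓ 0ℓ) where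
  open CommutativeRing R renaming (_+_ to _+ᴿ_; _*_ to _*ᴿ_; -_ to -ᴿ_; refl to ≈-refl; sym to ≈-sym; trans to ≈-trans; zero to *-zero)
  open RingProperties ring
  open Mult +-monoid renaming (_×_ to _·ᴿ_)
  open AGroupProperties +-abelianGroup using (⁻¹-∙-comm; ε⁻¹≈ε; ⁻¹-involutive)
  open SetoidReasoning setoid

  ⟦_⟧ : ℤ → Carrier
  ⟦ + k ⟧      = k ·ᴿ 1#
  ⟦ -[1+ k ] ⟧ = -ᴿ (suc k ·ᴿ 1#)

  ⟦⟧-cong : ∀ {i j} → i ≡ j → ⟦ i ⟧ ≈ ⟦ j ⟧
  ⟦⟧-cong refl = ≈-refl

  cancel-1 : ∀ x y → (1# +ᴿ x) +ᴿ (-ᴿ (1# +ᴿ y)) ≈ x +ᴿ (-ᴿ y)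
  cancel-1 x y = begin
    (1# +ᴿ x) +ᴿ (-ᴿ (1# +ᴿ y))        ≈⟨ +-congˡ (⁻¹-∙-comm 1# y) ⟨
    (1# +ᴿ x) +ᴿ ((-ᴿ 1#) +ᴿ (-ᴿ y))   ≈⟨ CSemigroupProperties.interchange (CommutativeMonoid.commutativeSemigroup +-commutativeMonoid) 1# x (-ᴿ 1#) (-ᴿ y) ⟩
    (1# +ᴿ (-ᴿ 1#)) +ᴿ (x +ᴿ (-ᴿ y))   ≈⟨ +-congʳ (-‿inverseʳ 1#) ⟩
    0# +ᴿ (x +ᴿ (-ᴿ y))                ≈⟨ +-identityˡ _ ⟩
    x +ᴿ (-ᴿ y)                        ∎

  -- Integer addition of opposite signs computes through `⊖`; this is the case to which additivity
  -- reduces.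
  ⟦⟧-⊖ : ∀ m k → ⟦ m ℤ.⊖ k ⟧ ≈ m ·ᴿ 1# +ᴿ (-ᴿ (k ·ᴿ 1#))
  ⟦⟧-⊖ zero    zero    = ≈-sym (-‿inverseʳ 0#)
  ⟦⟧-⊖ zero    (suc k) = ≈-sym (+-identityˡ _)
  ⟦⟧-⊖ (suc m) zero    = ≈-sym (≈-trans (+-congˡ ε⁻¹≈ε) (+-identityʳ _))
  ⟦⟧-⊖ (suc m) (suc k) = begin
    ⟦ suc m ℤ.⊖ suc k ⟧                       ≈⟨ ⟦⟧-cong (ℤₚ.[1+m]⊖[1+n]≡m⊖n m k) ⟩
    ⟦ m ℤ.⊖ k ⟧                               ≈⟨ ⟦⟧-⊖ m k ⟩
    m ·ᴿ 1# +ᴿ (-ᴿ (k ·ᴿ 1#))                 ≈⟨ cancel-1 (m ·ᴿ 1#) (k ·ᴿ 1#) ⟨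
    suc m ·ᴿ 1# +ᴿ (-ᴿ (suc k ·ᴿ 1#))         ∎

  ⟦⟧-+ : ∀ i j → ⟦ i ℤ.+ j ⟧ ≈ ⟦ i ⟧ +ᴿ ⟦ j ⟧
  ⟦⟧-+ (+ m)      (+ k)      = ×-homo-+ 1# m k
  ⟦⟧-+ (+ m)      -[1+ k ]   = ⟦⟧-⊖ m (suc k)
  ⟦⟧-+ -[1+ m ]   (+ k)      = ≈-trans (⟦⟧-⊖ k (suc m)) (+-comm _ _)
  ⟦⟧-+ -[1+ m ]   -[1+ k ]   = begin
    -ᴿ (1# +ᴿ (1# +ᴿ (m ℕ.+ k) ·ᴿ 1#))        ≈⟨ -‿cong (+-congˡ (+-congˡ (×-homo-+ 1# m k))) ⟩
    -ᴿ (1# +ᴿ (1# +ᴿ (m ·ᴿ 1# +ᴿ k ·ᴿ 1#)))   ≈⟨ -‿cong (+-congˡ (≈-trans (≈-sym (+-assoc _ _ _)) (≈-trans (+-congʳ (+-comm _ _)) (+-assoc _ _ _)))) ⟩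
    -ᴿ (1# +ᴿ (m ·ᴿ 1# +ᴿ (1# +ᴿ k ·ᴿ 1#)))   ≈⟨ -‿cong (+-assoc _ _ _) ⟨
    -ᴿ (suc m ·ᴿ 1# +ᴿ suc k ·ᴿ 1#)           ≈⟨ ⁻¹-∙-comm _ _ ⟨
    ⟦ -[1+ m ] ⟧ +ᴿ ⟦ -[1+ k ] ⟧              ∎

  ⟦⟧-neg : ∀ i → ⟦ ℤ.- i ⟧ ≈ -ᴿ ⟦ i ⟧
  ⟦⟧-neg (+ zero)  = ≈-sym ε⁻¹≈ε
  ⟦⟧-neg (+ suc k) = ≈-refl
  ⟦⟧-neg -[1+ k ]  = ≈-sym (⁻¹-involutive _)

  ⟦⟧-*-natural : ∀ k j → ⟦ + k ℤ.* j ⟧ ≈ ⟦ + k ⟧ *ᴿ ⟦ j ⟧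
  ⟦⟧-*-natural zero    j = ≈-trans (⟦⟧-cong (ℤₚ.*-zeroˡ j)) (≈-sym (zeroˡ _))
  ⟦⟧-*-natural (suc k) j = begin
    ⟦ + suc k ℤ.* j ⟧               ≈⟨ ⟦⟧-cong (ℤₚ.suc-* (+ k) j) ⟩
    ⟦ j ℤ.+ + k ℤ.* j ⟧             ≈⟨ ⟦⟧-+ j (+ k ℤ.* j) ⟩
    ⟦ j ⟧ +ᴿ ⟦ + k ℤ.* j ⟧          ≈⟨ +-cong (≈-sym (*-identityˡ _)) (⟦⟧-*-natural k j) ⟩
    1# *ᴿ ⟦ j ⟧ +ᴿ ⟦ + k ⟧ *ᴿ ⟦ j ⟧ ≈⟨ distribʳ _ _ _ ⟨
    ⟦ + suc k ⟧ *ᴿ ⟦ j ⟧            ∎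

  ⟦⟧-* : ∀ i j → ⟦ i ℤ.* j ⟧ ≈ ⟦ i ⟧ *ᴿ ⟦ j ⟧
  ⟦⟧-* (+ k)     j = ⟦⟧-*-natural k j
  ⟦⟧-* -[1+ k ]  j = begin
    ⟦ -[1+ k ] ℤ.* j ⟧         ≈⟨ ⟦⟧-cong (ℤₚ.neg-distribˡ-* (+ suc k) j) ⟨
    ⟦ ℤ.- (+ suc k ℤ.* j) ⟧    ≈⟨ ⟦⟧-neg (+ suc k ℤ.* j) ⟩
    -ᴿ ⟦ + suc k ℤ.* j ⟧       ≈⟨ -‿cong (⟦⟧-*-natural (suc k) j) ⟩
    -ᴿ (⟦ + suc k ⟧ *ᴿ ⟦ j ⟧)  ≈⟨ -‿distribˡ-* _ _ ⟩
    ⟦ -[1+ k ] ⟧ *ᴿ ⟦ j ⟧      ∎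

-- Ring morphisms that match the generators of two filtrations.

module FiltrationMap (R S : CommutativeRing 0ℓ 0ℓ) where
  private
    module R = CommutativeRing R
    module S = CommutativeRing S
  open RingMorphisms R.rawRing S.rawRing

  module _ {f : R.Carrier → S.Carrier} (hom : IsRingHomomorphism f)
           {I : Set} (g : I → R.Carrier) (g′ : I → S.Carrier) (f-g : ∀ i → f (g i) S.≈ g′ i) where
    open IsRingHomomorphism hom

    span-map : ∀ {P Q} → (∀ {x} → P x → Span S Q (f x)) → ∀ {x} → Span R P x → Span S Q (f x)
    span-map h (gen p)     = h p
    span-map h zeroₛ       = respₛ (S.sym 0#-homo) zeroₛ
    span-map h (addₛ p q)  = respₛ (S.sym (+-homo _ _)) (addₛ (span-map h p) (span-map h q))
    span-map h (negₛ p)    = respₛ (S.sym (-‿homo _)) (negₛ (span-map h p))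
    span-map h (respₛ e p) = respₛ (⟦⟧-cong e) (span-map h p)

    Lifts : (R.Carrier → Set) → S.Carrier → Set
    Lifts P y = ∃[ x ] P x × f x S.≈ y

    span-lift : ∀ {P Q} → (∀ {y} → Q y → Lifts (Span R P) y) → ∀ {y} → Span S Q y → Lifts (Span R P) y
    span-lift h (gen q)     = h q
    span-lift h zeroₛ       = R.0# , zeroₛ , 0#-homo
    span-lift h (addₛ p q)  = let (a , a∈ , ea) = span-lift h p ; (b , b∈ , eb) = span-lift h q in
      a R.+ b , addₛ a∈ b∈ , S.trans (+-homo a b) (S.+-cong ea eb)
    span-lift h (negₛ p)    = let (a , a∈ , ea) = span-lift h p in
      R.- a , negₛ a∈ , S.trans (-‿homo a) (S.-‿cong ea)
    span-lift h (respₛ e p) = let (a , a∈ , ea) = span-lift h p in a , a∈ , S.trans ea e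

    product-map : ∀ {k} (v : Vec R.Carrier k) → f (product R v) S.≈ product S (Vec.map f v)
    product-map []      = 1#-homo
    product-map (x ∷ v) = S.trans (*-homo x (product R v)) (S.*-congˡ (product-map v))

    generator-map : ∀ {x} → OneOrGen R g x → Span S (OneOrGen S g′) (f x)
    generator-map (inj₁ e)       = gen (inj₁ (S.trans (⟦⟧-cong e) 1#-homo))
    generator-map (inj₂ (i , e)) = gen (inj₂ (i , S.trans (⟦⟧-cong e) (f-g i)))

    generator-lift : ∀ {y} → OneOrGen S g′ y → Lifts (Span R (OneOrGen R g)) y
    generator-lift (inj₁ e)       = R.1# , gen (inj₁ R.refl) , S.trans 1#-homo (S.sym e)
    generator-lift (inj₂ (i , e)) = g i , gen (inj₂ (i , R.refl)) , S.trans (f-g i) (S.sym e)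

    products-map : ∀ {k x} → Products R k (Span R (OneOrGen R g)) x → Span S (Products S k (Span S (OneOrGen S g′))) (f x)
    products-map (v , v∈ , e) = gen (Vec.map f v , all v∈ , S.trans (⟦⟧-cong e) (product-map v))
      where
      all : ∀ {k} {v : Vec R.Carrier k} → VecAll.All (Span R (OneOrGen R g)) v →
            VecAll.All (Span S (OneOrGen S g′)) (Vec.map f v)
      all VecAll.[]       = VecAll.[]
      all (p VecAll.∷ ps) = span-map generator-map p VecAll.∷ all ps

    products-lift : ∀ {k y} → Products S k (Span S (OneOrGen S g′)) y → Lifts (Span R (Products R k (Span R (OneOrGen R g)))) y
    products-lift (v , v∈ , e) = let (w , w∈ , ew) = all v∈ in
      product R w , gen (w , w∈ , R.refl) , S.trans ew (S.sym e)
      where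
      all : ∀ {k} {v : Vec S.Carrier k} → VecAll.All (Span S (OneOrGen S g′)) v →
            ∃[ w ] VecAll.All (Span R (OneOrGen R g)) {k} w × f (product R w) S.≈ product S v
      all VecAll.[]       = [] , VecAll.[] , 1#-homo
      all (p VecAll.∷ ps) = let (a , a∈ , ea) = span-lift generator-lift p ; (w , w∈ , ew) = all ps in
        a ∷ w , a∈ VecAll.∷ w∈ , S.trans (*-homo a (product R w)) (S.*-cong ea ew)

    filtration-map : ∀ k {x} → filtration R g k x → filtration S g′ k (f x)
    filtration-map 0             = span-map (λ e → gen (S.trans (⟦⟧-cong e) 1#-homo))
    filtration-map 1             = span-map generator-map
    filtration-map (suc (suc k)) = span-map products-map

    filtration-lift : ∀ k {y} → filtration S g′ k y → Lifts (filtration R g k) y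
    filtration-lift 0             = span-lift (λ e → R.1# , gen R.refl , S.trans 1#-homo (S.sym e))
    filtration-lift 1             = span-lift generator-lift
    filtration-lift (suc (suc k)) = span-lift products-lift

    filtration-resp : ∀ k {x y} → x S.≈ y → filtration S g′ k x → filtration S g′ k y
    filtration-resp 0             = respₛ
    filtration-resp 1             = respₛ
    filtration-resp (suc (suc k)) = respₛ

    -- Every layer is a span of 1, of 1 and the generators, or of products of elements of the latter
    -- span. Preimages are assembled summand by summand and factor by factor from those of 1 and the
    -- generators.
    filtration-image : ∀ k y → filtration S g′ k y ⇔ Lifts (filtration R g k) y
    filtration-image k y = mk⇔ (filtration-lift k) λ (x , x∈ , e) → filtration-resp k e (filtration-map k x∈)

-- The morphism ρ: existence and uniqueness.

module Isomorphism {n} {X : Dynkin n} (Φ : RootSystem X) where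
  open RootSystem Φ
  open PosRoot
  open Descent Φ using (Incomparable)
  open Separation Φ
  open Regions Φ
  open Presentation (URel Φ)
  private
    module U = CommutativeRing (URing Φ)
    module H = CommutativeRing (HRing Φ)

  ρ : Expr PosRoot → LocConst Φ
  ρ (var α) = h Φ α
  ρ 𝟘       = H.0#
  ρ 𝟙       = H.1#
  ρ (s ⊕ t) = ρ s H.+ ρ t
  ρ (s ⊗ t) = ρ s H.* ρ t
  ρ (⊖ s)   = H.- ρ s

  ≼-reflexive : ∀ {α β} → coeffs α ≡ coeffs β → α ≼ β
  ≼-reflexive {α} e = subst (λ v → NonNeg (v -ᵛ coeffs α)) e (subst NonNeg (sym (-ᵛ-inverse (coeffs α))) nonNeg-0)

  _≼?_ : ∀ α β → Dec (α ≼ β)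
  α ≼? β = VecAll.all? (0ℤ ℤₚ.≤?_) (coeffs β -ᵛ coeffs α)

  h-values : ∀ α x → (fun (h Φ α) x ≡ 0ℤ × Below α (coords x)) ⊎ (fun (h Φ α) x ≡ 1ℤ × Above α (coords x))
  h-values α x with proj₂ (offShi x α)
  ... | inj₁ below = inj₁ (refl , below)
  ... | inj₂ above = inj₂ (refl , above)

  h-above : ∀ α x → Above α (coords x) → fun (h Φ α) x ≡ 1ℤ
  h-above α x above with h-values α x
  ... | inj₁ (_ , below) = ⊥-elim (above-below-absurd x {α} {α} (≼-reflexive {α} {α} refl) above below)
  ... | inj₂ (e , _)     = e

  h-below : ∀ α x → Below α (coords x) → fun (h Φ α) x ≡ 0ℤ
  h-below α x below with h-values α x
  ... | inj₁ (e , _)     = e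
  ... | inj₂ (_ , above) = ⊥-elim (above-below-absurd x {α} {α} (≼-reflexive {α} {α} refl) above below)

  h-min : ∀ {α β} → α ≼ β → ∀ x → fun (h Φ α) x ℤ.* fun (h Φ β) x ≡ fun (h Φ α) x
  h-min {α} {β} α≼β x = cases (h-values α x) (h-values β x)
    where
    cases : _ → _ → fun (h Φ α) x ℤ.* fun (h Φ β) x ≡ fun (h Φ α) x
    cases (inj₁ (e , _))     _                  = trans (cong (ℤ._* fun (h Φ β) x) e) (trans (ℤₚ.*-zeroˡ (fun (h Φ β) x)) (sym e))
    cases (inj₂ _)           (inj₂ (e , _))     = trans (cong (fun (h Φ α) x ℤ.*_) e) (ℤₚ.*-identityʳ (fun (h Φ α) x))
    cases (inj₂ (_ , above)) (inj₁ (_ , below)) = ⊥-elim (above-below-absurd x {α} {β} α≼β above below)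

  ρ-cong : ∀ {s t} → s ≈ t → ∀ x → fun (ρ s) x ≡ fun (ρ t) x
  ρ-cong (rel (minˡ {α} {β} α≼β)) x = h-min {α} {β} α≼β x
  ρ-cong (rel (minʳ {α} {β} β≼α)) x = trans (ℤₚ.*-comm (fun (h Φ α) x) (fun (h Φ β) x)) (h-min {β} {α} β≼α x)
  ρ-cong ≈-refl           x = refl
  ρ-cong (≈-sym p)        x = sym (ρ-cong p x)
  ρ-cong (≈-trans p q)    x = trans (ρ-cong p x) (ρ-cong q x)
  ρ-cong (⊕-cong p q)     x = cong₂ ℤ._+_ (ρ-cong p x) (ρ-cong q x)
  ρ-cong (⊗-cong p q)     x = cong₂ ℤ._*_ (ρ-cong p x) (ρ-cong q x)
  ρ-cong (⊖-cong p)       x = cong (λ z → ℤ.- z) (ρ-cong p x)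
  ρ-cong (⊕-assoc s t r)  x = ℤₚ.+-assoc (fun (ρ s) x) (fun (ρ t) x) (fun (ρ r) x)
  ρ-cong (⊕-comm s t)     x = ℤₚ.+-comm (fun (ρ s) x) (fun (ρ t) x)
  ρ-cong (⊕-identityˡ s)  x = ℤₚ.+-identityˡ (fun (ρ s) x)
  ρ-cong (⊖-inverseˡ s)   x = ℤₚ.+-inverseˡ (fun (ρ s) x)
  ρ-cong (⊗-assoc s t r)  x = ℤₚ.*-assoc (fun (ρ s) x) (fun (ρ t) x) (fun (ρ r) x)
  ρ-cong (⊗-comm s t)     x = ℤₚ.*-comm (fun (ρ s) x) (fun (ρ t) x)
  ρ-cong (⊗-identityˡ s)  x = ℤₚ.*-identityˡ (fun (ρ s) x)
  ρ-cong (distribˡ s t r) x = ℤₚ.*-distribˡ-+ (fun (ρ s) x) (fun (ρ t) x) (fun (ρ r) x)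

  open RingMorphisms U.rawRing H.rawRing

  ρ-homomorphism : IsRingHomomorphism ρ
  ρ-homomorphism = record
    { isSemiringHomomorphism = record
      { isNearSemiringHomomorphism = record
        { +-isMonoidHomomorphism = record
          { isMagmaHomomorphism = record
            { isRelHomomorphism = record { cong = ρ-cong }
            ; homo = λ _ _ _ → refl }
          ; ε-homo = λ _ → refl }
        ; *-homo = λ _ _ _ → refl }
      ; 1#-homo = λ _ → refl }
    ; -‿homo = λ _ _ → refl }

  ρ-unique : ∀ (σ : Expr PosRoot → LocConst Φ) → IsRingHomomorphism σ →
             (∀ α x → fun (σ (var α)) x ≡ fun (h Φ α) x) → ∀ a x → fun (σ a) x ≡ fun (ρ a) x
  ρ-unique σ hom σ-u = go
    where
    open IsRingHomomorphism hom
    go : ∀ a x → fun (σ a) x ≡ fun (ρ a) x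
    go (var α) x = σ-u α x
    go 𝟘       x = 0#-homo x
    go 𝟙       x = 1#-homo x
    go (s ⊕ t) x = trans (+-homo s t x) (cong₂ ℤ._+_ (go s x) (go t x))
    go (s ⊗ t) x = trans (*-homo s t x) (cong₂ ℤ._*_ (go s x) (go t x))
    go (⊖ s)   x = trans (-‿homo s x) (cong (λ z → ℤ.- z) (go s x))

  -- Surjectivity of ρ by expansion over the positive roots.

  collect : ∀ xs → (∀ {v} → v ∈ xs → v ∈ roots) → List PosRoot
  collect []       _  = []
  collect (v ∷ xs) v∈ with VecAll.all? (0ℤ ℤₚ.≤?_) v
  ... | yes v≥0 = record { coeffs = v ; root = v∈ (here refl) ; pos = v≥0 } ∷ collect xs (v∈ ∘ there)
  ... | no  _   = collect xs (v∈ ∘ there)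

  collect-complete : ∀ xs (v∈ : ∀ {v} → v ∈ xs → v ∈ roots) α → coeffs α ∈ xs → ∃[ β ] β ∈ collect xs v∈ × coeffs β ≡ coeffs α
  collect-complete (v ∷ xs) v∈ α (here e) with VecAll.all? (0ℤ ℤₚ.≤?_) v
  ... | yes v≥0 = _ , here refl , sym e
  ... | no  v≱0 = ⊥-elim (v≱0 (subst NonNeg e (pos α)))
  collect-complete (v ∷ xs) v∈ α (there p) with VecAll.all? (0ℤ ℤₚ.≤?_) v
  ... | yes _ = let (β , β∈ , e) = collect-complete xs (v∈ ∘ there) α p in β , there β∈ , e
  ... | no  _ = collect-complete xs (v∈ ∘ there) α p

  positiveRoots : List PosRoot
  positiveRoots = collect roots (λ {_} v∈ → v∈)

  -- The bookkeeping invariant of the case split: every positive root is undecided, in `ins` or in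
  -- `outs`. It holds up to coefficients, because a `PosRoot` carries proofs and need not occur
  -- literally in the enumeration.
  Covered : List PosRoot → List PosRoot → List PosRoot → Set
  Covered rest ins outs = ∀ α → ∃[ β ] coeffs β ≡ coeffs α × (β ∈ rest ⊎ β ∈ ins ⊎ β ∈ outs)

  covered-all : Covered positiveRoots [] []
  covered-all α = let (β , β∈ , e) = collect-complete roots (λ {_} v∈ → v∈) α (root α) in β , e , inj₁ β∈

  covered-in : ∀ {α rest ins outs} → Covered (α ∷ rest) ins outs → Covered rest (α ∷ ins) outs
  covered-in cov γ with cov γ
  ... | β , e , inj₁ (here refl)  = β , e , inj₂ (inj₁ (here refl))
  ... | β , e , inj₁ (there β∈)   = β , e , inj₁ β∈
  ... | β , e , inj₂ (inj₁ β∈)    = β , e , inj₂ (inj₁ (there β∈))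
  ... | β , e , inj₂ (inj₂ β∈)    = β , e , inj₂ (inj₂ β∈)

  covered-out : ∀ {α rest ins outs} → Covered (α ∷ rest) ins outs → Covered rest ins (α ∷ outs)
  covered-out cov γ with cov γ
  ... | β , e , inj₁ (here refl)  = β , e , inj₂ (inj₂ (here refl))
  ... | β , e , inj₁ (there β∈)   = β , e , inj₁ β∈
  ... | β , e , inj₂ (inj₁ β∈)    = β , e , inj₂ (inj₁ β∈)
  ... | β , e , inj₂ (inj₂ β∈)    = β , e , inj₂ (inj₂ (there β∈))

  Side : List PosRoot → List PosRoot → Point Φ → Set
  Side ins outs x = (∀ α → α ∈ ins → Above α (coords x)) × (∀ β → β ∈ outs → Below β (coords x))

  side-of : ∀ {ins outs} → Covered [] ins outs → (y : Vec ℝ n) →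
            (∀ α → α ∈ ins → Above α y) → (∀ β → β ∈ outs → Below β y) → ∀ α → Below α y ⊎ Above α y
  side-of cov y above below α with cov α
  ... | β , e , inj₂ (inj₁ β∈) = inj₂ (subst (λ c → 1ℝ < c ⟨ y ⟩) e (above β β∈))
  ... | β , e , inj₂ (inj₂ β∈) = inj₁ (subst (λ c → c ⟨ y ⟩ < 1ℝ) e (below β β∈))

  regionPoint : ∀ {ins outs} → Covered [] ins outs → Incomparable ins outs → ∃[ x ] Side ins outs x
  regionPoint {ins} {outs} cov inc =
    rationalPoint y (Separator.simple>0 sep) (side-of cov (Vec.map fromℚ y) above below) , above , below
    where
    y   = proj₁ (separator ins outs inc)
    sep = proj₂ (separator ins outs inc)
    above : ∀ α → α ∈ ins → Above α (Vec.map fromℚ y)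
    above α α∈ = above-fromℚ α y (Separator.in>1 sep α∈)
    below : ∀ β → β ∈ outs → Below β (Vec.map fromℚ y)
    below β β∈ = below-fromℚ β y (Separator.out<1 sep β∈)

  Comparable : List PosRoot → List PosRoot → Set
  Comparable ins outs = ∃[ α ] ∃[ β ] α ∈ ins × β ∈ outs × α ≼ β

  comparable? : ∀ ins outs → Comparable ins outs ⊎ Incomparable ins outs
  comparable? ins outs with any? (λ β → any? (λ α → α ≼? β) ins) outs
  ... | yes p = let (β , β∈ , q) = find p ; (α , α∈ , r) = find q in inj₁ (α , β , α∈ , β∈ , r)
  ... | no ¬p = inj₂ (All.map (λ {β} → Allₚ.¬Any⇒All¬ ins) (Allₚ.¬Any⇒All¬ outs ¬p))

  same-side : ∀ {ins outs} → Covered [] ins outs → ∀ x y → Side ins outs x → Side ins outs y → SameRegion x y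
  same-side cov x y (x-in , x-out) (y-in , y-out) α with cov α
  ... | β , e , inj₂ (inj₁ β∈) = inj₂ (subst (λ c → 1ℝ < c ⟨ coords x ⟩) e (x-in β β∈) , subst (λ c → 1ℝ < c ⟨ coords y ⟩) e (y-in β β∈))
  ... | β , e , inj₂ (inj₂ β∈) = inj₁ (subst (λ c → c ⟨ coords x ⟩ < 1ℝ) e (x-out β β∈) , subst (λ c → c ⟨ coords y ⟩ < 1ℝ) e (y-out β β∈))

  open IntegerImage (URing Φ)

  ρ-⟦⟧ : ∀ i x → fun (ρ ⟦ i ⟧) x ≡ i
  ρ-⟦⟧ (+ k)    x = natural k
    where
    natural : ∀ k → fun (ρ ⟦ + k ⟧) x ≡ + k
    natural zero    = refl
    natural (suc k) = cong (ℤ.suc) (natural k)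
  ρ-⟦⟧ -[1+ k ] x = cong (λ z → ℤ.- z) (ρ-⟦⟧ (+ suc k) x)

  -- In the comparable case no point lies on the prescribed sides, so 𝟘 is an arbitrary default. In
  -- the other case f is sampled at one point of the region.
  leaf : ∀ (f : LocConst Φ) {ins outs} → Covered [] ins outs → Comparable ins outs ⊎ Incomparable ins outs → Expr PosRoot
  leaf f cov (inj₁ _)   = 𝟘
  leaf f cov (inj₂ inc) = ⟦ fun f (proj₁ (regionPoint cov inc)) ⟧

  -- Shannon expansion of f over the positive roots.
  expansion : ∀ (f : LocConst Φ) rest {ins outs} → Covered rest ins outs → Expr PosRoot
  expansion f []         {ins} {outs} cov = leaf f cov (comparable? ins outs)
  expansion f (α ∷ rest) cov =
    var α ⊗ expansion f rest (covered-in cov) ⊕ (𝟙 ⊕ ⊖ var α) ⊗ expansion f rest (covered-out cov)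

  leaf-correct : ∀ (f : LocConst Φ) {ins outs} (cov : Covered [] ins outs) d y → Side ins outs y →
                 fun (ρ (leaf f cov d)) y ≡ fun f y
  leaf-correct f cov (inj₁ (α , β , α∈ , β∈ , α≼β)) y (above , below) =
    ⊥-elim (above-below-absurd y {α} {β} α≼β (above α α∈) (below β β∈))
  leaf-correct f cov (inj₂ inc) y side = let (x , x-side) = regionPoint cov inc in
    trans (ρ-⟦⟧ (fun f x) y) (constant-on-regions f x y (same-side cov x y x-side side))

  -- At y each h α is 0 or 1, so one of the two branches is multiplied by 0; the surviving one
  -- records the side of α on which y lies.
  expansion-correct : ∀ (f : LocConst Φ) rest {ins outs} (cov : Covered rest ins outs) y → Side ins outs y →
                      fun (ρ (expansion f rest cov)) y ≡ fun f y
  expansion-correct f []         {ins} {outs} cov y side = leaf-correct f cov (comparable? ins outs) y side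
  expansion-correct f (α ∷ rest) {ins} {outs} cov y (above , below) = cases (h-values α y)
    where
    a = fun (ρ (expansion f rest (covered-in cov))) y
    b = fun (ρ (expansion f rest (covered-out cov))) y
    open ≡-Reasoning
    cases : _ → fun (h Φ α) y ℤ.* a ℤ.+ (1ℤ ℤ.+ (ℤ.- fun (h Φ α) y)) ℤ.* b ≡ fun f y
    cases (inj₁ (e , α-below)) = begin
      fun (h Φ α) y ℤ.* a ℤ.+ (1ℤ ℤ.+ (ℤ.- fun (h Φ α) y)) ℤ.* b ≡⟨ cong (λ z → z ℤ.* a ℤ.+ (1ℤ ℤ.+ (ℤ.- z)) ℤ.* b) e ⟩
      0ℤ ℤ.* a ℤ.+ 1ℤ ℤ.* b   ≡⟨ cong₂ ℤ._+_ (ℤₚ.*-zeroˡ a) (ℤₚ.*-identityˡ b) ⟩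
      0ℤ ℤ.+ b                ≡⟨ ℤₚ.+-identityˡ b ⟩
      b                       ≡⟨ expansion-correct f rest (covered-out cov) y (above , λ { _ (here refl) → α-below ; β (there β∈) → below β β∈ }) ⟩
      fun f y                 ∎
    cases (inj₂ (e , α-above)) = begin
      fun (h Φ α) y ℤ.* a ℤ.+ (1ℤ ℤ.+ (ℤ.- fun (h Φ α) y)) ℤ.* b ≡⟨ cong (λ z → z ℤ.* a ℤ.+ (1ℤ ℤ.+ (ℤ.- z)) ℤ.* b) e ⟩
      1ℤ ℤ.* a ℤ.+ 0ℤ ℤ.* b   ≡⟨ cong₂ ℤ._+_ (ℤₚ.*-identityˡ a) (ℤₚ.*-zeroˡ b) ⟩
      a ℤ.+ 0ℤ                ≡⟨ ℤₚ.+-identityʳ a ⟩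
      a                       ≡⟨ expansion-correct f rest (covered-in cov) y ((λ { _ (here refl) → α-above ; β (there β∈) → above β β∈ }) , below) ⟩
      fun f y                 ∎

  -- Injectivity of ρ.

  u-cong : ∀ {α β} → coeffs α ≡ coeffs β → var α ≈ var β
  -- Each of α and β lies below the other, so the product of the two variables equals both.
  u-cong {α} {β} e = ≈-trans (≈-sym (rel (minˡ (≼-reflexive {α} {β} e)))) (rel (minʳ (≼-reflexive {β} {α} (sym e))))

  u-idem : ∀ α → var α ⊗ var α ≈ var α
  u-idem α = rel (minˡ (≼-reflexive {α} {α} refl))

  -- m behaves like the product of the u α for α ∈ ins and of the 1 − u β for β ∈ outs.
  record Splits (ins outs : List PosRoot) (m : Expr PosRoot) : Set where
    field
      absorb : ∀ {α} → α ∈ ins → var α ⊗ m ≈ m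
      kill   : ∀ {β} → β ∈ outs → var β ⊗ m ≈ 𝟘
  open Splits

  open SetoidReasoning U.setoid

  ⊗-swap : ∀ a b m → a ⊗ (b ⊗ m) ≈ b ⊗ (a ⊗ m)
  ⊗-swap a b m = ≈-trans (≈-sym (⊗-assoc a b m)) (≈-trans (⊗-cong (⊗-comm a b) ≈-refl) (⊗-assoc b a m))

  ⊗-zeroʳ : ∀ a → a ⊗ 𝟘 ≈ 𝟘
  ⊗-zeroʳ a = U.zeroʳ a

  distrib-minus : ∀ a b c → a ⊗ (b ⊕ ⊖ c) ≈ a ⊗ b ⊕ ⊖ (a ⊗ c)
  distrib-minus a b c = ≈-trans (distribˡ a b (⊖ c)) (⊕-cong ≈-refl (≈-sym (RingProperties.-‿distribʳ-* U.ring a c)))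

  splits-in : ∀ {α ins outs m} → Splits ins outs m → Splits (α ∷ ins) outs (var α ⊗ m)
  splits-in {α} {m = m} s .absorb (here refl) = ≈-trans (≈-sym (⊗-assoc (var α) (var α) m)) (⊗-cong (u-idem α) ≈-refl)
  splits-in {α} {m = m} s .absorb (there β∈)  = ≈-trans (⊗-swap _ (var α) m) (⊗-cong ≈-refl (s .absorb β∈))
  splits-in {α} {m = m} s .kill   β∈          = ≈-trans (⊗-swap _ (var α) m) (≈-trans (⊗-cong ≈-refl (s .kill β∈)) (⊗-zeroʳ (var α)))

  splits-out : ∀ {α ins outs m} → Splits ins outs m → Splits ins (α ∷ outs) (m ⊕ ⊖ (var α ⊗ m))
  splits-out {α} {m = m} s .absorb {β} β∈ = ≈-trans (distrib-minus (var β) m (var α ⊗ m))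
    (⊕-cong (s .absorb β∈) (⊖-cong (≈-trans (⊗-swap (var β) (var α) m) (⊗-cong ≈-refl (s .absorb β∈)))))
  splits-out {α} {m = m} s .kill (here refl) = ≈-trans (distrib-minus (var α) m (var α ⊗ m))
    (≈-trans (⊕-cong ≈-refl (⊖-cong (≈-trans (≈-sym (⊗-assoc (var α) (var α) m)) (⊗-cong (u-idem α) ≈-refl))))
      (U.-‿inverseʳ (var α ⊗ m)))
  splits-out {α} {m = m} s .kill {β} (there β∈) = ≈-trans (distrib-minus (var β) m (var α ⊗ m))
    (≈-trans (⊕-cong (s .kill β∈) (⊖-cong (≈-trans (⊗-swap (var β) (var α) m)
        (≈-trans (⊗-cong ≈-refl (s .kill β∈)) (⊗-zeroʳ (var α))))))
      (U.-‿inverseʳ 𝟘))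

  splits-comparable : ∀ {ins outs m} → Splits ins outs m → Comparable ins outs → m ≈ 𝟘
  splits-comparable {m = m} s (α , β , α∈ , β∈ , α≼β) = begin
    m                        ≈⟨ s .absorb α∈ ⟨
    var α ⊗ m                ≈⟨ ⊗-cong (rel (minˡ α≼β)) ≈-refl ⟨
    (var α ⊗ var β) ⊗ m      ≈⟨ ⊗-assoc (var α) (var β) m ⟩
    var α ⊗ (var β ⊗ m)      ≈⟨ ⊗-cong ≈-refl (s .kill β∈) ⟩
    var α ⊗ 𝟘                ≈⟨ ⊗-zeroʳ (var α) ⟩
    𝟘                        ∎

  -- On m a variable acts as 1 or as 0 according to the list that contains its root, and x lies on
  -- the matching side of 1. The actions then combine along the ring operations in the same way as
  -- the values at x.
  evaluate : ∀ {ins outs m} → Covered [] ins outs → Splits ins outs m → ∀ x → Side ins outs x →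
             ∀ p → p ⊗ m ≈ ⟦ fun (ρ p) x ⟧ ⊗ m
  evaluate {m = m} cov s x (above , below) = go
    where
    go : ∀ p → p ⊗ m ≈ ⟦ fun (ρ p) x ⟧ ⊗ m
    go (var α) with cov α
    ... | β , e , inj₂ (inj₁ β∈) = begin
      var α ⊗ m                  ≈⟨ ⊗-cong (u-cong {β} {α} e) ≈-refl ⟨
      var β ⊗ m                  ≈⟨ s .absorb β∈ ⟩
      m                          ≈⟨ ⊗-identityˡ m ⟨
      𝟙 ⊗ m                      ≈⟨ ⊗-cong (U.+-identityʳ 𝟙) ≈-refl ⟨
      ⟦ 1ℤ ⟧ ⊗ m                 ≈⟨ ⊗-cong (⟦⟧-cong (h-above α x (subst (λ c → 1ℝ < c ⟨ coords x ⟩) e (above β β∈)))) ≈-refl ⟨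
      ⟦ fun (h Φ α) x ⟧ ⊗ m      ∎
    ... | β , e , inj₂ (inj₂ β∈) = begin
      var α ⊗ m                  ≈⟨ ⊗-cong (u-cong {β} {α} e) ≈-refl ⟨
      var β ⊗ m                  ≈⟨ s .kill β∈ ⟩
      𝟘                          ≈⟨ U.zeroˡ m ⟨
      ⟦ 0ℤ ⟧ ⊗ m                 ≈⟨ ⊗-cong (⟦⟧-cong (h-below α x (subst (λ c → c ⟨ coords x ⟩ < 1ℝ) e (below β β∈)))) ≈-refl ⟨
      ⟦ fun (h Φ α) x ⟧ ⊗ m      ∎
    go 𝟘       = ≈-refl
    go 𝟙       = ⊗-cong (≈-sym (U.+-identityʳ 𝟙)) ≈-refl
    go (a ⊕ b) = begin
      (a ⊕ b) ⊗ m                                      ≈⟨ U.distribʳ m a b ⟩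
      a ⊗ m ⊕ b ⊗ m                                    ≈⟨ ⊕-cong (go a) (go b) ⟩
      ⟦ fun (ρ a) x ⟧ ⊗ m ⊕ ⟦ fun (ρ b) x ⟧ ⊗ m        ≈⟨ U.distribʳ m _ _ ⟨
      (⟦ fun (ρ a) x ⟧ ⊕ ⟦ fun (ρ b) x ⟧) ⊗ m          ≈⟨ ⊗-cong (⟦⟧-+ (fun (ρ a) x) (fun (ρ b) x)) ≈-refl ⟨
      ⟦ fun (ρ a) x ℤ.+ fun (ρ b) x ⟧ ⊗ m              ∎
    go (a ⊗ b) = begin
      (a ⊗ b) ⊗ m                                      ≈⟨ ⊗-assoc a b m ⟩
      a ⊗ (b ⊗ m)                                      ≈⟨ ⊗-cong ≈-refl (go b) ⟩
      a ⊗ (⟦ fun (ρ b) x ⟧ ⊗ m)                        ≈⟨ ⊗-swap a ⟦ fun (ρ b) x ⟧ m ⟩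
      ⟦ fun (ρ b) x ⟧ ⊗ (a ⊗ m)                        ≈⟨ ⊗-cong ≈-refl (go a) ⟩
      ⟦ fun (ρ b) x ⟧ ⊗ (⟦ fun (ρ a) x ⟧ ⊗ m)          ≈⟨ ⊗-swap ⟦ fun (ρ b) x ⟧ ⟦ fun (ρ a) x ⟧ m ⟩
      ⟦ fun (ρ a) x ⟧ ⊗ (⟦ fun (ρ b) x ⟧ ⊗ m)          ≈⟨ ⊗-assoc _ _ m ⟨
      (⟦ fun (ρ a) x ⟧ ⊗ ⟦ fun (ρ b) x ⟧) ⊗ m          ≈⟨ ⊗-cong (⟦⟧-* (fun (ρ a) x) (fun (ρ b) x)) ≈-refl ⟨
      ⟦ fun (ρ a) x ℤ.* fun (ρ b) x ⟧ ⊗ m              ∎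
    go (⊖ a)   = begin
      (⊖ a) ⊗ m                                        ≈⟨ RingProperties.-‿distribˡ-* U.ring a m ⟨
      ⊖ (a ⊗ m)                                        ≈⟨ ⊖-cong (go a) ⟩
      ⊖ (⟦ fun (ρ a) x ⟧ ⊗ m)                          ≈⟨ RingProperties.-‿distribˡ-* U.ring _ m ⟩
      (⊖ ⟦ fun (ρ a) x ⟧) ⊗ m                          ≈⟨ ⊗-cong (⟦⟧-neg (fun (ρ a) x)) ≈-refl ⟨
      ⟦ ℤ.- fun (ρ a) x ⟧ ⊗ m                          ∎

  module _ (p : Expr PosRoot) (ρp≡0 : ∀ x → fun (ρ p) x ≡ 0ℤ) where

    kernel-leaf : ∀ {ins outs m} → Covered [] ins outs → Splits ins outs m →
                  Comparable ins outs ⊎ Incomparable ins outs → p ⊗ m ≈ 𝟘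
    kernel-leaf cov s (inj₁ c)   = ≈-trans (⊗-cong ≈-refl (splits-comparable s c)) (⊗-zeroʳ p)
    kernel-leaf {m = m} cov s (inj₂ inc) = let (x , side) = regionPoint cov inc in
      ≈-trans (evaluate cov s x side p) (≈-trans (⊗-cong (⟦⟧-cong (ρp≡0 x)) ≈-refl) (U.zeroˡ m))

    -- Stated for any m with the `Splits` property, so that the induction can start at m = 𝟙 with
    -- empty lists and replace m by u α m and (1 - u α) m, whose sum is m.
    kernel-split : ∀ rest {ins outs m} → Covered rest ins outs → Splits ins outs m → p ⊗ m ≈ 𝟘
    kernel-split []         {ins} {outs} cov s = kernel-leaf cov s (comparable? ins outs)
    kernel-split (α ∷ rest) {m = m} cov s = begin
      p ⊗ m                                                ≈⟨ ⊗-cong ≈-refl split ⟩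
      p ⊗ (var α ⊗ m ⊕ (m ⊕ ⊖ (var α ⊗ m)))                ≈⟨ distribˡ p _ _ ⟩
      p ⊗ (var α ⊗ m) ⊕ p ⊗ (m ⊕ ⊖ (var α ⊗ m))            ≈⟨ ⊕-cong (kernel-split rest (covered-in cov) (splits-in s))
                                                                     (kernel-split rest (covered-out cov) (splits-out s)) ⟩
      𝟘 ⊕ 𝟘                                                ≈⟨ ⊕-identityˡ 𝟘 ⟩
      𝟘                                                    ∎
      where
      split : m ≈ var α ⊗ m ⊕ (m ⊕ ⊖ (var α ⊗ m))
      split = ≈-sym (≈-trans (≈-sym (⊕-assoc (var α ⊗ m) m (⊖ (var α ⊗ m))))
        (AGroupProperties.xyx⁻¹≈y U.+-abelianGroup (var α ⊗ m) m))

    kernel-trivial : p ≈ 𝟘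
    kernel-trivial = ≈-trans (≈-sym (U.*-identityʳ p)) (kernel-split positiveRoots covered-all (record { absorb = λ () ; kill = λ () }))

  ρ-injective : ∀ {a b} → (∀ x → fun (ρ a) x ≡ fun (ρ b) x) → a ≈ b
  ρ-injective {a} {b} e = AGroupProperties.x∙y⁻¹≈ε⇒x≈y U.+-abelianGroup a b (kernel-trivial (a ⊕ ⊖ b) (λ x → ℤₚ.i≡j⇒i-j≡0 (e x)))

  ρ-surjective : ∀ (f : LocConst Φ) → ∃[ p ] (∀ {q} → q ≈ p → ∀ x → fun (ρ q) x ≡ fun f x)
  ρ-surjective f = expansion f positiveRoots covered-all , λ e x →
    trans (ρ-cong e x) (expansion-correct f positiveRoots covered-all x ((λ _ ()) , λ _ ()))

  ρ-filteredMorphism : IsFilteredMorphism (U Φ) (H Φ) ρ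
  ρ-filteredMorphism = record
    { isRingHomomorphism = ρ-homomorphism
    ; preserves = FiltrationMap.filtration-map (URing Φ) (HRing Φ) ρ-homomorphism (u Φ) (h Φ) (λ _ _ → refl) }

  ρ-filteredIsomorphism : IsFilteredIsomorphism (U Φ) (H Φ) ρ
  ρ-filteredIsomorphism = record
    { isRingIsomorphism = record
      { isRingMonomorphism = record { isRingHomomorphism = ρ-homomorphism ; injective = ρ-injective }
      ; surjective = ρ-surjective }
    ; image = FiltrationMap.filtration-image (URing Φ) (HRing Φ) ρ-homomorphism (u Φ) (h Φ) (λ _ _ → refl) }

theorem6p3 : ∀ {n : ℕ} (X : Dynkin n) (Φ : RootSystem X) →
    let module U = FilteredRing (U Φ)
        module H = FilteredRing (H Φ)
    in
    Σ[ ρ ∈ (U.Carrier → H.Carrier) ]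
      (IsFilteredMorphism (U Φ) (H Φ) ρ × (∀ α → ρ (u Φ α) H.≈ h Φ α)) ×
      (∀ (σ : U.Carrier → H.Carrier) → IsFilteredMorphism (U Φ) (H Φ) σ →
         (∀ α → σ (u Φ α) H.≈ h Φ α) → ∀ a → σ a H.≈ ρ a) ×
      IsFilteredIsomorphism (U Φ) (H Φ) ρ
theorem6p3 X Φ = ρ , (ρ-filteredMorphism , λ _ _ → refl) ,
  (λ σ σ-morphism → ρ-unique σ (IsFilteredMorphism.isRingHomomorphism σ-morphism)) , ρ-filteredIsomorphism
  where open Isomorphism Φ
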